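{- For all $\lambda\in\mathbf{k}$ and $v\in\mathcal{V}^{\mathrm{B}}$, one has in $\mathcal{V}^{\mathrm{B}}\otimes\mathcal{V}^{\mathrm{B}}$: \[\Delta^{\mathcal{W},\mathrm{B}}\big(\lambda+v(X_1-1)\big)=\lambda\,(1\otimes1)+\mathsf{r}\underline{\mathrm{row}}\cdot\mathsf{r}\underline{\rho}(v)\cdot\mathsf{r}\underline{\mathrm{col}},\] i.e. $\Delta^{\mathcal{W},\mathrm{B}}$ followed by the inclusion $\mathcal{W}^{\mathrm{B}}\otimes\mathcal{W}^{\mathrm{B}}\hookrightarrow\mathcal{V}^{\mathrm{B}}\otimes\mathcal{V}^{\mathrm{B}}$ equals $\Delta_{\mathcal{O}^{\mathrm{B}}_{\mathsf{mat}}}$ composed with the isomorphism $\mathcal{W}^{\mathrm{B}}\cong\mathbf{k}\oplus(\mathcal{V}^{\mathrm{B}},\cdot_{X_1-1})$.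
   Context: $\mathbf{k}$ is a commutative $\mathbb{Q}$-algebra; $F_2$ free on $X_0,X_1$, $\mathcal{V}^{\mathrm{B}}=\mathbf{k}F_2$; in $\mathcal{V}^{\mathrm{B}}\otimes\mathcal{V}^{\mathrm{B}}$, $X_i=X_i\otimes1$, $Y_i=1\otimes X_i$. $\mathrm{op}_G$ is the antiautomorphism $g\mapsto g^{ -1}$ of $\mathbf{k}G$. $\underline{\rho}:\mathcal{V}^{\mathrm{B}}\to M_3(\mathcal{V}^{\mathrm{B}}\otimes\mathcal{V}^{\mathrm{B}})$ is the algebra morphism with $\underline{\rho}(X_0)=\begin{pmatrix}X_0&0&0\\0&(1-X_1)X_0+Y_1^{ -1}Y_0Y_1&(1-X_1)X_0X_1\\0&X_0-Y_1^{ -1}Y_0Y_1X_1^{ -1}&X_0X_1\end{pmatrix}$, $\underline{\rho}(X_1)=\begin{pmatrix}(X_1-1)Y_1+1&Y_1(1-Y_1)&0\\1-X_1&Y_1&0\\0&0&1\end{pmatrix}$; with $D=\mathrm{diag}(Y_1,X_1,(X_0X_1)^{ -1}Y_1^{ -1}Y_0Y_1)$, $\mathsf{r}\underline{\rho}(v):=D^{ -1}M_3(\mathrm{op}_{F_2^2})({}^t\underline{\rho}(\mathrm{op}_{F_2}(v)))D$ (entrywise $\mathrm{op}$, transpose). $\mathsf{r}\underline{\mathrm{row}}=(Y_1,\,-X_1Y_1,\,0)\in M_{1,3}$, $\mathsf{r}\underline{\mathrm{col}}=Y_1^{ -1}\,{}^t(X_1-1,\,1-Y_1,\,0)\in M_{3,1}$.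 For an algebra $B$ and $e\in B$, $\mathbf{k}\oplus(B,\cdot_e)$ is the algebra with product $(\lambda,b)(\lambda',b')=(\lambda\lambda',\lambda b'+\lambda'b+beb')$; $\Delta_{\mathcal{O}^{\mathrm{B}}_{\mathsf{mat}}}:\mathbf{k}\oplus(\mathcal{V}^{\mathrm{B}},\cdot_{X_1-1})\to\mathcal{V}^{\mathrm{B}}\otimes\mathcal{V}^{\mathrm{B}}$ is $(\lambda,v)\mapsto\lambda+\mathsf{r}\underline{\mathrm{row}}\,\mathsf{r}\underline{\rho}(v)\,\mathsf{r}\underline{\mathrm{col}}$. $\mathcal{W}^{\mathrm{B}}=\mathbf{k}\oplus\mathcal{V}^{\mathrm{B}}(X_1-1)$ is a subalgebra, isomorphic to $\mathbf{k}\oplus(\mathcal{V}^{\mathrm{B}},\cdot_{X_1-1})$ via $(\lambda,v)\mapsto\lambda+v(X_1-1)$; it is generated by $X_1^{ -1}$ and $X_0^n(X_1-1)$, $n\in\mathbb{Z}$. $\Delta^{\mathcal{W},\mathrm{B}}:\mathcal{W}^{\mathrm{B}}\to\mathcal{W}^{\mathrm{B}}\otimes\mathcal{W}^{\mathrm{B}}$ is the (known to exist) algebra morphism with $\Delta^{\mathcal{W},\mathrm{B}}(X_1^{ -1})=X_1^{ -1}\otimes X_1^{ -1}$ and $\Delta^{\mathcal{W},\mathrm{B}}(X_0^n(X_1-1))=X_0^n(X_1-1)\otimes1+1\otimes X_0^n(X_1-1)-\sum_{k=1}^{n-1}X_0^k(X_1-1)\otimes X_0^{n-k}(X_1-1)$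 for $n\in\mathbb{Z}$, with the convention $\sum_{k=p}^qf(k)=f(p)+\dots+f(q)$ if $q>p-1$, $0$ if $q=p-1$, $-f(p-1)-\dots-f(q+1)$ if $q<p-1$. -}

module Defs where

open import Algebra.Bundles using (CommutativeRing; Group; Monoid; Ring)
import Algebra.Construct.DirectProduct as DirectProduct
import Algebra.Definitions.RawMonoid as RawMonoidDefinitions
open import Algebra.Morphism.Structures using (IsRingHomomorphism; IsGroupHomomorphism)
import Algebra.Properties.AbelianGroup as AbelianGroupProperties
import Algebra.Properties.Group as GroupProperties
import Algebra.Properties.Ring as RingProperties
import Algebra.Properties.Semiring.Sum as Sum
open import Data.Bool.Base using (Bool; true; false; not; if_then_else_)
open import Data.Bool.Properties using (not-involutive)
open import Data.Fin.Base using (Fin; zero; suc; toℕ)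
open import Data.Fin.Patterns using (0F; 1F; 2F)
open import Data.Fin.Properties using (_≟_)
open import Data.Integer.Base as ℤ using (ℤ; +_; -[1+_])
open import Data.List.Base as List using (List; []; _∷_; [_]; _++_; map; concatMap; foldr; reverse)
import Data.List.Properties as List
open import Data.Nat.Base as ℕ using (ℕ)
open import Data.Product.Base using (Σ; _×_; _,_; ∃₂; map₁; map₂; proj₁; proj₂)
import Data.Vec.Functional as Vector
open import Function.Base using (_∘_)
open import Level using (Level; _⊔_) renaming (suc to lsuc)
open import Relation.Binary.Bundles using (Setoid)
open import Relation.Binary.Construct.Closure.Equivalence as EqClosure using (EqClosure)
open import Relation.Binary.Core using (Rel)
open import Relation.Binary.PropositionalEquality.Core as ≡ using (_≡_)
import Relation.Binary.Reasoning.Setoid as SetoidReasoning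
open import Relation.Nullary.Decidable using (does; yes; no)

-- Unital associative k-algebras, with scalars acting through a central
-- structure map η.
record KAlgebra {c ℓ} (k : CommutativeRing c ℓ) (a r : Level) : Set (c ⊔ ℓ ⊔ lsuc (a ⊔ r)) where
  private module k = CommutativeRing k
  field
    ring : Ring a r
  open Ring ring public
  field
    η : k.Carrier → Carrier
    η-isRingHomomorphism : IsRingHomomorphism k.rawRing rawRing η
    η-central : ∀ c x → η c * x ≈ x * η c

  open IsRingHomomorphism η-isRingHomomorphism public using ()
    renaming (⟦⟧-cong to η-cong; +-homo to η-+; *-homo to η-*; 0#-homo to η-0; 1#-homo to η-1; -‿homo to η-neg)

  infixr 7 _•_

  _•_ : k.Carrier → Carrier → Carrier
  c • x = η c * x

record AlgebraHom {c ℓ} {k : CommutativeRing c ℓ} {a r b s}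
                  (A : KAlgebra k a r) (B : KAlgebra k b s) : Set (c ⊔ a ⊔ r ⊔ b ⊔ s) where
  private
    module k = CommutativeRing k
    module A = KAlgebra A
    module B = KAlgebra B
  field
    ⟦_⟧ : A.Carrier → B.Carrier
    isRingHomomorphism : IsRingHomomorphism A.rawRing B.rawRing ⟦_⟧
    η-homo : ∀ (c : k.Carrier) → ⟦ A.η c ⟧ B.≈ B.η c

LinComb : ∀ {c ℓ x} → CommutativeRing c ℓ → Set x → Set (c ⊔ x)
LinComb k X = List (CommutativeRing.Carrier k × X)

module Span {c ℓ x r} (k : CommutativeRing c ℓ) {X : Set x} (R : X → LinComb k X → Set r) where
  private module k = CommutativeRing k

  scale : k.Carrier → LinComb k X → LinComb k X
  scale c = map (map₁ (c k.*_))

  infix 4 _≈_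

  -- The least k-module congruence on formal linear combinations that
  -- identifies a generator x with u whenever R x u.
  data _≈_ : Rel (LinComb k X) (c ⊔ ℓ ⊔ x ⊔ r) where
    ≈-refl  : ∀ {u} → u ≈ u
    ≈-sym   : ∀ {u v} → u ≈ v → v ≈ u
    ≈-trans : ∀ {u v w} → u ≈ v → v ≈ w → u ≈ w
    ++-cong : ∀ {u u₁ v v₁} → u ≈ u₁ → v ≈ v₁ → u ++ v ≈ u₁ ++ v₁
    ++-comm : ∀ u v → u ++ v ≈ v ++ u
    coeff   : ∀ {c d} x → c k.≈ d → [ c , x ] ≈ [ d , x ]
    merge   : ∀ c d x → (c , x) ∷ (d , x) ∷ [] ≈ [ c k.+ d , x ]
    vanish  : ∀ x → [ k.0# , x ] ≈ []
    relate  : ∀ c {x u} → R x u → [ c , x ] ≈ scale c u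

  setoid : Setoid (c ⊔ x) (c ⊔ ℓ ⊔ x ⊔ r)
  setoid = record
    { _≈_ = _≈_
    ; isEquivalence = record { refl = ≈-refl ; sym = ≈-sym ; trans = ≈-trans } }

  open SetoidReasoning setoid

  ≡⇒≈ : ∀ {u v} → u ≡ v → u ≈ v
  ≡⇒≈ ≡.refl = ≈-refl

  ∷-cong : ∀ {c d x u v} → c k.≈ d → u ≈ v → (c , x) ∷ u ≈ (d , x) ∷ v
  ∷-cong e p = ++-cong (coeff _ e) p

  interchange : ∀ u v w z → (u ++ v) ++ (w ++ z) ≈ (u ++ w) ++ (v ++ z)
  interchange u v w z = begin
    (u ++ v) ++ (w ++ z)  ≡⟨ List.++-assoc u v (w ++ z) ⟩
    u ++ (v ++ (w ++ z))  ≡⟨ ≡.cong (u ++_) (List.++-assoc v w z) ⟨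
    u ++ ((v ++ w) ++ z)  ≈⟨ ++-cong (≈-refl {u}) (++-cong (++-comm v w) ≈-refl) ⟩
    u ++ ((w ++ v) ++ z)  ≡⟨ ≡.cong (u ++_) (List.++-assoc w v z) ⟩
    u ++ (w ++ (v ++ z))  ≡⟨ List.++-assoc u w (v ++ z) ⟨
    (u ++ w) ++ (v ++ z)  ∎

  scale-++ : ∀ c u v → scale c (u ++ v) ≡ scale c u ++ scale c v
  scale-++ c = List.map-++ _

  scale-scale : ∀ c d u → scale (c k.* d) u ≈ scale c (scale d u)
  scale-scale c d [] = ≈-refl
  scale-scale c d (_ ∷ u) = ∷-cong (k.*-assoc c d _) (scale-scale c d u)

  scale-one : ∀ u → scale k.1# u ≈ u
  scale-one [] = ≈-refl
  scale-one (_ ∷ u) = ∷-cong (k.*-identityˡ _) (scale-one u)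

  scale-cong : ∀ c {u v} → u ≈ v → scale c u ≈ scale c v
  scale-cong c ≈-refl = ≈-refl
  scale-cong c (≈-sym p) = ≈-sym (scale-cong c p)
  scale-cong c (≈-trans p q) = ≈-trans (scale-cong c p) (scale-cong c q)
  scale-cong c (++-cong {u} {u₁} {v} {v₁} p q) = begin
    scale c (u ++ v)           ≡⟨ scale-++ c u v ⟩
    scale c u ++ scale c v     ≈⟨ ++-cong (scale-cong c p) (scale-cong c q) ⟩
    scale c u₁ ++ scale c v₁   ≡⟨ scale-++ c u₁ v₁ ⟨
    scale c (u₁ ++ v₁)         ∎
  scale-cong c (++-comm u v) = begin
    scale c (u ++ v)        ≡⟨ scale-++ c u v ⟩
    scale c u ++ scale c v  ≈⟨ ++-comm (scale c u) _ ⟩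
    scale c v ++ scale c u  ≡⟨ scale-++ c v u ⟨
    scale c (v ++ u)        ∎
  scale-cong c (coeff x e) = coeff x (k.*-congˡ e)
  scale-cong c (merge d e x) = ≈-trans (merge _ _ x) (coeff x (k.sym (k.distribˡ c d e)))
  scale-cong c (vanish x) = ≈-trans (coeff x (k.zeroʳ c)) (vanish x)
  scale-cong c (relate d {u = u} p) = ≈-trans (relate (c k.* d) p) (scale-scale c d u)

  neg : LinComb k X → LinComb k X
  neg = map (map₁ (k.-_))

  neg-inverseˡ : ∀ u → neg u ++ u ≈ []
  neg-inverseˡ [] = ≈-refl
  neg-inverseˡ ((c , x) ∷ u) = begin
    ((k.- c , x) ∷ neg u) ++ ((c , x) ∷ u)       ≈⟨ interchange [ k.- c , x ] (neg u) [ c , x ] u ⟩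
    ((k.- c , x) ∷ (c , x) ∷ []) ++ (neg u ++ u) ≈⟨ ++-cong (merge _ _ x) (neg-inverseˡ u) ⟩
    (k.- c k.+ c , x) ∷ []                       ≈⟨ coeff x (k.-‿inverseˡ c) ⟩
    [ k.0# , x ]                                 ≈⟨ vanish x ⟩
    []                                           ∎

  neg-inverseʳ : ∀ u → u ++ neg u ≈ []
  neg-inverseʳ u = ≈-trans (++-comm u (neg u)) (neg-inverseˡ u)

  neg-cong : ∀ {u v} → u ≈ v → neg u ≈ neg v
  neg-cong {u} {v} p = begin
    neg u                    ≡⟨ List.++-identityʳ (neg u) ⟨
    neg u ++ []              ≈⟨ ++-cong (≈-refl {neg u}) (neg-inverseʳ v) ⟨
    neg u ++ (v ++ neg v)    ≡⟨ List.++-assoc (neg u) v (neg v) ⟨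
    (neg u ++ v) ++ neg v    ≈⟨ ++-cong (++-cong (≈-refl {neg u}) p) ≈-refl ⟨
    (neg u ++ u) ++ neg v    ≈⟨ ++-cong (neg-inverseˡ u) ≈-refl ⟩
    neg v                    ∎

module Product {c ℓ x} (k : CommutativeRing c ℓ) {X : Set x} (_∙_ : X → X → X) where
  private module k = CommutativeRing k

  infixl 7 _⋆_ _*_

  _⋆_ : k.Carrier × X → LinComb k X → LinComb k X
  (c , x) ⋆ v = map (λ (d , y) → c k.* d , x ∙ y) v

  _*_ : LinComb k X → LinComb k X → LinComb k X
  u * v = concatMap (_⋆ v) u

-- The relations R include the equality of M, and their span in k[M] is
-- a two-sided ideal.
record IsIdealRelation {c ℓ m e r} (k : CommutativeRing c ℓ) (M : Monoid m e)
                       (R : Monoid.Carrier M → LinComb k (Monoid.Carrier M) → Set r) : Set (c ⊔ ℓ ⊔ m ⊔ e ⊔ r) where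
  private module k = CommutativeRing k
  open Monoid M using (_∙_) renaming (_≈_ to _≈ᴹ_)
  open Span k R
  open Product k _∙_
  field
    R-cong : ∀ {x y} → x ≈ᴹ y → R x [ k.1# , y ]
    R-∙ʳ   : ∀ {x u} → R x u → ∀ z → [ k.1# , x ∙ z ] ≈ u * [ k.1# , z ]
    R-∙ˡ   : ∀ {x u} → R x u → ∀ z → [ k.1# , z ∙ x ] ≈ [ k.1# , z ] * u

module MonoidAlgebra {c ℓ m e r} (k : CommutativeRing c ℓ) (M : Monoid m e)
  (R : Monoid.Carrier M → LinComb k (Monoid.Carrier M) → Set r)
  (isIdealRelation : IsIdealRelation k M R)
  where

  open Monoid M using (_∙_; ε) renaming (Carrier to X; _≈_ to _≈ᴹ_)
  open Product k _∙_
  open Span k R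
  open IsIdealRelation isIdealRelation

  private
    module k = CommutativeRing k
    module M = Monoid M
    C = LinComb k X

  open SetoidReasoning setoid

  single : ∀ {c d x y} → c k.≈ d → x ≈ᴹ y → [ c , x ] ≈ [ d , y ]
  single p q = ≈-trans (relate _ (R-cong q)) (coeff _ (k.trans (k.*-identityʳ _) p))

  cons : ∀ {c d x y u v} → c k.≈ d → x ≈ᴹ y → u ≈ v → (c , x) ∷ u ≈ (d , y) ∷ v
  cons p q s = ++-cong (single p q) s

  *-distribʳ-++ : ∀ w u v → (u ++ v) * w ≡ u * w ++ v * w
  *-distribʳ-++ w u v = List.concatMap-++ (_⋆ w) u v

  *-distribˡ-++ : ∀ u v w → u * (v ++ w) ≈ u * v ++ u * w
  *-distribˡ-++ [] v w = ≈-refl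
  *-distribˡ-++ (t ∷ u) v w = begin
    t ⋆ (v ++ w) ++ u * (v ++ w)           ≡⟨ ≡.cong (_++ u * (v ++ w)) (List.map-++ _ v w) ⟩
    (t ⋆ v ++ t ⋆ w) ++ u * (v ++ w)       ≈⟨ ++-cong (≈-refl {t ⋆ v ++ t ⋆ w}) (*-distribˡ-++ u v w) ⟩
    (t ⋆ v ++ t ⋆ w) ++ (u * v ++ u * w)   ≈⟨ interchange (t ⋆ v) (t ⋆ w) (u * v) (u * w) ⟩
    (t ⋆ v ++ u * v) ++ (t ⋆ w ++ u * w)   ∎

  *-zeroʳ : ∀ u → u * [] ≡ []
  *-zeroʳ [] = ≡.refl
  *-zeroʳ (_ ∷ u) = *-zeroʳ u

  scale-*ˡ : ∀ c u d z → scale (c k.* d) (u * [ k.1# , z ]) ≈ scale c u * [ d , z ]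
  scale-*ˡ c [] d z = ≈-refl
  scale-*ˡ c ((f , x) ∷ u) d z = ∷-cong lemma (scale-*ˡ c u d z)
    where
    lemma : (c k.* d) k.* (f k.* k.1#) k.≈ (c k.* f) k.* d
    lemma = k.trans (k.*-congˡ (k.*-identityʳ f)) (k.trans (k.*-assoc c d f)
              (k.trans (k.*-congˡ (k.*-comm d f)) (k.sym (k.*-assoc c f d))))

  scale-*ʳ : ∀ c u d z → scale (d k.* c) ([ k.1# , z ] * u) ≈ [ d , z ] * scale c u
  scale-*ʳ c [] d z = ≈-refl
  scale-*ʳ c ((f , x) ∷ u) d z = ∷-cong lemma (scale-*ʳ c u d z)
    where
    lemma : (d k.* c) k.* (k.1# k.* f) k.≈ d k.* (c k.* f)
    lemma = k.trans (k.*-congˡ (k.*-identityˡ f)) (k.*-assoc d c f)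

  *-congʳ-single : ∀ t {u v} → u ≈ v → u * [ t ] ≈ v * [ t ]
  *-congʳ-single t ≈-refl = ≈-refl
  *-congʳ-single t (≈-sym p) = ≈-sym (*-congʳ-single t p)
  *-congʳ-single t (≈-trans p q) = ≈-trans (*-congʳ-single t p) (*-congʳ-single t q)
  *-congʳ-single t (++-cong {u} {u₁} {v} {v₁} p q) = begin
    (u ++ v) * [ t ]              ≡⟨ *-distribʳ-++ [ t ] u v ⟩
    u * [ t ] ++ v * [ t ]        ≈⟨ ++-cong (*-congʳ-single t p) (*-congʳ-single t q) ⟩
    u₁ * [ t ] ++ v₁ * [ t ]      ≡⟨ *-distribʳ-++ [ t ] u₁ v₁ ⟨
    (u₁ ++ v₁) * [ t ]            ∎
  *-congʳ-single t (++-comm u v) = begin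
    (u ++ v) * [ t ]              ≡⟨ *-distribʳ-++ [ t ] u v ⟩
    u * [ t ] ++ v * [ t ]        ≈⟨ ++-comm (u * [ t ]) _ ⟩
    v * [ t ] ++ u * [ t ]        ≡⟨ *-distribʳ-++ [ t ] v u ⟨
    (v ++ u) * [ t ]              ∎
  *-congʳ-single t (coeff x p) = coeff _ (k.*-congʳ p)
  *-congʳ-single t (merge c d x) = ≈-trans (merge _ _ _) (coeff _ (k.sym (k.distribʳ _ c d)))
  *-congʳ-single t (vanish x) = ≈-trans (coeff _ (k.zeroˡ _)) (vanish _)
  *-congʳ-single (d , z) (relate c {x} {u} p) = begin
    [ c k.* d , x ∙ z ]                    ≈⟨ coeff _ (k.*-identityʳ _) ⟨
    scale (c k.* d) [ k.1# , x ∙ z ]       ≈⟨ scale-cong (c k.* d) (R-∙ʳ p z) ⟩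
    scale (c k.* d) (u * [ k.1# , z ])     ≈⟨ scale-*ˡ c u d z ⟩
    scale c u * [ d , z ]                  ∎

  *-congʳ : ∀ v {u u₁} → u ≈ u₁ → u * v ≈ u₁ * v
  *-congʳ [] {u} {u₁} p = ≡⇒≈ (≡.trans (*-zeroʳ u) (≡.sym (*-zeroʳ u₁)))
  *-congʳ (t ∷ v) {u} {u₁} p = begin
    u * (t ∷ v)             ≈⟨ *-distribˡ-++ u [ t ] v ⟩
    u * [ t ] ++ u * v      ≈⟨ ++-cong (*-congʳ-single t p) (*-congʳ v p) ⟩
    u₁ * [ t ] ++ u₁ * v    ≈⟨ *-distribˡ-++ u₁ [ t ] v ⟨
    u₁ * (t ∷ v)            ∎

  ⋆-cong : ∀ t {u v} → u ≈ v → t ⋆ u ≈ t ⋆ v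
  ⋆-cong t ≈-refl = ≈-refl
  ⋆-cong t (≈-sym p) = ≈-sym (⋆-cong t p)
  ⋆-cong t (≈-trans p q) = ≈-trans (⋆-cong t p) (⋆-cong t q)
  ⋆-cong t (++-cong {u} {u₁} {v} {v₁} p q) = begin
    t ⋆ (u ++ v)          ≡⟨ List.map-++ _ u v ⟩
    t ⋆ u ++ t ⋆ v        ≈⟨ ++-cong (⋆-cong t p) (⋆-cong t q) ⟩
    t ⋆ u₁ ++ t ⋆ v₁      ≡⟨ List.map-++ _ u₁ v₁ ⟨
    t ⋆ (u₁ ++ v₁)        ∎
  ⋆-cong t (++-comm u v) = begin
    t ⋆ (u ++ v)          ≡⟨ List.map-++ _ u v ⟩
    t ⋆ u ++ t ⋆ v        ≈⟨ ++-comm (t ⋆ u) _ ⟩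
    t ⋆ v ++ t ⋆ u        ≡⟨ List.map-++ _ v u ⟨
    t ⋆ (v ++ u)          ∎
  ⋆-cong t (coeff x p) = coeff _ (k.*-congˡ p)
  ⋆-cong t (merge c d x) = ≈-trans (merge _ _ _) (coeff _ (k.sym (k.distribˡ _ c d)))
  ⋆-cong t (vanish x) = ≈-trans (coeff _ (k.zeroʳ _)) (vanish _)
  ⋆-cong (d , z) (relate c {x} {u} p) = begin
    [ d k.* c , z ∙ x ]                    ≈⟨ coeff _ (k.*-identityʳ _) ⟨
    scale (d k.* c) [ k.1# , z ∙ x ]       ≈⟨ scale-cong (d k.* c) (R-∙ˡ p z) ⟩
    scale (d k.* c) ([ k.1# , z ] * u)     ≈⟨ scale-*ʳ c u d z ⟩
    (d , z) ⋆ scale c u ++ []              ≡⟨ List.++-identityʳ _ ⟩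
    (d , z) ⋆ scale c u                    ∎

  *-congˡ : ∀ u {v v₁} → v ≈ v₁ → u * v ≈ u * v₁
  *-congˡ [] p = ≈-refl
  *-congˡ (t ∷ u) p = ++-cong (⋆-cong t p) (*-congˡ u p)

  *-cong : ∀ {u u₁ v v₁} → u ≈ u₁ → v ≈ v₁ → u * v ≈ u₁ * v₁
  *-cong {u₁ = u₁} {v} p q = ≈-trans (*-congʳ v p) (*-congˡ u₁ q)

  ⋆-assoc : ∀ s t w → (proj₁ s k.* proj₁ t , proj₂ s ∙ proj₂ t) ⋆ w ≈ s ⋆ (t ⋆ w)
  ⋆-assoc s t [] = ≈-refl
  ⋆-assoc s t (_ ∷ w) = cons (k.*-assoc _ _ _) (M.assoc _ _ _) (⋆-assoc s t w)

  ⋆-*-assoc : ∀ t v w → (t ⋆ v) * w ≈ t ⋆ (v * w)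
  ⋆-*-assoc t [] w = ≈-refl
  ⋆-*-assoc t (s ∷ v) w = begin
    (proj₁ t k.* proj₁ s , proj₂ t ∙ proj₂ s) ⋆ w ++ (t ⋆ v) * w  ≈⟨ ++-cong (⋆-assoc t s w) (⋆-*-assoc t v w) ⟩
    t ⋆ (s ⋆ w) ++ t ⋆ (v * w)                                    ≡⟨ List.map-++ _ (s ⋆ w) (v * w) ⟨
    t ⋆ (s ⋆ w ++ v * w)                                          ∎

  *-assoc : ∀ u v w → (u * v) * w ≈ u * (v * w)
  *-assoc [] v w = ≈-refl
  *-assoc (t ∷ u) v w = begin
    (t ⋆ v ++ u * v) * w            ≡⟨ *-distribʳ-++ w (t ⋆ v) (u * v) ⟩
    (t ⋆ v) * w ++ (u * v) * w      ≈⟨ ++-cong (⋆-*-assoc t v w) (*-assoc u v w) ⟩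
    t ⋆ (v * w) ++ u * (v * w)      ∎

  scalar : k.Carrier → C
  scalar c = [ c , ε ]

  scalar-* : ∀ c u → scalar c * u ≈ scale c u
  scalar-* c [] = ≈-refl
  scalar-* c (_ ∷ u) = cons k.refl (M.identityˡ _) (scalar-* c u)

  *-scalar : ∀ c u → u * scalar c ≈ scale c u
  *-scalar c [] = ≈-refl
  *-scalar c (_ ∷ u) = cons (k.*-comm _ c) (M.identityʳ _) (*-scalar c u)

  algebra : KAlgebra k (c ⊔ m) (c ⊔ ℓ ⊔ m ⊔ r)
  algebra = record
    { ring = record
      { Carrier = C ; _≈_ = _≈_ ; _+_ = _++_ ; _*_ = _*_ ; -_ = neg ; 0# = [] ; 1# = scalar k.1#
      ; isRing = record
        { +-isAbelianGroup = record
          { isGroup = record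
            { isMonoid = record
              { isSemigroup = record
                { isMagma = record { isEquivalence = Setoid.isEquivalence setoid ; ∙-cong = ++-cong }
                ; assoc = λ u v w → ≡⇒≈ (List.++-assoc u v w) }
              ; identity = (λ u → ≈-refl) , (λ u → ≡⇒≈ (List.++-identityʳ u)) }
            ; inverse = neg-inverseˡ , neg-inverseʳ
            ; ⁻¹-cong = neg-cong }
          ; comm = ++-comm }
        ; *-cong = *-cong
        ; *-assoc = *-assoc
        ; *-identity = (λ u → ≈-trans (scalar-* k.1# u) (scale-one u))
                     , (λ u → ≈-trans (*-scalar k.1# u) (scale-one u))
        ; distrib = *-distribˡ-++ , (λ w u v → ≡⇒≈ (*-distribʳ-++ w u v)) } }
    ; η = scalar
    ; η-isRingHomomorphism = record
      { isSemiringHomomorphism = record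
        { isNearSemiringHomomorphism = record
          { +-isMonoidHomomorphism = record
            { isMagmaHomomorphism = record
              { isRelHomomorphism = record { cong = coeff ε }
              ; homo = λ c d → ≈-sym (merge c d ε) }
            ; ε-homo = vanish ε }
          ; *-homo = λ c d → single k.refl (M.sym (M.identityˡ ε)) }
        ; 1#-homo = ≈-refl }
      ; -‿homo = λ c → ≈-refl }
    ; η-central = λ c u → ≈-trans (scalar-* c u) (≈-sym (*-scalar c u)) }

module Units {c ℓ a r} {k : CommutativeRing c ℓ} (A : KAlgebra k a r) where
  open KAlgebra A
  open SetoidReasoning setoid

  record Unit : Set (a ⊔ r) where
    field
      value   : Carrier
      inverse : Carrier
      inverseˡ : inverse * value ≈ 1#
      inverseʳ : value * inverse ≈ 1#
  open Unit public

  private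
    cancel : ∀ {w x y z} → x * y ≈ 1# → w * z ≈ 1# → (w * x) * (y * z) ≈ 1#
    cancel {w} {x} {y} {z} p q = begin
      (w * x) * (y * z)  ≈⟨ *-assoc w x (y * z) ⟩
      w * (x * (y * z))  ≈⟨ *-congˡ (*-assoc x y z) ⟨
      w * ((x * y) * z)  ≈⟨ *-congˡ (*-congʳ p) ⟩
      w * (1# * z)       ≈⟨ *-congˡ (*-identityˡ z) ⟩
      w * z              ≈⟨ q ⟩
      1#                 ∎

    inverse-cong : ∀ {u v} → value u ≈ value v → inverse u ≈ inverse v
    inverse-cong {u} {v} p = begin
      inverse u                          ≈⟨ *-identityʳ _ ⟨
      inverse u * 1#                     ≈⟨ *-congˡ (inverseʳ v) ⟨
      inverse u * (value v * inverse v)  ≈⟨ *-assoc _ _ _ ⟨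
      (inverse u * value v) * inverse v  ≈⟨ *-congʳ (*-congˡ p) ⟨
      (inverse u * value u) * inverse v  ≈⟨ *-congʳ (inverseˡ u) ⟩
      1# * inverse v                     ≈⟨ *-identityˡ _ ⟩
      inverse v                          ∎

  units : Group (a ⊔ r) r
  units = record
    { Carrier = Unit
    ; _≈_ = λ u v → value u ≈ value v
    ; _∙_ = λ u v → record
        { value = value u * value v ; inverse = inverse v * inverse u
        ; inverseˡ = cancel (inverseˡ u) (inverseˡ v)
        ; inverseʳ = cancel (inverseʳ v) (inverseʳ u) }
    ; ε = record { value = 1# ; inverse = 1# ; inverseˡ = *-identityˡ 1# ; inverseʳ = *-identityˡ 1# }
    ; _⁻¹ = λ u → record
        { value = inverse u ; inverse = value u ; inverseˡ = inverseʳ u ; inverseʳ = inverseˡ u }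
    ; isGroup = record
      { isMonoid = record
        { isSemigroup = record
          { isMagma = record
            { isEquivalence = record { refl = refl ; sym = sym ; trans = trans }
            ; ∙-cong = *-cong }
          ; assoc = λ u v w → *-assoc _ _ _ }
        ; identity = (λ u → *-identityˡ _) , (λ u → *-identityʳ _) }
      ; inverse = inverseˡ , inverseʳ
      ; ⁻¹-cong = λ {u} {v} → inverse-cong {u} {v} } }

  withValue : (u : Unit) (x : Carrier) → x ≈ value u → Unit
  withValue u x p = record
    { value = x ; inverse = inverse u
    ; inverseˡ = trans (*-congˡ p) (inverseˡ u)
    ; inverseʳ = trans (*-congʳ p) (inverseʳ u) }

  Commute : Unit → Unit → Set r
  Commute u v = value u * value v ≈ value v * value u

  inverse-expansion : ∀ u → inverse u ≈ η (CommutativeRing.1# k) + - inverse u * (value u - 1#)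
  inverse-expansion u = begin
    y                            ≈⟨ +-identityˡ y ⟨
    0# + y                       ≈⟨ +-congʳ (-‿inverseʳ 1#) ⟨
    (1# - 1#) + y                ≈⟨ +-assoc _ _ _ ⟩
    1# + (- 1# + y)              ≈⟨ +-cong η-1 (+-cong (-‿cong (inverseˡ u)) (*-identityʳ y)) ⟨
    η₁ + (- (y * x) + y * 1#)    ≈⟨ +-congˡ (+-cong (-‿distribˡ-* y x) (sym (-x*-y≈x*y y 1#))) ⟩
    η₁ + (- y * x + - y * - 1#)  ≈⟨ +-congˡ (distribˡ (- y) x (- 1#)) ⟨
    η₁ + - y * (x - 1#)          ∎
    where
    open RingProperties ring using (-‿distribˡ-*; -‿distribʳ-*; -‿involutive)
    x = value u
    y = inverse u
    η₁ = η (CommutativeRing.1# k)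
    -x*-y≈x*y : ∀ x y → - x * - y ≈ x * y
    -x*-y≈x*y x y = trans (sym (-‿distribˡ-* x (- y)))
      (trans (-‿cong (sym (-‿distribʳ-* x y))) (-‿involutive _))

module GroupAlgebra {c ℓ g e} (k : CommutativeRing c ℓ) (G : Group g e) where
  private
    module k = CommutativeRing k
    module G = Group G

  data Equal : G.Carrier → LinComb k G.Carrier → Set (c ⊔ g ⊔ e) where
    equal : ∀ {x y} → x G.≈ y → Equal x [ k.1# , y ]

  private
    open Span k Equal
    open Product k G._∙_

    single : ∀ {x y} → x G.≈ y → [ k.1# , x ] ≈ [ k.1# k.* k.1# , y ]
    single p = relate k.1# (equal p)

    Equal-∙ʳ : ∀ {x u} → Equal x u → ∀ z → [ k.1# , x G.∙ z ] ≈ u * [ k.1# , z ]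
    Equal-∙ʳ (equal p) z = single (G.∙-congʳ p)

    Equal-∙ˡ : ∀ {x u} → Equal x u → ∀ z → [ k.1# , z G.∙ x ] ≈ [ k.1# , z ] * u
    Equal-∙ˡ (equal p) z = single (G.∙-congˡ p)

    isIdealRelation : IsIdealRelation k G.monoid Equal
    isIdealRelation = record { R-cong = equal ; R-∙ʳ = Equal-∙ʳ ; R-∙ˡ = Equal-∙ˡ }

  open MonoidAlgebra k G.monoid Equal isIdealRelation public using (algebra)
  open KAlgebra algebra using (Carrier)
  open Units algebra using (Unit)

  ⌜_⌝ : G.Carrier → Unit
  ⌜ x ⌝ = record
    { value = [ k.1# , x ] ; inverse = [ k.1# , x G.⁻¹ ]
    ; inverseˡ = ≈-sym (single (G.sym (G.inverseˡ x)))
    ; inverseʳ = ≈-sym (single (G.sym (G.inverseʳ x))) }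

  op : Carrier → Carrier
  op = map (map₂ (G._⁻¹))

  module Lift {a r} (A : KAlgebra k a r)
    (φ : G.Carrier → Units.Unit A)
    (φ-hom : IsGroupHomomorphism G.rawGroup (Group.rawGroup (Units.units A)) φ)
    where
    private
      module A = KAlgebra A
      module φ = IsGroupHomomorphism φ-hom
      open Units A using (value)
      open SetoidReasoning A.setoid

    extend : Carrier → A.Carrier
    extend = foldr (λ (c , x) s → A.η c A.* value (φ x) A.+ s) A.0#

    private
      term : k.Carrier × G.Carrier → A.Carrier
      term (c , x) = A.η c A.* value (φ x)

      extend-++ : ∀ u v → extend (u ++ v) A.≈ extend u A.+ extend v
      extend-++ [] v = A.sym (A.+-identityˡ _)
      extend-++ (t ∷ u) v = A.trans (A.+-congˡ (extend-++ u v)) (A.sym (A.+-assoc _ _ _))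

      extend-cong : ∀ {u v} → u ≈ v → extend u A.≈ extend v
      extend-cong ≈-refl = A.refl
      extend-cong (≈-sym p) = A.sym (extend-cong p)
      extend-cong (≈-trans p q) = A.trans (extend-cong p) (extend-cong q)
      extend-cong (++-cong {u} {u₁} {v} {v₁} p q) = A.trans (extend-++ u v)
        (A.trans (A.+-cong (extend-cong p) (extend-cong q)) (A.sym (extend-++ u₁ v₁)))
      extend-cong (++-comm u v) = A.trans (extend-++ u v)
        (A.trans (A.+-comm _ _) (A.sym (extend-++ v u)))
      extend-cong (coeff x p) = A.+-congʳ (A.*-congʳ (A.η-cong p))
      extend-cong (merge c d x) = A.trans (A.sym (A.+-assoc _ _ _)) (A.+-congʳ
        (A.trans (A.sym (A.distribʳ _ _ _)) (A.*-congʳ (A.sym (A.η-+ c d)))))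
      extend-cong (vanish x) = A.trans (A.+-identityʳ _)
        (A.trans (A.*-congʳ A.η-0) (A.zeroˡ _))
      extend-cong (relate c (equal p)) = A.+-congʳ
        (A.*-cong (A.η-cong (k.sym (k.*-identityʳ c))) (φ.⟦⟧-cong p))

      term-* : ∀ s t → term (proj₁ s k.* proj₁ t , proj₂ s G.∙ proj₂ t) A.≈ term s A.* term t
      term-* (c , x) (d , y) = begin
        A.η (c k.* d) A.* value (φ (x G.∙ y))                      ≈⟨ A.*-cong (A.η-* c d) (φ.homo x y) ⟩
        (A.η c A.* A.η d) A.* (value (φ x) A.* value (φ y))        ≈⟨ A.*-assoc _ _ _ ⟩
        A.η c A.* (A.η d A.* (value (φ x) A.* value (φ y)))        ≈⟨ A.*-congˡ (A.*-assoc _ _ _) ⟨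
        A.η c A.* ((A.η d A.* value (φ x)) A.* value (φ y))        ≈⟨ A.*-congˡ (A.*-congʳ (A.η-central d _)) ⟩
        A.η c A.* ((value (φ x) A.* A.η d) A.* value (φ y))        ≈⟨ A.*-congˡ (A.*-assoc _ _ _) ⟩
        A.η c A.* (value (φ x) A.* (A.η d A.* value (φ y)))        ≈⟨ A.*-assoc _ _ _ ⟨
        (A.η c A.* value (φ x)) A.* (A.η d A.* value (φ y))        ∎

      extend-⋆ : ∀ t v → extend (t ⋆ v) A.≈ term t A.* extend v
      extend-⋆ t [] = A.sym (A.zeroʳ _)
      extend-⋆ t (s ∷ v) = A.trans (A.+-cong (term-* t s) (extend-⋆ t v)) (A.sym (A.distribˡ _ _ _))

      extend-* : ∀ u v → extend (u * v) A.≈ extend u A.* extend v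
      extend-* [] v = A.sym (A.zeroˡ _)
      extend-* (t ∷ u) v = A.trans (extend-++ (t ⋆ v) (u * v))
        (A.trans (A.+-cong (extend-⋆ t v) (extend-* u v)) (A.sym (A.distribʳ _ _ _)))

      extend-scalar : ∀ c → extend [ c , G.ε ] A.≈ A.η c
      extend-scalar c = A.trans (A.+-identityʳ _) (A.trans (A.*-congˡ φ.ε-homo) (A.*-identityʳ _))

      extend-neg : ∀ u → extend (neg u) A.≈ A.- extend u
      extend-neg [] = A.sym (GroupProperties.ε⁻¹≈ε A.+-group)
      extend-neg ((c , x) ∷ u) = A.trans
        (A.+-cong (A.trans (A.*-congʳ (A.η-neg c)) (A.sym (RingProperties.-‿distribˡ-* A.ring _ _))) (extend-neg u))
        (AbelianGroupProperties.⁻¹-∙-comm A.+-abelianGroup _ _)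

    extend-⌜⌝ : ∀ x → extend (Units.value ⌜ x ⌝) A.≈ value (φ x)
    extend-⌜⌝ x = A.trans (A.+-identityʳ _) (A.trans (A.*-congʳ A.η-1) (A.*-identityˡ _))

    hom : AlgebraHom algebra A
    hom = record
      { ⟦_⟧ = extend
      ; isRingHomomorphism = record
        { isSemiringHomomorphism = record
          { isNearSemiringHomomorphism = record
            { +-isMonoidHomomorphism = record
              { isMagmaHomomorphism = record
                { isRelHomomorphism = record { cong = extend-cong }
                ; homo = extend-++ }
              ; ε-homo = A.refl }
            ; *-homo = extend-* }
          ; 1#-homo = A.trans (extend-scalar k.1#) A.η-1 }
        ; -‿homo = extend-neg }
      ; η-homo = extend-scalar }

-- Words in letters (s , true), standing for s, and (s , false), standing
-- for its inverse, modulo cancellation.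
module FreeGroup {s} (S : Set s) where

  Letter : Set s
  Letter = S × Bool

  flip : Letter → Letter
  flip = map₂ not

  data _⟶_ : Rel (List Letter) s where
    cancel : ∀ u l v → (u ++ l ∷ flip l ∷ v) ⟶ (u ++ v)

  private
    _∼_ : Rel (List Letter) s
    _∼_ = EqClosure _⟶_

    setoid : Setoid s s
    setoid = EqClosure.setoid _⟶_

    module ∼ = Setoid setoid
    open SetoidReasoning setoid

    flip-flip : ∀ l → flip (flip l) ≡ l
    flip-flip (s , b) = ≡.cong (s ,_) (not-involutive b)

    step : ∀ {u v} → u ⟶ v → u ∼ v
    step = EqClosure.return

    ≡⇒∼ : ∀ {u v} → u ≡ v → u ∼ v
    ≡⇒∼ ≡.refl = ∼.refl

    ++-congˡ : ∀ w {u v} → u ∼ v → (w ++ u) ∼ (w ++ v)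
    ++-congˡ w = EqClosure.gmap (w ++_) λ where
      (cancel u l v) → ≡.subst₂ _⟶_ (List.++-assoc w u _) (List.++-assoc w u v) (cancel (w ++ u) l v)

    ++-congʳ : ∀ w {u v} → u ∼ v → (u ++ w) ∼ (v ++ w)
    ++-congʳ w = EqClosure.gmap (_++ w) λ where
      (cancel u l v) → ≡.subst₂ _⟶_ (≡.sym (List.++-assoc u _ w)) (≡.sym (List.++-assoc u v w)) (cancel u l (v ++ w))

    ++-cong : ∀ {u u₁ v v₁} → u ∼ u₁ → v ∼ v₁ → (u ++ v) ∼ (u₁ ++ v₁)
    ++-cong {u₁ = u₁} {v} p q = ∼.trans (++-congʳ v p) (++-congˡ u₁ q)

    inv : List Letter → List Letter
    inv u = reverse (map flip u)

    inv-∷ : ∀ l u → inv (l ∷ u) ≡ inv u ++ [ flip l ]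
    inv-∷ l u = List.unfold-reverse (flip l) (map flip u)

    inv-++ : ∀ u v → inv (u ++ v) ≡ inv v ++ inv u
    inv-++ u v = ≡.trans (≡.cong reverse (List.map-++ flip u v)) (List.reverse-++ (map flip u) (map flip v))

    inv-inv : ∀ u → inv (inv u) ≡ u
    inv-inv [] = ≡.refl
    inv-inv (l ∷ u) = ≡.trans (≡.cong inv (inv-∷ l u)) (≡.trans (inv-++ (inv u) _)
      (≡.cong₂ _∷_ (flip-flip l) (inv-inv u)))

    inv-cancel : ∀ u l v → inv (u ++ l ∷ flip l ∷ v) ≡ inv v ++ flip (flip l) ∷ flip (flip (flip l)) ∷ inv u
    inv-cancel u l v = ≡.trans (inv-++ u (l ∷ flip l ∷ v))
      (≡.trans (≡.cong (_++ inv u) (≡.trans (inv-∷ l (flip l ∷ v))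
        (≡.trans (≡.cong (_++ [ flip l ]) (inv-∷ (flip l) v)) (List.++-assoc (inv v) _ _))))
      (≡.trans (List.++-assoc (inv v) _ _)
        (≡.cong (λ m → inv v ++ flip (flip l) ∷ m ∷ inv u) (≡.sym (flip-flip (flip l))))))

    inv-cong : ∀ {u v} → u ∼ v → inv u ∼ inv v
    inv-cong = EqClosure.gmap inv λ where
      (cancel u l v) → ≡.subst₂ _⟶_ (≡.sym (inv-cancel u l v)) (≡.sym (inv-++ u v))
                         (cancel (inv v) (flip (flip l)) (inv u))

    inverseʳ : ∀ u → (u ++ inv u) ∼ []
    inverseʳ [] = ∼.refl
    inverseʳ (l ∷ u) = begin
      l ∷ u ++ inv (l ∷ u)               ≡⟨ ≡.cong (λ w → l ∷ u ++ w) (inv-∷ l u) ⟩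
      l ∷ u ++ (inv u ++ [ flip l ])     ≡⟨ ≡.cong (l ∷_) (List.++-assoc u (inv u) _) ⟨
      l ∷ (u ++ inv u) ++ [ flip l ]     ≈⟨ ++-congˡ [ l ] (++-congʳ [ flip l ] (inverseʳ u)) ⟩
      l ∷ flip l ∷ []                    ≈⟨ step (cancel [] l []) ⟩
      []                                 ∎

    inverseˡ : ∀ u → (inv u ++ u) ∼ []
    inverseˡ u = ∼.trans (≡⇒∼ (≡.cong (inv u ++_) (≡.sym (inv-inv u)))) (inverseʳ (inv u))

  group : Group s s
  group = record
    { Carrier = List Letter ; _≈_ = _∼_ ; _∙_ = _++_ ; ε = [] ; _⁻¹ = inv
    ; isGroup = record
      { isMonoid = record
        { isSemigroup = record
          { isMagma = record { isEquivalence = ∼.isEquivalence ; ∙-cong = ++-cong }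
          ; assoc = λ u v w → ≡⇒∼ (List.++-assoc u v w) }
        ; identity = (λ u → ∼.refl) , (λ u → ≡⇒∼ (List.++-identityʳ u)) }
      ; inverse = inverseˡ , inverseʳ
      ; ⁻¹-cong = inv-cong } }

  generator : S → List Letter
  generator s = [ s , true ]

  module Lift {g e} (G : Group g e) (f : S → Group.Carrier G) where
    private
      module G = Group G

    letter : Letter → G.Carrier
    letter (s , b) = if b then f s else f s G.⁻¹

    lift : List Letter → G.Carrier
    lift = foldr (λ l x → letter l G.∙ x) G.ε

    lift-generator : ∀ s → lift (generator s) G.≈ f s
    lift-generator s = G.identityʳ _

    private
      lift-++ : ∀ u v → lift (u ++ v) G.≈ lift u G.∙ lift v
      lift-++ [] v = G.sym (G.identityˡ _)
      lift-++ (l ∷ u) v = G.trans (G.∙-congˡ (lift-++ u v)) (G.sym (G.assoc _ _ _))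

      letter-flip : ∀ l → letter l G.∙ letter (flip l) G.≈ G.ε
      letter-flip (s , true) = G.inverseʳ _
      letter-flip (s , false) = G.inverseˡ _

      lift-⟶ : ∀ {u v} → u ⟶ v → lift u G.≈ lift v
      lift-⟶ (cancel u l v) = G.trans (lift-++ u _) (G.trans
        (G.∙-congˡ (G.trans (G.sym (G.assoc _ _ _)) (G.trans (G.∙-congʳ (letter-flip l)) (G.identityˡ _))))
        (G.sym (lift-++ u v)))

      lift-cong : ∀ {u v} → u ∼ v → lift u G.≈ lift v
      lift-cong = EqClosure.gfold G.isEquivalence lift lift-⟶

    hom : IsGroupHomomorphism (Group.rawGroup group) G.rawGroup lift
    hom = record
      { isMonoidHomomorphism = record
        { isMagmaHomomorphism = record
          { isRelHomomorphism = record { cong = lift-cong }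
          ; homo = lift-++ }
        ; ε-homo = G.refl }
      ; ⁻¹-homo = λ u → GroupProperties.inverseˡ-unique G _ _
          (G.trans (G.sym (lift-++ (inv u) u)) (lift-cong (inverseˡ u))) }

module _ {g e} (G : Group g e) where
  open Group G
  open RawMonoidDefinitions rawMonoid using () renaming (_×_ to power)

  infixr 8 _^ᶻ_

  _^ᶻ_ : Carrier → ℤ → Carrier
  x ^ᶻ (+ n)    = power n x
  x ^ᶻ -[1+ n ] = power (ℕ.suc n) x ⁻¹

module Tensor {c ℓ a r b s} {k : CommutativeRing c ℓ} (A : KAlgebra k a r) (B : KAlgebra k b s) where
  private
    module k = CommutativeRing k
    module A = KAlgebra A
    module B = KAlgebra B

  data Bilinear : A.Carrier × B.Carrier → LinComb k (A.Carrier × B.Carrier) → Set (c ⊔ a ⊔ r ⊔ b ⊔ s) where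
    equal   : ∀ {x x₁ y y₁} → x A.≈ x₁ × y B.≈ y₁ → Bilinear (x , y) [ k.1# , x₁ , y₁ ]
    addˡ    : ∀ x x₁ y → Bilinear (x A.+ x₁ , y) ((k.1# , x , y) ∷ (k.1# , x₁ , y) ∷ [])
    addʳ    : ∀ x y y₁ → Bilinear (x , y B.+ y₁) ((k.1# , x , y) ∷ (k.1# , x , y₁) ∷ [])
    scalarˡ : ∀ c x y → Bilinear (A.η c A.* x , y) [ c , x , y ]
    scalarʳ : ∀ c x y → Bilinear (x , B.η c B.* y) [ c , x , y ]

  private
    M : Monoid (a ⊔ b) (r ⊔ s)
    M = DirectProduct.monoid A.*-monoid B.*-monoid

    open Monoid M using (_∙_)
    open Span k Bilinear
    open Product k _∙_

    single : ∀ {c x x₁ y y₁} → x A.≈ x₁ → y B.≈ y₁ → [ c , x , y ] ≈ [ c , x₁ , y₁ ]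
    single p q = ≈-trans (relate _ (equal (p , q))) (coeff _ (k.*-identityʳ _))

    rewriteˡ : ∀ {x x₁ y y₁ u v} → x A.≈ x₁ → y B.≈ y₁ → Bilinear (x₁ , y₁) u → scale k.1# u ≈ v → [ k.1# , x , y ] ≈ v
    rewriteˡ p q t h = ≈-trans (single p q) (≈-trans (relate k.1# t) h)

    Bilinear-∙ʳ : ∀ {x u} → Bilinear x u → ∀ z → [ k.1# , x ∙ z ] ≈ u * [ k.1# , z ]
    Bilinear-∙ʳ (equal (p , q)) _ = ≈-trans (single (A.*-congʳ p) (B.*-congʳ q)) (coeff _ (k.sym (k.*-identityʳ _)))
    Bilinear-∙ʳ (addˡ x x₁ y) (z , w) = rewriteˡ (A.distribʳ z x x₁) B.refl (addˡ _ _ _) ≈-refl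
    Bilinear-∙ʳ (addʳ x y y₁) (z , w) = rewriteˡ A.refl (B.distribʳ w y y₁) (addʳ _ _ _) ≈-refl
    Bilinear-∙ʳ (scalarˡ c x y) (z , w) = rewriteˡ (A.*-assoc _ _ _) B.refl (scalarˡ c _ _) (coeff _ (k.*-comm _ _))
    Bilinear-∙ʳ (scalarʳ c x y) (z , w) = rewriteˡ A.refl (B.*-assoc _ _ _) (scalarʳ c _ _) (coeff _ (k.*-comm _ _))

    Bilinear-∙ˡ : ∀ {x u} → Bilinear x u → ∀ z → [ k.1# , z ∙ x ] ≈ [ k.1# , z ] * u
    Bilinear-∙ˡ (equal (p , q)) _ = ≈-trans (single (A.*-congˡ p) (B.*-congˡ q)) (coeff _ (k.sym (k.*-identityʳ _)))
    Bilinear-∙ˡ (addˡ x x₁ y) (z , w) = rewriteˡ (A.distribˡ z x x₁) B.refl (addˡ _ _ _) ≈-refl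
    Bilinear-∙ˡ (addʳ x y y₁) (z , w) = rewriteˡ A.refl (B.distribˡ w y y₁) (addʳ _ _ _) ≈-refl
    Bilinear-∙ˡ (scalarˡ c x y) (z , w) =
      rewriteˡ (A.trans (A.sym (A.*-assoc _ _ _)) (A.trans (A.*-congʳ (A.sym (A.η-central c z))) (A.*-assoc _ _ _)))
               B.refl (scalarˡ c _ _) ≈-refl
    Bilinear-∙ˡ (scalarʳ c x y) (z , w) =
      rewriteˡ A.refl
               (B.trans (B.sym (B.*-assoc _ _ _)) (B.trans (B.*-congʳ (B.sym (B.η-central c w))) (B.*-assoc _ _ _)))
               (scalarʳ c _ _) ≈-refl

    isIdealRelation : IsIdealRelation k M Bilinear
    isIdealRelation = record { R-cong = equal ; R-∙ʳ = Bilinear-∙ʳ ; R-∙ˡ = Bilinear-∙ˡ }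

  open MonoidAlgebra k M Bilinear isIdealRelation public using (algebra)
  open KAlgebra algebra using (Carrier)

  infixl 7 _⊗_

  _⊗_ : A.Carrier → B.Carrier → Carrier
  x ⊗ y = [ k.1# , x , y ]

  ⊗-comm : ∀ x y → (x ⊗ B.1#) * (A.1# ⊗ y) ≈ (A.1# ⊗ y) * (x ⊗ B.1#)
  ⊗-comm x y = single (A.trans (A.*-identityʳ x) (A.sym (A.*-identityˡ x)))
                      (B.trans (B.*-identityˡ y) (B.sym (B.*-identityʳ y)))

  _⊗ᵘ_ : Units.Unit A → Units.Unit B → Units.Unit algebra
  u ⊗ᵘ v = record
    { value = Aᵘ.value u ⊗ Bᵘ.value v ; inverse = Aᵘ.inverse u ⊗ Bᵘ.inverse v
    ; inverseˡ = unit (Aᵘ.inverseˡ u) (Bᵘ.inverseˡ v)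
    ; inverseʳ = unit (Aᵘ.inverseʳ u) (Bᵘ.inverseʳ v) }
    where
    module Aᵘ = Units A
    module Bᵘ = Units B
    unit : ∀ {x y} → x A.≈ A.1# → y B.≈ B.1# → [ k.1# k.* k.1# , x , y ] ≈ [ k.1# , A.1# , B.1# ]
    unit p q = ≈-trans (single p q) (coeff _ (k.*-identityʳ _))

-- x ⊗ y ↦ f x ⊗ g y, extended linearly; it respects equality whenever f
-- and g are k-linear.
tensorMap : ∀ {c ℓ} {k : CommutativeRing c ℓ} {a r b s a₁ r₁ b₁ s₁}
  {A : KAlgebra k a r} {B : KAlgebra k b s} {A₁ : KAlgebra k a₁ r₁} {B₁ : KAlgebra k b₁ s₁} →
  (KAlgebra.Carrier A → KAlgebra.Carrier A₁) → (KAlgebra.Carrier B → KAlgebra.Carrier B₁) →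
  KAlgebra.Carrier (Tensor.algebra A B) → KAlgebra.Carrier (Tensor.algebra A₁ B₁)
tensorMap f g = map λ (c , x , y) → c , f x , g y

record IsSubalgebra {c ℓ a r p} {k : CommutativeRing c ℓ} (A : KAlgebra k a r)
                    (P : KAlgebra.Carrier A → Set p) : Set (c ⊔ a ⊔ p) where
  open KAlgebra A
  field
    P-+   : ∀ {x y} → P x → P y → P (x + y)
    P-*   : ∀ {x y} → P x → P y → P (x * y)
    P-neg : ∀ {x} → P x → P (- x)
    P-η   : ∀ c → P (η c)
    P-0   : P 0#
    P-1   : P 1#

module Subalgebra {c ℓ a r p} {k : CommutativeRing c ℓ} (A : KAlgebra k a r)
  {P : KAlgebra.Carrier A → Set p} (isSubalgebra : IsSubalgebra A P) where

  open KAlgebra A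
  open IsSubalgebra isSubalgebra

  algebra : KAlgebra k (a ⊔ p) r
  algebra = record
    { ring = record
      { Carrier = Σ Carrier P
      ; _≈_ = λ x y → proj₁ x ≈ proj₁ y
      ; _+_ = λ (x , p) (y , q) → x + y , P-+ p q
      ; _*_ = λ (x , p) (y , q) → x * y , P-* p q
      ; -_ = λ (x , p) → - x , P-neg p
      ; 0# = 0# , P-0
      ; 1# = 1# , P-1
      ; isRing = record
        { +-isAbelianGroup = record
          { isGroup = record
            { isMonoid = record
              { isSemigroup = record
                { isMagma = record
                  { isEquivalence = record { refl = refl ; sym = sym ; trans = trans }
                  ; ∙-cong = +-cong }
                ; assoc = λ x y z → +-assoc _ _ _ }
              ; identity = (λ x → +-identityˡ _) , (λ x → +-identityʳ _) }
            ; inverse = (λ x → -‿inverseˡ _) , (λ x → -‿inverseʳ _)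
            ; ⁻¹-cong = -‿cong }
          ; comm = λ x y → +-comm _ _ }
        ; *-cong = *-cong
        ; *-assoc = λ x y z → *-assoc _ _ _
        ; *-identity = (λ x → *-identityˡ _) , (λ x → *-identityʳ _)
        ; distrib = (λ x y z → distribˡ _ _ _) , (λ x y z → distribʳ _ _ _) } }
    ; η = λ c → η c , P-η c
    ; η-isRingHomomorphism = record
      { isSemiringHomomorphism = record
        { isNearSemiringHomomorphism = record
          { +-isMonoidHomomorphism = record
            { isMagmaHomomorphism = record
              { isRelHomomorphism = record { cong = η-cong }
              ; homo = η-+ }
            ; ε-homo = η-0 }
          ; *-homo = η-* }
        ; 1#-homo = η-1 }
      ; -‿homo = η-neg }
    ; η-central = λ c x → η-central c _ }

-- As a subset of B: elements carry some decomposition l + v e, but are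
-- compared in B.
module ScalarsPlusLeftIdeal {c ℓ a r} {k : CommutativeRing c ℓ} (B : KAlgebra k a r)
  (e : KAlgebra.Carrier B) where
  private module k = CommutativeRing k
  open KAlgebra B
  open RingProperties ring using (-‿distribˡ-*)
  open AbelianGroupProperties +-abelianGroup using (⁻¹-∙-comm)
  open SetoidReasoning setoid

  _∈k⊕Be : Carrier → Set (c ⊔ a ⊔ r)
  x ∈k⊕Be = ∃₂ λ l v → x ≈ η l + v * e

  private
    medial : ∀ a b c d → (a + b) + (c + d) ≈ (a + c) + (b + d)
    medial a b c d = begin
      (a + b) + (c + d)  ≈⟨ +-assoc a b (c + d) ⟩
      a + (b + (c + d))  ≈⟨ +-congˡ (+-assoc b c d) ⟨
      a + ((b + c) + d)  ≈⟨ +-congˡ (+-congʳ (+-comm b c)) ⟩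
      a + ((c + b) + d)  ≈⟨ +-congˡ (+-assoc c b d) ⟩
      a + (c + (b + d))  ≈⟨ +-assoc a c (b + d) ⟨
      (a + c) + (b + d)  ∎

    closed-+ : ∀ {x y} → x ∈k⊕Be → y ∈k⊕Be → (x + y) ∈k⊕Be
    closed-+ {x} {y} (l , v , p) (m , w , q) = l k.+ m , v + w , (begin
      x + y                              ≈⟨ +-cong p q ⟩
      (η l + v * e) + (η m + w * e)      ≈⟨ medial _ _ _ _ ⟩
      (η l + η m) + (v * e + w * e)      ≈⟨ +-cong (η-+ l m) (distribʳ e v w) ⟨
      η (l k.+ m) + (v + w) * e          ∎)

    closed-* : ∀ {x y} → x ∈k⊕Be → y ∈k⊕Be → (x * y) ∈k⊕Be
    closed-* {x} {y} (l , v , p) (m , w , q) = l k.* m , η l * w + (η m * v + v * e * w) , (begin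
      x * y
        ≈⟨ *-cong p q ⟩
      (η l + v * e) * (η m + w * e)
        ≈⟨ distribˡ _ _ _ ⟩
      (η l + v * e) * η m + (η l + v * e) * (w * e)
        ≈⟨ +-cong (distribʳ _ _ _) (distribʳ _ _ _) ⟩
      (η l * η m + v * e * η m) + (η l * (w * e) + v * e * (w * e))
        ≈⟨ +-cong (+-congˡ (η-central m (v * e))) (+-cong (*-assoc _ _ _) (*-assoc _ _ _)) ⟨
      (η l * η m + η m * (v * e)) + (η l * w * e + v * e * w * e)
        ≈⟨ +-congʳ (+-cong (η-* l m) (*-assoc _ _ _)) ⟨
      (η (l k.* m) + η m * v * e) + (η l * w * e + v * e * w * e)
        ≈⟨ medial _ _ _ _ ⟩
      (η (l k.* m) + η l * w * e) + (η m * v * e + v * e * w * e)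
        ≈⟨ +-assoc _ _ _ ⟩
      η (l k.* m) + (η l * w * e + (η m * v * e + v * e * w * e))
        ≈⟨ +-congˡ (+-congˡ (distribʳ _ _ _)) ⟨
      η (l k.* m) + (η l * w * e + (η m * v + v * e * w) * e)
        ≈⟨ +-congˡ (distribʳ _ _ _) ⟨
      η (l k.* m) + (η l * w + (η m * v + v * e * w)) * e
        ∎)

    closed-neg : ∀ {x} → x ∈k⊕Be → (- x) ∈k⊕Be
    closed-neg {x} (l , v , p) = k.- l , - v , (begin
      - x                        ≈⟨ -‿cong p ⟩
      - (η l + v * e)            ≈⟨ ⁻¹-∙-comm _ _ ⟨
      - η l + - (v * e)          ≈⟨ +-cong (sym (η-neg l)) (-‿distribˡ-* v e) ⟩
      η (k.- l) + - v * e        ∎)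

    closed-η : ∀ l → η l ∈k⊕Be
    closed-η l = l , 0# , sym (trans (+-congˡ (zeroˡ e)) (+-identityʳ _))

    closed-≈ : ∀ {x y} → x ≈ y → y ∈k⊕Be → x ∈k⊕Be
    closed-≈ p (l , v , q) = l , v , trans p q

    isSubalgebra : IsSubalgebra B _∈k⊕Be
    isSubalgebra = record
      { P-+ = closed-+ ; P-* = closed-* ; P-neg = closed-neg ; P-η = closed-η
      ; P-0 = closed-≈ (sym η-0) (closed-η k.0#)
      ; P-1 = closed-≈ (sym η-1) (closed-η k.1#) }

  algebra : KAlgebra k (c ⊔ a ⊔ r) r
  algebra = Subalgebra.algebra B isSubalgebra

  private module W = KAlgebra algebra

  _⊕_·e : k.Carrier → Carrier → W.Carrier
  l ⊕ v ·e = η l + v * e , l , v , refl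

module _ {a r} (R : Ring a r) where
  open Ring R
  open Sum semiring using (sum)

  private
    sumOfLength : ℤ → ℤ → ℤ → (ℤ → Carrier) → Carrier
    sumOfLength p q (+ n)    f = sum {n} λ i → f (p ℤ.+ + toℕ i)
    sumOfLength p q -[1+ n ] f = - sum {ℕ.suc n} λ i → f (q ℤ.+ + 1 ℤ.+ + toℕ i)

  -- f(p) + … + f(q) if q ≥ p, 0 if q = p - 1, and
  -- - (f(q+1) + … + f(p-1)) if q < p - 1.
  intervalSum : ℤ → ℤ → (ℤ → Carrier) → Carrier
  intervalSum p q = sumOfLength p q (q ℤ.- p ℤ.+ + 1)

module Matrices {c ℓ a r} {k : CommutativeRing c ℓ} (A : KAlgebra k a r) where
  open KAlgebra A hiding (zero)
  open Sum semiring
  open RingProperties ring using (-0#≈0#)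
  open SetoidReasoning setoid
  open Units A using (Unit; value; inverse)

  Matrix : ℕ → ℕ → Set a
  Matrix m n = Vector.Vector (Vector.Vector Carrier n) m

  infix 4 _≋_
  infixl 7 _⊡_

  _≋_ : ∀ {m n} → Rel (Matrix m n) r
  M ≋ N = ∀ i j → M i j ≈ N i j

  _⊡_ : ∀ {m n p} → Matrix m n → Matrix n p → Matrix m p
  (M ⊡ N) i j = sum λ h → M i h * N h j

  transpose : ∀ {m n} → Matrix m n → Matrix n m
  transpose M i j = M j i

  mapEntries : ∀ {m n} → (Carrier → Carrier) → Matrix m n → Matrix m n
  mapEntries f M i j = f (M i j)

  diagonal : ∀ {n} → Vector.Vector Carrier n → Matrix n n
  diagonal d i j = if does (i ≟ j) then d i else 0#

  sum-cong : ∀ {n} {f g : Fin n → Carrier} → (∀ i → f i ≈ g i) → sum f ≈ sum g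
  sum-cong = sum-cong-≋

  sum-zero : ∀ {n} (f : Fin n → Carrier) → (∀ i → f i ≈ 0#) → sum f ≈ 0#
  sum-zero {n} f p = trans (sum-cong p) (sum-replicate-zero n)

  sum-only : ∀ {n} (f : Fin n → Carrier) i → (∀ h → does (h ≟ i) ≡ false → f h ≈ 0#) → sum f ≈ f i
  sum-only f zero p = trans (+-congˡ (sum-zero (f ∘ suc) λ h → p (suc h) ≡.refl)) (+-identityʳ _)
  sum-only f (suc i) p = trans
    (+-cong (p zero ≡.refl) (sum-only (f ∘ suc) i λ h → p (suc h))) (+-identityˡ _)

  diagonal-≡ : ∀ {n} (d : Fin n → Carrier) i → diagonal d i i ≡ d i
  diagonal-≡ d zero = ≡.refl
  diagonal-≡ d (suc i) = diagonal-≡ (d ∘ suc) i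

  diagonal-≢ : ∀ {n} (d : Fin n → Carrier) i j → does (i ≟ j) ≡ false → diagonal d i j ≡ 0#
  diagonal-≢ d i j p = ≡.cong (if_then d i else 0#) p

  ≟-sym : ∀ {n} (i j : Fin n) → does (i ≟ j) ≡ does (j ≟ i)
  ≟-sym zero zero = ≡.refl
  ≟-sym zero (suc j) = ≡.refl
  ≟-sym (suc i) zero = ≡.refl
  ≟-sym (suc i) (suc j) = ≟-sym i j

  diagonal-⊡ : ∀ {m n} (d : Fin m → Carrier) (M : Matrix m n) → ∀ i j → (diagonal d ⊡ M) i j ≈ d i * M i j
  diagonal-⊡ d M i j = trans
    (sum-only _ i λ h p → trans (*-congʳ (reflexive (diagonal-≢ d i h (≡.trans (≟-sym i h) p)))) (zeroˡ _))
    (*-congʳ (reflexive (diagonal-≡ d i)))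

  ⊡-diagonal : ∀ {m n} (M : Matrix m n) (d : Fin n → Carrier) → ∀ i j → (M ⊡ diagonal d) i j ≈ M i j * d j
  ⊡-diagonal M d i j = trans
    (sum-only _ j λ h p → trans (*-congˡ (reflexive (diagonal-≢ d h j p))) (zeroʳ _))
    (*-congˡ (reflexive (diagonal-≡ d j)))

  diagonal-cong : ∀ {n} {d e : Fin n → Carrier} → (∀ i → d i ≈ e i) → diagonal d ≋ diagonal e
  diagonal-cong p i j with i ≟ j
  ... | yes _ = p i
  ... | no _ = refl

  diagonal-* : ∀ {n} (d e : Fin n → Carrier) → diagonal d ⊡ diagonal e ≋ diagonal (λ i → d i * e i)
  diagonal-* d e i j = trans (diagonal-⊡ d (diagonal e) i j) lemma
    where
    lemma : d i * diagonal e i j ≈ diagonal (λ i → d i * e i) i j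
    lemma with i ≟ j
    ... | yes _ = refl
    ... | no _ = zeroʳ _

  diagonal-+ : ∀ {n} (d e : Fin n → Carrier) i j → diagonal (λ i → d i + e i) i j ≈ diagonal d i j + diagonal e i j
  diagonal-+ d e i j with i ≟ j
  ... | yes _ = refl
  ... | no _ = sym (+-identityˡ _)

  diagonal-neg : ∀ {n} (d : Fin n → Carrier) i j → diagonal (λ i → - d i) i j ≈ - diagonal d i j
  diagonal-neg d i j with i ≟ j
  ... | yes _ = refl
  ... | no _ = sym -0#≈0#

  diagonal-0 : ∀ {n} (i j : Fin n) → diagonal (λ _ → 0#) i j ≈ 0#
  diagonal-0 i j with i ≟ j
  ... | yes _ = refl
  ... | no _ = refl

  ⊡-assoc : ∀ {m n p q} (L : Matrix m n) (M : Matrix n p) (N : Matrix p q) → (L ⊡ M) ⊡ N ≋ L ⊡ (M ⊡ N)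
  ⊡-assoc L M N i j = begin
    sum (λ h → sum (λ g → L i g * M g h) * N h j)
      ≈⟨ sum-cong (λ h → *-distribʳ-sum (N h j) (λ g → L i g * M g h)) ⟩
    sum (λ h → sum (λ g → L i g * M g h * N h j))
      ≈⟨ ∑-comm (λ h g → L i g * M g h * N h j) ⟩
    sum (λ g → sum (λ h → L i g * M g h * N h j))
      ≈⟨ sum-cong (λ g → sum-cong (λ h → *-assoc (L i g) (M g h) (N h j))) ⟩
    sum (λ g → sum (λ h → L i g * (M g h * N h j)))
      ≈⟨ sum-cong (λ g → *-distribˡ-sum (L i g) (λ h → M g h * N h j)) ⟨
    sum (λ g → L i g * sum (λ h → M g h * N h j))
      ∎

  ⊡-identityˡ : ∀ {m n} (M : Matrix m n) → diagonal (λ _ → 1#) ⊡ M ≋ M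
  ⊡-identityˡ M i j = trans (diagonal-⊡ _ M i j) (*-identityˡ _)

  algebra : ℕ → KAlgebra k a r
  algebra n = record
    { ring = record
      { Carrier = Matrix n n
      ; _≈_ = _≋_
      ; _+_ = λ M N i j → M i j + N i j
      ; _*_ = _⊡_
      ; -_ = λ M i j → - M i j
      ; 0# = λ i j → 0#
      ; 1# = diagonal λ _ → 1#
      ; isRing = record
        { +-isAbelianGroup = record
          { isGroup = record
            { isMonoid = record
              { isSemigroup = record
                { isMagma = record
                  { isEquivalence = record
                    { refl = λ i j → refl
                    ; sym = λ p i j → sym (p i j)
                    ; trans = λ p q i j → trans (p i j) (q i j) }
                  ; ∙-cong = λ p q i j → +-cong (p i j) (q i j) }
                ; assoc = λ L M N i j → +-assoc _ _ _ }
              ; identity = (λ M i j → +-identityˡ _) , (λ M i j → +-identityʳ _) }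
            ; inverse = (λ M i j → -‿inverseˡ _) , (λ M i j → -‿inverseʳ _)
            ; ⁻¹-cong = λ p i j → -‿cong (p i j) }
          ; comm = λ M N i j → +-comm _ _ }
        ; *-cong = λ p q i j → sum-cong λ h → *-cong (p i h) (q h j)
        ; *-assoc = ⊡-assoc
        ; *-identity = ⊡-identityˡ , (λ M i j → trans (⊡-diagonal M _ i j) (*-identityʳ _))
        ; distrib = (λ L M N i j → trans (sum-cong {n} λ h → distribˡ (L i h) (M h j) (N h j)) (∑-distrib-+ (λ h → L i h * M h j) (λ h → L i h * N h j)))
                  , (λ L M N i j → trans (sum-cong {n} λ h → distribʳ (L h j) (M i h) (N i h)) (∑-distrib-+ (λ h → M i h * L h j) (λ h → N i h * L h j))) } }
    ; η = λ c → diagonal λ _ → η c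
    ; η-isRingHomomorphism = record
      { isSemiringHomomorphism = record
        { isNearSemiringHomomorphism = record
          { +-isMonoidHomomorphism = record
            { isMagmaHomomorphism = record
              { isRelHomomorphism = record { cong = λ p → diagonal-cong λ _ → η-cong p }
              ; homo = λ c d i j → trans (diagonal-cong (λ _ → η-+ c d) i j) (diagonal-+ _ _ i j) }
            ; ε-homo = λ i j → trans (diagonal-cong (λ _ → η-0) i j) (diagonal-0 i j) }
          ; *-homo = λ c d i j → trans (diagonal-cong (λ _ → η-* c d) i j) (sym (diagonal-* _ _ i j)) }
        ; 1#-homo = diagonal-cong λ _ → η-1 }
      ; -‿homo = λ c i j → trans (diagonal-cong (λ _ → η-neg c) i j) (diagonal-neg _ i j) }
    ; η-central = λ c M i j → trans (diagonal-⊡ _ M i j)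
                    (trans (η-central c _) (sym (⊡-diagonal M _ i j))) }

  diagonalᵘ : ∀ {n} → Vector.Vector Unit n → Units.Unit (algebra n)
  diagonalᵘ d = record
    { value = diagonal (value ∘ d)
    ; inverse = diagonal (inverse ∘ d)
    ; inverseˡ = λ i j → trans (diagonal-* (inverse ∘ d) (value ∘ d) i j) (diagonal-cong (λ h → Unit.inverseˡ (d h)) i j)
    ; inverseʳ = λ i j → trans (diagonal-* (value ∘ d) (inverse ∘ d) i j) (diagonal-cong (λ h → Unit.inverseʳ (d h)) i j) }

  -- Adds x times row j to row i.
  addRow : ∀ {m n} → Fin m → Fin m → Carrier → Matrix m n → Matrix m n
  addRow i j x M p q = if does (p ≟ i) then M p q + x * M j q else M p q

  elementary : ∀ {n} → Fin n → Fin n → Carrier → Matrix n n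
  elementary i j x = addRow i j x (diagonal λ _ → 1#)

  elementary-⊡ : ∀ {m n} i j x (M : Matrix m n) → elementary i j x ⊡ M ≋ addRow i j x M
  elementary-⊡ i j x M p q with does (p ≟ i)
  ... | false = ⊡-identityˡ M p q
  ... | true = begin
    sum (λ h → (δ p h + x * δ j h) * M h q)
      ≈⟨ sum-cong (λ h → distribʳ (M h q) (δ p h) (x * δ j h)) ⟩
    sum (λ h → δ p h * M h q + x * δ j h * M h q)
      ≈⟨ ∑-distrib-+ (λ h → δ p h * M h q) (λ h → x * δ j h * M h q) ⟩
    sum (λ h → δ p h * M h q) + sum (λ h → x * δ j h * M h q)
      ≈⟨ +-congˡ (sum-cong (λ h → *-assoc x (δ j h) (M h q))) ⟩
    sum (λ h → δ p h * M h q) + sum (λ h → x * (δ j h * M h q))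
      ≈⟨ +-congˡ (*-distribˡ-sum x (λ h → δ j h * M h q)) ⟨
    sum (λ h → δ p h * M h q) + x * sum (λ h → δ j h * M h q)
      ≈⟨ +-cong (⊡-identityˡ M p q) (*-congˡ (⊡-identityˡ M j q)) ⟩
    M p q + x * M j q
      ∎
    where
    δ : ∀ {n} → Matrix n n
    δ = diagonal λ _ → 1#

  addRow-addRow : ∀ {m n} i j x y (M : Matrix m n) → does (j ≟ i) ≡ false → y + x ≈ 0# →
                  addRow i j x (addRow i j y M) ≋ M
  addRow-addRow i j x y M e s p q with does (p ≟ i)
  ... | false = refl
  ... | true rewrite e = begin
    (M p q + y * M j q) + x * M j q  ≈⟨ +-assoc _ _ _ ⟩
    M p q + (y * M j q + x * M j q)  ≈⟨ +-congˡ (distribʳ _ _ _) ⟨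
    M p q + (y + x) * M j q          ≈⟨ +-congˡ (*-congʳ s) ⟩
    M p q + 0# * M j q               ≈⟨ +-congˡ (zeroˡ _) ⟩
    M p q + 0#                       ≈⟨ +-identityʳ _ ⟩
    M p q                            ∎

  elementaryᵘ : ∀ {n} (i j : Fin n) → does (j ≟ i) ≡ false → Carrier → Units.Unit (algebra n)
  elementaryᵘ i j e x = record
    { value = elementary i j x
    ; inverse = elementary i j (- x)
    ; inverseˡ = λ p q → trans (elementary-⊡ i j (- x) (elementary i j x) p q) (addRow-addRow i j (- x) x (diagonal λ _ → 1#) e (-‿inverseʳ x) p q)
    ; inverseʳ = λ p q → trans (elementary-⊡ i j x (elementary i j (- x)) p q) (addRow-addRow i j x (- x) (diagonal λ _ → 1#) e (-‿inverseˡ x) p q) }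

  addRow-cong : ∀ {m n} i j x {M N : Matrix m n} → M ≋ N → addRow i j x M ≋ addRow i j x N
  addRow-cong i j x e p q with does (p ≟ i)
  ... | false = e p q
  ... | true = +-cong (e p q) (*-congˡ (e j q))

  elementary-factor : ∀ {m n} {i j : Fin m} {x} {M N : Matrix m n} → M ≋ N → elementary i j x ⊡ M ≋ addRow i j x N
  elementary-factor {i = i} {j} {x} {M} e p q = trans (elementary-⊡ i j x M p q) (addRow-cong i j x e p q)

⟨_∣_∣_⟩ : ∀ {a} {A : Set a} → A → A → A → Vector.Vector A 3
⟨ x ∣ y ∣ z ⟩ = x Vector.∷ y Vector.∷ z Vector.∷ Vector.[]

-- The commutation hypotheses are what makes ρX₀ and ρX₁ invertible, so
-- that they are the images of X₀ and X₁ under an algebra morphism.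
module MatrixData {c ℓ a r} {k : CommutativeRing c ℓ} (A : KAlgebra k a r)
  (𝐗₀ 𝐗₁ 𝐘₀ 𝐘₁ : Units.Unit A)
  (X₁Y₀ : Units.Commute A 𝐗₁ 𝐘₀)
  (X₁Y₁ : Units.Commute A 𝐗₁ 𝐘₁)
  where

  open KAlgebra A
  open Units A
  open Matrices A hiding (algebra)
  open Group units using (_∙_; _⁻¹; ε)
  open RingProperties ring using (-‿distribʳ-*; -‿distribˡ-*; -1*x≈-x; -‿involutive)
  open SetoidReasoning setoid

  M₃ : KAlgebra k a r
  M₃ = Matrices.algebra A 3

  module M₃ = Units M₃

  private
    X₀ = value 𝐗₀
    X₁ = value 𝐗₁
    Y₀ = value 𝐘₀
    Y₁ = value 𝐘₁
    X₁⁻¹ = inverse 𝐗₁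
    Y₁⁻¹ = inverse 𝐘₁

  ρX₀ : Matrix 3 3
  ρX₀ = ⟨ ⟨ X₀ ∣ 0#                                ∣ 0#                  ⟩
        ∣ ⟨ 0# ∣ (1# - X₁) * X₀ + Y₁⁻¹ * Y₀ * Y₁   ∣ (1# - X₁) * X₀ * X₁ ⟩
        ∣ ⟨ 0# ∣ X₀ - Y₁⁻¹ * Y₀ * Y₁ * X₁⁻¹        ∣ X₀ * X₁             ⟩ ⟩

  ρX₁ : Matrix 3 3
  ρX₁ = ⟨ ⟨ (X₁ - 1#) * Y₁ + 1# ∣ Y₁ * (1# - Y₁) ∣ 0# ⟩
        ∣ ⟨ 1# - X₁             ∣ Y₁             ∣ 0# ⟩
        ∣ ⟨ 0#                  ∣ 0#             ∣ 1# ⟩ ⟩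

  𝐃 : M₃.Unit
  𝐃 = diagonalᵘ ⟨ 𝐘₁ ∣ 𝐗₁ ∣ (𝐗₀ ∙ 𝐗₁) ⁻¹ ∙ 𝐘₁ ⁻¹ ∙ 𝐘₀ ∙ 𝐘₁ ⟩

  row : Matrix 1 3
  row _ = ⟨ Y₁ ∣ - (X₁ * Y₁) ∣ 0# ⟩

  col : Matrix 3 1
  col i _ = Y₁⁻¹ * ⟨ X₁ - 1# ∣ 1# - Y₁ ∣ 0# ⟩ i

  private
    x*0+y*0 : ∀ x y {u v} → u ≈ 0# → v ≈ 0# → x * u + y * v ≈ 0#
    x*0+y*0 x y p q = trans (+-cong (trans (*-congˡ p) (zeroʳ x)) (trans (*-congˡ q) (zeroʳ y))) (+-identityˡ 0#)

    0+x*0 : ∀ x → 0# + x * 0# ≈ 0#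
    0+x*0 x = trans (+-identityˡ _) (zeroʳ x)

    1+x*0 : ∀ x → 1# + x * 0# ≈ 1#
    1+x*0 x = trans (+-congˡ (zeroʳ x)) (+-identityʳ 1#)

    0+x*1 : ∀ x → 0# + x * 1# ≈ x
    0+x*1 x = trans (+-identityˡ _) (*-identityʳ x)

    x*1+y*0 : ∀ x y {u v} → u ≈ 1# → v ≈ 0# → x * u + y * v ≈ x
    x*1+y*0 x y p q = trans (+-cong (trans (*-congˡ p) (*-identityʳ x)) (trans (*-congˡ q) (zeroʳ y))) (+-identityʳ x)

    x*0+ : ∀ x {y z} → y ≈ z → x * 0# + y ≈ z
    x*0+ x p = trans (+-cong (zeroʳ x) p) (+-identityˡ _)

    *-cancel : ∀ x {y z} → y * z ≈ 1# → x * y * z ≈ x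
    *-cancel x p = trans (*-assoc _ _ _) (trans (*-congˡ p) (*-identityʳ x))

    d₁ d₂ : Unit
    d₁ = 𝐘₁ ⁻¹ ∙ 𝐘₀ ∙ 𝐘₁ ∙ 𝐗₁ ⁻¹
    d₂ = 𝐗₀ ∙ 𝐗₁

    X₁Y₁⁻¹ : X₁ * Y₁⁻¹ ≈ Y₁⁻¹ * X₁
    X₁Y₁⁻¹ = begin
      X₁ * Y₁⁻¹                    ≈⟨ *-congʳ (*-identityˡ X₁) ⟨
      1# * X₁ * Y₁⁻¹               ≈⟨ *-congʳ (*-congʳ (inverseˡ 𝐘₁)) ⟨
      Y₁⁻¹ * Y₁ * X₁ * Y₁⁻¹        ≈⟨ *-congʳ (*-assoc _ _ _) ⟩
      Y₁⁻¹ * (Y₁ * X₁) * Y₁⁻¹      ≈⟨ *-congʳ (*-congˡ X₁Y₁) ⟨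
      Y₁⁻¹ * (X₁ * Y₁) * Y₁⁻¹      ≈⟨ *-congʳ (*-assoc _ _ _) ⟨
      Y₁⁻¹ * X₁ * Y₁ * Y₁⁻¹        ≈⟨ *-cancel _ (inverseʳ 𝐘₁) ⟩
      Y₁⁻¹ * X₁                    ∎

    X₁-past : ∀ {u v} → X₁ * u ≈ u * X₁ → X₁ * v ≈ v * X₁ → X₁ * (u * v) ≈ u * v * X₁
    X₁-past {u} {v} p q = begin
      X₁ * (u * v)  ≈⟨ *-assoc _ _ _ ⟨
      X₁ * u * v    ≈⟨ *-congʳ p ⟩
      u * X₁ * v    ≈⟨ *-assoc _ _ _ ⟩
      u * (X₁ * v)  ≈⟨ *-congˡ q ⟩
      u * (v * X₁)  ≈⟨ *-assoc _ _ _ ⟨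
      u * v * X₁    ∎

    X₁d₁ : X₁ * value d₁ ≈ Y₁⁻¹ * Y₀ * Y₁
    X₁d₁ = trans (sym (*-assoc _ _ _)) (trans (*-congʳ (X₁-past (X₁-past X₁Y₁⁻¹ X₁Y₀) X₁Y₁)) (*-cancel _ (inverseʳ 𝐗₁)))

    rotate : ∀ x y z → x + (y + z) ≈ y + (x + z)
    rotate x y z = trans (sym (+-assoc _ _ _)) (trans (+-congʳ (+-comm x y)) (+-assoc _ _ _))

    ρX₀₂₁ : value d₂ * (0# + X₁⁻¹ * 1#) + - 1# * (value d₁ * 1#) ≈ X₀ - value d₁
    ρX₀₂₁ = +-cong (trans (*-congˡ (0+x*1 _)) (*-cancel X₀ (inverseʳ 𝐗₁)))
                   (trans (-1*x≈-x _) (-‿cong (*-identityʳ _)))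

    ρX₀₁₁ : value d₁ * 1# + (1# - X₁) * (value d₂ * (0# + X₁⁻¹ * 1#) + - 1# * (value d₁ * 1#))
            ≈ (1# - X₁) * X₀ + Y₁⁻¹ * Y₀ * Y₁
    ρX₀₁₁ = begin
      d * 1# + (1# - X₁) * (value d₂ * (0# + X₁⁻¹ * 1#) + - 1# * (d * 1#))
        ≈⟨ +-cong (*-identityʳ d) (*-congˡ ρX₀₂₁) ⟩
      d + (1# - X₁) * (X₀ - d)
        ≈⟨ +-congˡ (distribˡ _ _ _) ⟩
      d + ((1# - X₁) * X₀ + (1# - X₁) * - d)
        ≈⟨ rotate _ _ _ ⟩
      (1# - X₁) * X₀ + (d + (1# - X₁) * - d)
        ≈⟨ +-congˡ (+-congˡ (distribʳ _ _ _)) ⟩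
      (1# - X₁) * X₀ + (d + (1# * - d + - X₁ * - d))
        ≈⟨ +-congˡ (+-congˡ (+-cong (*-identityˡ _) (trans (sym (-‿distribʳ-* _ _)) (-‿cong (sym (-‿distribˡ-* _ _)))))) ⟩
      (1# - X₁) * X₀ + (d + (- d + - - (X₁ * d)))
        ≈⟨ +-congˡ (+-assoc _ _ _) ⟨
      (1# - X₁) * X₀ + ((d - d) + - - (X₁ * d))
        ≈⟨ +-congˡ (+-cong (-‿inverseʳ d) (-‿involutive _)) ⟩
      (1# - X₁) * X₀ + (0# + X₁ * d)
        ≈⟨ +-congˡ (trans (+-identityˡ _) X₁d₁) ⟩
      (1# - X₁) * X₀ + Y₁⁻¹ * Y₀ * Y₁
        ∎
      where d = value d₁

    factored₀ : M₃.Unit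
    factored₀ = elementaryᵘ 1F 2F ≡.refl (1# - X₁) ∙ᴹ
      (elementaryᵘ 2F 1F ≡.refl (- 1#) ∙ᴹ (diagonalᵘ ⟨ 𝐗₀ ∣ d₁ ∣ d₂ ⟩ ∙ᴹ elementaryᵘ 2F 1F ≡.refl X₁⁻¹))
      where open Group M₃.units using () renaming (_∙_ to _∙ᴹ_)

    factorisation₀ : ρX₀ ≋ M₃.value factored₀
    factorisation₀ i j = trans (entry i j)
      (sym (elementary-factor {i = 1F} {2F} (elementary-factor {i = 2F} {1F}
        (diagonal-⊡ (value ∘ ⟨ 𝐗₀ ∣ d₁ ∣ d₂ ⟩) (elementary 2F 1F X₁⁻¹))) i j))
      where
      entry : ρX₀ ≋ addRow 1F 2F (1# - X₁) (addRow 2F 1F (- 1#)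
                (λ i j → value (⟨ 𝐗₀ ∣ d₁ ∣ d₂ ⟩ i) * elementary 2F 1F X₁⁻¹ i j))
      entry 0F 0F = sym (*-identityʳ _)
      entry 0F 1F = sym (zeroʳ _)
      entry 0F 2F = sym (zeroʳ _)
      entry 1F 0F = sym (x*0+ _ (trans (*-congˡ (x*0+y*0 _ _ (0+x*0 _) (zeroʳ _))) (zeroʳ _)))
      entry 1F 1F = sym ρX₀₁₁
      entry 1F 2F = sym (x*0+ _ (trans (*-congˡ (x*1+y*0 _ _ (1+x*0 _) (zeroʳ _))) (sym (*-assoc _ _ _))))
      entry 2F 0F = sym (x*0+y*0 _ _ (0+x*0 _) (zeroʳ _))
      entry 2F 1F = sym ρX₀₂₁
      entry 2F 2F = sym (x*1+y*0 _ _ (1+x*0 _) (zeroʳ _))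

    w = Y₁⁻¹ * (1# - X₁)

    ρX₁₁₀ : Y₁ * (0# + w * 1#) ≈ 1# - X₁
    ρX₁₁₀ = begin
      Y₁ * (0# + w * 1#)          ≈⟨ *-congˡ (0+x*1 w) ⟩
      Y₁ * (Y₁⁻¹ * (1# - X₁))     ≈⟨ *-assoc _ _ _ ⟨
      Y₁ * Y₁⁻¹ * (1# - X₁)       ≈⟨ *-congʳ (inverseʳ 𝐘₁) ⟩
      1# * (1# - X₁)              ≈⟨ *-identityˡ _ ⟩
      1# - X₁                     ∎

    ρX₁₀₀ : X₁ * 1# + (1# - Y₁) * (Y₁ * (0# + w * 1#)) ≈ (X₁ - 1#) * Y₁ + 1#
    ρX₁₀₀ = begin
      X₁ * 1# + (1# - Y₁) * (Y₁ * (0# + w * 1#))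
        ≈⟨ +-cong (*-identityʳ X₁) (*-congˡ ρX₁₁₀) ⟩
      X₁ + (1# - Y₁) * (1# - X₁)
        ≈⟨ +-congˡ (trans (distribʳ _ _ _) (+-cong (*-identityˡ _) (sym (-‿distribˡ-* _ _)))) ⟩
      X₁ + ((1# - X₁) + - (Y₁ * (1# - X₁)))
        ≈⟨ +-assoc _ _ _ ⟨
      (X₁ + (1# - X₁)) + - (Y₁ * (1# - X₁))
        ≈⟨ +-cong (trans (rotate _ _ _) (trans (+-congˡ (-‿inverseʳ X₁)) (+-identityʳ 1#))) (-‿distribʳ-* _ _) ⟩
      1# + Y₁ * - (1# - X₁)
        ≈⟨ +-comm _ _ ⟩
      Y₁ * - (1# - X₁) + 1#
        ≈⟨ +-congʳ (*-congˡ (⁻¹-anti-homo-// 1# X₁)) ⟩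
      Y₁ * (X₁ - 1#) + 1#
        ≈⟨ +-congʳ (trans (distribˡ _ _ _) (+-congˡ (sym (-‿distribʳ-* _ _)))) ⟩
      (Y₁ * X₁ - Y₁ * 1#) + 1#
        ≈⟨ +-congʳ (+-cong (sym X₁Y₁) (-‿cong (trans (*-identityʳ Y₁) (sym (*-identityˡ Y₁))))) ⟩
      (X₁ * Y₁ - 1# * Y₁) + 1#
        ≈⟨ +-congʳ (trans (distribʳ _ _ _) (+-congˡ (sym (-‿distribˡ-* _ _)))) ⟨
      (X₁ - 1#) * Y₁ + 1#
        ∎
      where open GroupProperties +-group using (⁻¹-anti-homo-//)

    ρX₁₀₁ : X₁ * 0# + (1# - Y₁) * (Y₁ * (1# + w * 0#)) ≈ Y₁ * (1# - Y₁)
    ρX₁₀₁ = x*0+ _ (begin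
      (1# - Y₁) * (Y₁ * (1# + w * 0#))  ≈⟨ *-congˡ (trans (*-congˡ (1+x*0 w)) (*-identityʳ Y₁)) ⟩
      (1# - Y₁) * Y₁                    ≈⟨ distribʳ _ _ _ ⟩
      1# * Y₁ + - Y₁ * Y₁               ≈⟨ +-cong (trans (*-identityˡ Y₁) (sym (*-identityʳ Y₁)))
                                                  (trans (sym (-‿distribˡ-* _ _)) (-‿distribʳ-* _ _)) ⟩
      Y₁ * 1# + Y₁ * - Y₁               ≈⟨ distribˡ _ _ _ ⟨
      Y₁ * (1# - Y₁)                    ∎)

    factored₁ : M₃.Unit
    factored₁ = elementaryᵘ 0F 1F ≡.refl (1# - Y₁) ∙ᴹ (diagonalᵘ ⟨ 𝐗₁ ∣ 𝐘₁ ∣ ε ⟩ ∙ᴹ elementaryᵘ 1F 0F ≡.refl w)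
      where open Group M₃.units using () renaming (_∙_ to _∙ᴹ_)

    factorisation₁ : ρX₁ ≋ M₃.value factored₁
    factorisation₁ i j = trans (entry i j) (sym (elementary-factor {i = 0F} {1F}
        (diagonal-⊡ (value ∘ ⟨ 𝐗₁ ∣ 𝐘₁ ∣ ε ⟩) (elementary 1F 0F w)) i j))
      where
      entry : ρX₁ ≋ addRow 0F 1F (1# - Y₁) (λ i j → value (⟨ 𝐗₁ ∣ 𝐘₁ ∣ ε ⟩ i) * elementary 1F 0F w i j)
      entry 0F 0F = sym ρX₁₀₀
      entry 0F 1F = sym ρX₁₀₁
      entry 0F 2F = sym (x*0+y*0 _ _ refl (trans (*-congˡ (0+x*0 w)) (zeroʳ _)))
      entry 1F 0F = sym ρX₁₁₀
      entry 1F 1F = sym (trans (*-congˡ (1+x*0 w)) (*-identityʳ _))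
      entry 1F 2F = sym (trans (*-congˡ (0+x*0 w)) (zeroʳ _))
      entry 2F 0F = sym (zeroʳ _)
      entry 2F 1F = sym (zeroʳ _)
      entry 2F 2F = sym (*-identityʳ _)

  ρX₀ᵘ ρX₁ᵘ : M₃.Unit
  ρX₀ᵘ = M₃.withValue factored₀ ρX₀ factorisation₀
  ρX₁ᵘ = M₃.withValue factored₁ ρX₁ factorisation₁

module Betti {c ℓ} (k : CommutativeRing c ℓ) where
  private module k = CommutativeRing k

  module F₂ = FreeGroup (Fin 2)
  module 𝐤F₂ = GroupAlgebra k F₂.group

  𝒱 : KAlgebra k c (c ⊔ ℓ)
  𝒱 = 𝐤F₂.algebra

  module 𝒱⊗𝒱 = Tensor 𝒱 𝒱

  private
    module V = KAlgebra 𝒱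
    module U = Units 𝒱
    module T = KAlgebra 𝒱⊗𝒱.algebra
    open Group U.units using () renaming (ε to 1ᵘ)

    x₀ x₁ : U.Unit
    x₀ = 𝐤F₂.⌜ F₂.generator 0F ⌝
    x₁ = 𝐤F₂.⌜ F₂.generator 1F ⌝

    X₁ = U.value x₁
    X₁⁻¹ = U.inverse x₁

  open MatrixData 𝒱⊗𝒱.algebra
    (x₀ 𝒱⊗𝒱.⊗ᵘ 1ᵘ) (x₁ 𝒱⊗𝒱.⊗ᵘ 1ᵘ) (1ᵘ 𝒱⊗𝒱.⊗ᵘ x₀) (1ᵘ 𝒱⊗𝒱.⊗ᵘ x₁)
    (𝒱⊗𝒱.⊗-comm _ _) (𝒱⊗𝒱.⊗-comm _ _) public
  open Matrices 𝒱⊗𝒱.algebra public hiding (algebra)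

  private
    ρXᵘ : Fin 2 → M₃.Unit
    ρXᵘ 0F = ρX₀ᵘ
    ρXᵘ 1F = ρX₁ᵘ

    module ρ-group = F₂.Lift M₃.units ρXᵘ
    module ρ-algebra = 𝐤F₂.Lift M₃ ρ-group.lift ρ-group.hom

  ρ : AlgebraHom 𝒱 M₃
  ρ = ρ-algebra.hom

  open AlgebraHom

  ρ[X₀]≋ρX₀ : ⟦ ρ ⟧ (U.value x₀) ≋ ρX₀
  ρ[X₀]≋ρX₀ i j = T.trans (ρ-algebra.extend-⌜⌝ (F₂.generator 0F) i j) (ρ-group.lift-generator 0F i j)

  ρ[X₁]≋ρX₁ : ⟦ ρ ⟧ (U.value x₁) ≋ ρX₁
  ρ[X₁]≋ρX₁ i j = T.trans (ρ-algebra.extend-⌜⌝ (F₂.generator 1F) i j) (ρ-group.lift-generator 1F i j)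

  -- Under 𝒱 ⊗ 𝒱 ≅ 𝐤[F₂ × F₂], the k-linear map (g , h) ↦ (g , h)⁻¹.
  op₂ : T.Carrier → T.Carrier
  op₂ = tensorMap {A = 𝒱} {B = 𝒱} {A₁ = 𝒱} {B₁ = 𝒱} 𝐤F₂.op 𝐤F₂.op

  rρ : V.Carrier → Matrix 3 3
  rρ v = M₃.inverse 𝐃 ⊡ mapEntries op₂ (transpose (⟦ ρ ⟧ (𝐤F₂.op v))) ⊡ M₃.value 𝐃

  open ScalarsPlusLeftIdeal 𝒱 (X₁ V.- V.1#) public using (_∈k⊕Be; _⊕_·e) renaming (algebra to 𝒲)

  module 𝒲⊗𝒲 = Tensor 𝒲 𝒲

  private
    module W = KAlgebra 𝒲
    module WW = KAlgebra 𝒲⊗𝒲.algebra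
    open 𝒲⊗𝒲 using (_⊗_)

  inclusion : WW.Carrier → T.Carrier
  inclusion = tensorMap {A = 𝒲} {B = 𝒲} {A₁ = 𝒱} {B₁ = 𝒱} proj₁ proj₁

  X₁⁻¹∈𝒲 : W.Carrier
  X₁⁻¹∈𝒲 = X₁⁻¹ , k.1# , V.- X₁⁻¹ , U.inverse-expansion x₁

  X₀^_[X₁-1]∈𝒲 : ℤ → W.Carrier
  X₀^ n [X₁-1]∈𝒲 = X₀ⁿ V.* (X₁ V.- V.1#) , k.0# , X₀ⁿ
                  , V.sym (V.trans (V.+-congʳ V.η-0) (V.+-identityˡ _))
    where X₀ⁿ = U.value 𝐤F₂.⌜ _^ᶻ_ F₂.group (F₂.generator 0F) n ⌝

  -- These values determine Δ, because X₁⁻¹ and the X₀ⁿ(X₁ - 1) generate 𝒲.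
  record IsΔ^𝒲 (Δ : AlgebraHom 𝒲 𝒲⊗𝒲.algebra) : Set (c ⊔ ℓ) where
    private
      a : ℤ → W.Carrier
      a n = X₀^ n [X₁-1]∈𝒲
    field
      Δ-X₁⁻¹ : ⟦ Δ ⟧ X₁⁻¹∈𝒲 WW.≈ X₁⁻¹∈𝒲 ⊗ X₁⁻¹∈𝒲
      Δ-X₀ⁿ[X₁-1] : ∀ n → ⟦ Δ ⟧ (a n) WW.≈
        (a n ⊗ W.1# WW.+ W.1# ⊗ a n)
          WW.- intervalSum WW.ring (+ 1) (n ℤ.- + 1) (λ j → a j ⊗ a (n ℤ.- j))

{-# OPTIONS --safe #-}
-- Put F₁(g) = Δ(g(X₁ - 1)) and F₂(g) = row · rρ(g) · col for g ∈ F₂. Then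
-- rρ is multiplicative and rρ(X₁⁻¹) - 1 = - col · (X₁Y₁)⁻¹ · row, while Δ is
-- multiplicative and Δ(X₁⁻¹) = (X₁Y₁)⁻¹; hence both functions satisfy
-- F(g X₁⁻¹ h) = F(gh) - F(g) (X₁Y₁)⁻¹ F(h) and F(1) = X₁Y₁ - 1. Such a
-- function is determined by its values at the powers of X₀. To compare these,
-- the sums in the definition of Δ are characterised by a first-order
-- recurrence in n ∈ ℤ, which the entries of row · rρ(X₀ⁿ), suitably rescaled,
-- also satisfy.
module Submission where

open import Defs
open import Algebra.Bundles using (CommutativeRing; Group; Monoid; Ring)
import Algebra.Construct.DirectProduct as DirectProduct
open import Algebra.Morphism.Structures using (IsRingHomomorphism)
import Algebra.Properties.Group as GroupProperties
import Algebra.Properties.Ring as RingProperties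
import Algebra.Properties.Semigroup as SemigroupProperties
import Algebra.Properties.Semiring.Sum as Sum
open import Data.Bool.Base using (true; false)
open import Data.Fin.Base as Fin using (Fin; toℕ)
open import Data.Fin.Patterns using (0F; 1F; 2F)
open import Data.Fin.Properties using (_≟_)
open import Data.Integer.Base as ℤ using (ℤ; +_; -[1+_]; 0ℤ)
import Data.Integer.Properties as ℤ
open import Data.Integer.Tactic.RingSolver using (solve-∀)
open import Data.List.Base using ([]; _∷_; [_]; _++_; map)
import Data.List.Properties as List
open import Data.Nat.Base as ℕ using (ℕ)
open import Data.Product.Base as × using (_×_; _,_; proj₁; map₂)
open import Data.Rational.Base using (ℚ; +-*-rawRing)
open import Function.Base using (_∘_; id)
open import Level using (_⊔_)
open import Relation.Binary.PropositionalEquality.Core as ≡ using (_≡_)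
import Relation.Binary.Reasoning.Setoid as SetoidReasoning
open import Relation.Nullary.Decidable using (yes; no)

-- In general neither g nor h lies in `𝒲`, so multiplicativity of Δ does not apply to g X₁⁻¹ h (X₁ -
-- 1) as it stands. Writing X₁⁻¹ = 1 - (X₁ - 1) X₁⁻¹ in the middle leaves only gh(X₁ - 1), g(X₁ -
-- 1), X₁⁻¹ and h(X₁ - 1), all of them in `𝒲`. The cut is made at X₁⁻¹ rather than X₁ because Δ is
-- prescribed there, and because `op` makes the dual matrices explicit at the inverse generators:
-- they are read off from ρ(X₀) and ρ(X₁), while those of X₀ and X₁ would need inverse matrices. For
-- the same reason the recurrence passes from n + 1 to n; invertibility of Y₀ lets it run both ways
-- from n = 0. A recurrence replaces closed formulas because the sum in Δ changes shape with the
-- sign of n, whereas its convention makes one successor rule valid on all of ℤ. On the matrix side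
-- the last two entries of the row are coupled; a suitable combination of them is a geometric
-- sequence, and eliminating it leaves a single inhomogeneous equation.

ℤ-induction : ∀ {p} (P : ℤ → Set p) → P 0ℤ →
  (∀ n → P n → P (ℤ.suc n)) → (∀ n → P (ℤ.suc n) → P n) → ∀ n → P n
ℤ-induction P z up down (+ 0) = z
ℤ-induction P z up down (+ ℕ.suc n) = up (+ n) (ℤ-induction P z up down (+ n))
ℤ-induction P z up down -[1+ 0 ] = down -[1+ 0 ] z
ℤ-induction P z up down -[1+ ℕ.suc n ] = down _ (ℤ-induction P z up down -[1+ n ])

-- Integer powers in a group.

module _ {g e} (G : Group g e) where
  open Group G
  open GroupProperties G
  open SetoidReasoning setoid

  -- Negative powers are defined as inverses of positive ones; this rule lets later arguments ignore
  -- the sign of the exponent.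
  ^ᶻ-suc : ∀ x n → _^ᶻ_ G x (ℤ.suc n) ≈ x ∙ _^ᶻ_ G x n
  ^ᶻ-suc x (+ n) = refl
  ^ᶻ-suc x -[1+ 0 ] = sym (trans (∙-congˡ (⁻¹-cong (identityʳ x))) (inverseʳ x))
  ^ᶻ-suc x -[1+ ℕ.suc n ] = begin
    _^ᶻ_ G x -[1+ n ]                             ≈⟨ \\-leftDividesˡ x _ ⟨
    x ∙ (x ⁻¹ ∙ _^ᶻ_ G x -[1+ n ])                ≈⟨ ∙-congˡ (⁻¹-anti-homo-∙ _ x) ⟨
    x ∙ (_^ᶻ_ G x (+ ℕ.suc n) ∙ x) ⁻¹             ≈⟨ ∙-congˡ (⁻¹-cong (power-comm (ℕ.suc n))) ⟩
    x ∙ _^ᶻ_ G x -[1+ ℕ.suc n ]                   ∎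
    where
    power-comm : ∀ m → _^ᶻ_ G x (+ m) ∙ x ≈ x ∙ _^ᶻ_ G x (+ m)
    power-comm 0 = trans (identityˡ x) (sym (identityʳ x))
    power-comm (ℕ.suc m) = trans (assoc x _ x) (∙-congˡ (power-comm m))

  ^ᶻ-comm : ∀ x n → _^ᶻ_ G x n ∙ x ≈ x ∙ _^ᶻ_ G x n
  ^ᶻ-comm x = ℤ-induction _ (trans (identityˡ x) (sym (identityʳ x)))
    (λ n p → trans (∙-congʳ (^ᶻ-suc x n)) (trans (assoc x _ x) (∙-congˡ (trans p (sym (^ᶻ-suc x n))))))
    (λ n p → ∙-cancelˡ x _ _ (trans (sym (assoc x _ x)) (trans (∙-congʳ (sym (^ᶻ-suc x n))) (trans p (∙-congˡ (^ᶻ-suc x n))))))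

  ^ᶻ-sucʳ : ∀ x n → _^ᶻ_ G x (ℤ.suc n) ≈ _^ᶻ_ G x n ∙ x
  ^ᶻ-sucʳ x n = trans (^ᶻ-suc x n) (sym (^ᶻ-comm x n))

-- Sums with integer bounds.

module _ {a r} (R : Ring a r) where
  open Ring R
  open Sum semiring using (sum; sum-cong-≋)
  open RingProperties R using (-‿+-comm; -0#≈0#)
  open SetoidReasoning setoid

  private
    length-suc : ∀ p q l → q ℤ.- p ℤ.+ + 1 ≡ l → ℤ.suc q ℤ.- p ℤ.+ + 1 ≡ ℤ.suc l
    length-suc p q l ≡.refl = lemma p q
      where
      lemma : ∀ p q → (+ 1 ℤ.+ q) ℤ.- p ℤ.+ + 1 ≡ + 1 ℤ.+ (q ℤ.- p ℤ.+ + 1)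
      lemma = solve-∀

    last-index : ∀ p q n → q ℤ.- p ℤ.+ + 1 ≡ n → p ℤ.+ n ≡ ℤ.suc q
    last-index p q _ ≡.refl = lemma p q
      where
      lemma : ∀ p q → p ℤ.+ (q ℤ.- p ℤ.+ + 1) ≡ + 1 ℤ.+ q
      lemma = solve-∀

    shift : ∀ q → q ℤ.+ + 1 ℤ.+ + 0 ≡ + 1 ℤ.+ q
    shift = solve-∀

    shift-suc : ∀ q i → q ℤ.+ + 1 ℤ.+ + ℕ.suc i ≡ ℤ.suc q ℤ.+ + 1 ℤ.+ + i
    shift-suc q i = lemma q (+ i)
      where
      lemma : ∀ q i → q ℤ.+ + 1 ℤ.+ (+ 1 ℤ.+ i) ≡ (+ 1 ℤ.+ q) ℤ.+ + 1 ℤ.+ i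
      lemma = solve-∀

    sum-snoc : ∀ n (g : ℕ → Carrier) → sum {ℕ.suc n} (g ∘ toℕ) ≈ sum {n} (g ∘ toℕ) + g n
    sum-snoc 0 g = +-comm _ _
    sum-snoc (ℕ.suc n) g = trans (+-congˡ (sum-snoc n (g ∘ ℕ.suc))) (sym (+-assoc _ _ _))

    -x-y+x : ∀ x y → - (x + y) + x ≈ - y
    -x-y+x x y = begin
      - (x + y) + x    ≈⟨ +-congʳ (-‿+-comm x y) ⟨
      - x - y + x      ≈⟨ +-congʳ (+-comm _ _) ⟩
      - y - x + x      ≈⟨ +-assoc _ _ _ ⟩
      - y + (- x + x)  ≈⟨ +-congˡ (-‿inverseˡ x) ⟩
      - y + 0#         ≈⟨ +-identityʳ _ ⟩
      - y              ∎

  -- The sign convention for q < p - 1 is what makes this hold for all integers: on a negative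
  -- interval, raising q removes one negated summand, which is the same as adding it.
  intervalSum-suc : ∀ p q f → intervalSum R p (ℤ.suc q) f ≈ intervalSum R p q f + f (ℤ.suc q)
  intervalSum-suc p q f with q ℤ.- p ℤ.+ + 1 in eq
  ... | + n rewrite length-suc p q _ eq = trans (sum-snoc n λ i → f (p ℤ.+ + i))
          (+-congˡ (reflexive (≡.cong f (last-index p q (+ n) eq))))
  -- Here q = p - 2: the single negated summand cancels and the empty sum remains.
  ... | -[1+ 0 ] rewrite length-suc p q _ eq = sym (begin
          - (f (q ℤ.+ + 1 ℤ.+ + 0) + 0#) + f (ℤ.suc q)
            ≈⟨ +-congˡ (reflexive (≡.cong f (shift q))) ⟨
          - (f (q ℤ.+ + 1 ℤ.+ + 0) + 0#) + f (q ℤ.+ + 1 ℤ.+ + 0)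
            ≈⟨ -x-y+x _ _ ⟩
          - 0#
            ≈⟨ -0#≈0# ⟩
          0# ∎)
  ... | -[1+ ℕ.suc n ] rewrite length-suc p q _ eq = sym (begin
          - (f (q ℤ.+ + 1 ℤ.+ + 0) + tail) + f (ℤ.suc q)
            ≈⟨ +-congˡ (reflexive (≡.cong f (shift q))) ⟨
          - (f (q ℤ.+ + 1 ℤ.+ + 0) + tail) + f (q ℤ.+ + 1 ℤ.+ + 0)
            ≈⟨ -x-y+x _ tail ⟩
          - tail
            ≈⟨ -‿cong (sum-cong-≋ {ℕ.suc n} λ i → reflexive (≡.cong f (shift-suc q (toℕ i)))) ⟩
          - sum {ℕ.suc n} (λ i → f (ℤ.suc q ℤ.+ + 1 ℤ.+ + toℕ i)) ∎)
    where tail = sum {ℕ.suc n} (λ i → f (q ℤ.+ + 1 ℤ.+ + ℕ.suc (toℕ i)))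

  intervalSum-cong : ∀ p q {f g} → (∀ n → f n ≈ g n) → intervalSum R p q f ≈ intervalSum R p q g
  intervalSum-cong p q f≈g with q ℤ.- p ℤ.+ + 1
  ... | + n = sum-cong-≋ {n} λ i → f≈g (p ℤ.+ + toℕ i)
  ... | -[1+ n ] = -‿cong (sum-cong-≋ {ℕ.suc n} λ i → f≈g (q ℤ.+ + 1 ℤ.+ + toℕ i))

module _ {a r b s} (R : Ring a r) (S : Ring b s) where
  private
    module R = Ring R
    module S = Ring S
  open Sum R.semiring using () renaming (sum to sumᴿ)
  open Sum S.semiring using () renaming (sum to sumˢ)

  module _ (h : R.Carrier → S.Carrier) (h-cong : ∀ {x y} → x R.≈ y → h x S.≈ h y)
    (h-+ : ∀ x y → h (x R.+ y) S.≈ h x S.+ h y) where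

    private
      h-0 : h R.0# S.≈ S.0#
      h-0 = RingProperties.x+x≈x⇒x≈0 S _ (S.trans (S.sym (h-+ _ _)) (h-cong (R.+-identityˡ _)))

      sum-homo : ∀ n f → h (sumᴿ {n} f) S.≈ sumˢ {n} (h ∘ f)
      sum-homo 0 f = h-0
      sum-homo (ℕ.suc n) f = S.trans (h-+ _ _) (S.+-congˡ (sum-homo n (f ∘ Fin.suc)))

    additive⇒neg : ∀ x → h (R.- x) S.≈ S.- h x
    additive⇒neg x = GroupProperties.inverseˡ-unique S.+-group _ _
      (S.trans (S.sym (h-+ _ _)) (S.trans (h-cong (R.-‿inverseˡ x)) h-0))

    intervalSum-homo : ∀ p q f → h (intervalSum R p q f) S.≈ intervalSum S p q (h ∘ f)
    intervalSum-homo p q f with q ℤ.- p ℤ.+ + 1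
    ... | + n = sum-homo n λ i → f (p ℤ.+ + toℕ i)
    ... | -[1+ n ] = S.trans (additive⇒neg _) (S.-‿cong (sum-homo (ℕ.suc n) λ i → f (q ℤ.+ + 1 ℤ.+ + toℕ i)))

-- First-order recurrences over the integers.

module Recurrences {c ℓ a r} {k : CommutativeRing c ℓ} (A : KAlgebra k a r) (𝐲 : Units.Unit A) where
  open KAlgebra A
  open Units A
  open RingProperties ring
  open SemigroupProperties *-semigroup using (uv≈w⇒xu∙v≈xw)
  open SetoidReasoning setoid

  private
    y = value 𝐲
    y⁻¹ = inverse 𝐲

  -- Directed from n + 1 to n, as the matrix of X₀⁻¹ will supply it. Since y is a unit, the value at
  -- 0 determines f in both directions.
  Recurrence : (ℤ → Carrier) → (ℤ → Carrier) → Set r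
  Recurrence d f = ∀ n → f n ≈ d n + f (ℤ.suc n) * y⁻¹

  recurrence-unique : ∀ {d f g} → Recurrence d f → Recurrence d g → f 0ℤ ≈ g 0ℤ → ∀ n → f n ≈ g n
  recurrence-unique {d} {f} {g} F G f₀≈g₀ = ℤ-induction _ f₀≈g₀
    (λ n p → begin
      f (ℤ.suc n)              ≈⟨ cancel _ ⟨
      f (ℤ.suc n) * y⁻¹ * y    ≈⟨ *-congʳ (+-cancelˡ (d n) _ _ (trans (sym (F n)) (trans p (G n)))) ⟩
      g (ℤ.suc n) * y⁻¹ * y    ≈⟨ cancel _ ⟩
      g (ℤ.suc n)              ∎)
    (λ n p → trans (F n) (trans (+-congˡ (*-congʳ p)) (sym (G n))))
    where
    cancel : ∀ x → x * y⁻¹ * y ≈ x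
    cancel x = trans (uv≈w⇒xu∙v≈xw (inverseˡ 𝐲) x) (*-identityʳ x)

  module _ (p : ℤ → Carrier) (p-0 : p 0ℤ ≈ 1#) (p-suc : ∀ n → p (ℤ.suc n) ≈ p n * y)
    (d : ℤ → Carrier) where

    -- With y = Y₀, p n = Y₀ⁿ and d j = X₀ʲ(X₁ - 1), this is the left cofactor of Y₁ - 1 in Δ(X₀ⁿ(X₁
    -- - 1)), once the term X₀ⁿ(X₁ - 1) is set aside.
    truncated : ℤ → Carrier
    truncated n = p n - intervalSum ring (+ 1) (n ℤ.- + 1) (λ j → d j * p (n ℤ.- j))

    private
      p-pred : ∀ n → p (ℤ.suc n) * y⁻¹ ≈ p n
      p-pred n = trans (*-congʳ (p-suc n)) (trans (uv≈w⇒xu∙v≈xw (inverseʳ 𝐲) _) (*-identityʳ _))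

      suc-n-1 : ∀ n → (+ 1 ℤ.+ n) ℤ.- + 1 ≡ + 1 ℤ.+ (n ℤ.- + 1)
      suc-n-1 = solve-∀

      suc[n-1] : ∀ n → + 1 ℤ.+ (n ℤ.- + 1) ≡ n
      suc[n-1] = solve-∀

      suc-n-j : ∀ n j → (+ 1 ℤ.+ n) ℤ.- j ≡ + 1 ℤ.+ (n ℤ.- j)
      suc-n-j = solve-∀

      summand : ∀ n j → (d j * p (ℤ.suc n ℤ.- j)) * y⁻¹ ≈ d j * p (n ℤ.- j)
      summand n j = trans (*-assoc _ _ _) (*-congˡ
        (trans (*-congʳ (reflexive (≡.cong p (suc-n-j n j)))) (p-pred _)))

      S : ℤ → Carrier
      S n = intervalSum ring (+ 1) (n ℤ.- + 1) (λ j → d j * p (n ℤ.- j))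

      -- Multiplication by y⁻¹ lowers the exponent n + 1 - j in every summand by one; the additional
      -- summand, at j = n, then carries p 0 = 1.
      S-suc : ∀ n → S (ℤ.suc n) * y⁻¹ ≈ S n + d n
      S-suc n = begin
        S (ℤ.suc n) * y⁻¹
          ≈⟨ intervalSum-homo ring ring (_* y⁻¹) *-congʳ (λ _ _ → distribʳ _ _ _) (+ 1) (ℤ.suc n ℤ.- + 1) _ ⟩
        intervalSum ring (+ 1) (ℤ.suc n ℤ.- + 1) (λ j → (d j * p (ℤ.suc n ℤ.- j)) * y⁻¹)
          ≈⟨ intervalSum-cong ring (+ 1) (ℤ.suc n ℤ.- + 1) (summand n) ⟩
        intervalSum ring (+ 1) (ℤ.suc n ℤ.- + 1) (λ j → d j * p (n ℤ.- j))
          ≡⟨ ≡.cong (λ q → intervalSum ring (+ 1) q (λ j → d j * p (n ℤ.- j))) (suc-n-1 n) ⟩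
        intervalSum ring (+ 1) (ℤ.suc (n ℤ.- + 1)) (λ j → d j * p (n ℤ.- j))
          ≈⟨ intervalSum-suc ring (+ 1) (n ℤ.- + 1) _ ⟩
        S n + d (ℤ.suc (n ℤ.- + 1)) * p (n ℤ.- ℤ.suc (n ℤ.- + 1))
          ≡⟨ ≡.cong (λ m → S n + d m * p (n ℤ.- m)) (suc[n-1] n) ⟩
        S n + d n * p (n ℤ.- n)
          ≈⟨ +-congˡ (*-congˡ (trans (reflexive (≡.cong p (ℤ.+-inverseʳ n))) p-0)) ⟩
        S n + d n * 1#
          ≈⟨ +-congˡ (*-identityʳ _) ⟩
        S n + d n
          ∎

    -- By convention the sum from 1 to -1 is minus the summand at 0, so the two signs cancel and d 0
    -- is added.
    truncated-0 : truncated 0ℤ ≈ 1# + d 0ℤ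
    truncated-0 = +-cong p-0 (trans (-‿involutive _)
      (trans (+-identityʳ _) (trans (*-congˡ p-0) (*-identityʳ _))))

    truncated-recurrence : Recurrence d truncated
    truncated-recurrence n = sym (begin
      d n + (p (ℤ.suc n) - S (ℤ.suc n)) * y⁻¹          ≈⟨ +-congˡ ([y-z]x≈yx-zx _ _ _) ⟩
      d n + (p (ℤ.suc n) * y⁻¹ - S (ℤ.suc n) * y⁻¹)    ≈⟨ +-congˡ (+-cong (p-pred n) (-‿cong (S-suc n))) ⟩
      d n + (p n - (S n + d n))                        ≈⟨ +-congˡ (+-congˡ (-‿+-comm _ _)) ⟨
      d n + (p n + (- S n - d n))                      ≈⟨ +-congˡ (+-assoc _ _ _) ⟨
      d n + ((p n - S n) - d n)                        ≈⟨ +-assoc _ _ _ ⟨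
      (d n + (p n - S n)) - d n                        ≈⟨ xyx⁻¹≈y _ _ ⟩
      p n - S n                                        ∎)

-- Functions on words determined by cutting at X₁.

-- In the application, w = X₁Y₁.
module Cutting {c ℓ a r} {k : CommutativeRing c ℓ} (A : KAlgebra k a r) (𝐰 : Units.Unit A) where
  open KAlgebra A
  open Units A
  open FreeGroup (Fin 2)
  open Group group using (_∙_; _⁻¹) renaming (Carrier to Word; _≈_ to _∼_; sym to ∼-sym; trans to ∼-trans; ∙-congˡ to ++-congˡ)
  open RingProperties ring
  open SetoidReasoning setoid

  private
    w = value 𝐰
    w⁻¹ = inverse 𝐰

    x₀ x₁ : Word
    x₀ = generator 0F
    x₁ = generator 1F

    x₀^ : ℤ → Word
    x₀^ = _^ᶻ_ group x₀

  record Cuttable (F : Word → Carrier) : Set r where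
    field
      cong : ∀ {g h} → g ∼ h → F g ≈ F h
      cut  : ∀ g h → F (g ∙ (x₁ ⁻¹ ∙ h)) ≈ F (g ∙ h) - F g * (w⁻¹ * F h)
      F-ε  : F [] ≈ w - 1#

  module _ {F} (cuttable : Cuttable F) where
    open Cuttable cuttable

    -- The normalisation `F-ε` enters here: (w - 1) w⁻¹ = 1 - w⁻¹ turns a cut after the empty prefix
    -- into a scaling.
    strip : ∀ h → F (x₁ ⁻¹ ∙ h) ≈ w⁻¹ * F h
    strip h = begin
      F (x₁ ⁻¹ ∙ h)                            ≈⟨ cut [] h ⟩
      F h - F [] * (w⁻¹ * F h)                 ≈⟨ +-congˡ (-‿cong (*-congʳ F-ε)) ⟩
      F h - (w - 1#) * (w⁻¹ * F h)             ≈⟨ +-congˡ (-‿cong ([y-z]x≈yx-zx _ _ _)) ⟩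
      F h - (w * (w⁻¹ * F h) - 1# * (w⁻¹ * F h))
        ≈⟨ +-congˡ (-‿cong (+-cong (trans (sym (*-assoc _ _ _)) (trans (*-congʳ (inverseʳ 𝐰)) (*-identityˡ _)))
             (-‿cong (*-identityˡ _)))) ⟩
      F h - (F h - w⁻¹ * F h)                  ≈⟨ +-congˡ (⁻¹-anti-homo‿- _ _) ⟩
      F h + (w⁻¹ * F h - F h)                  ≈⟨ +-assoc _ _ _ ⟨
      F h + w⁻¹ * F h - F h                    ≈⟨ xyx⁻¹≈y _ _ ⟩
      w⁻¹ * F h                                ∎

    x₁⁻¹x₁ : ∀ h → (x₁ ⁻¹ ∙ (x₁ ∙ h)) ∼ h
    x₁⁻¹x₁ h = GroupProperties.\\-leftDividesʳ group x₁ h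

    -- The rule for x₁ follows from the one for x₁⁻¹: cut before x₁ h, where x₁⁻¹ x₁ cancels, and
    -- use `strip` to recognise w⁻¹ F(x₁ h) as F(h).
    paste : ∀ g h → F (g ∙ (x₁ ∙ h)) ≈ F (g ∙ h) + F g * F h
    paste g h = begin
      F (g ∙ (x₁ ∙ h))
        ≈⟨ //-rightDividesˡ _ _ ⟨
      F (g ∙ (x₁ ∙ h)) - F g * (w⁻¹ * F (x₁ ∙ h)) + F g * (w⁻¹ * F (x₁ ∙ h))
        ≈⟨ +-congʳ (cut g (x₁ ∙ h)) ⟨
      F (g ∙ (x₁ ⁻¹ ∙ (x₁ ∙ h))) + F g * (w⁻¹ * F (x₁ ∙ h))
        ≈⟨ +-congˡ (*-congˡ (strip (x₁ ∙ h))) ⟨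
      F (g ∙ (x₁ ⁻¹ ∙ (x₁ ∙ h))) + F g * F (x₁ ⁻¹ ∙ (x₁ ∙ h))
        ≈⟨ +-cong (cong (++-congˡ {g} (x₁⁻¹x₁ h))) (*-congˡ (cong (x₁⁻¹x₁ h))) ⟩
      F (g ∙ h) + F g * F h
        ∎

  -- Cutting a word at its leftmost x₁ or x₁⁻¹ leaves a power of x₀ and shorter
  -- words.
  cuttable-unique : ∀ {F F′} → Cuttable F → Cuttable F′ → (∀ n → F (x₀^ n) ≈ F′ (x₀^ n)) → ∀ g → F g ≈ F′ g
  cuttable-unique {F} {F′} c c′ agree g = go g 0ℤ
    where
    module c = Cuttable c
    module c′ = Cuttable c′
    module F₂ = GroupProperties group
    open Group group using () renaming (∙-congʳ to ++-congʳ; assoc to ++-assoc; identityʳ to ++-identityʳ)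

    via : ∀ {h h′} → h ∼ h′ → F h′ ≈ F′ h′ → F h ≈ F′ h
    via p e = trans (c.cong p) (trans e (c′.cong (∼-sym p)))

    x₀^-pred : ∀ n → (x₀^ n ∙ x₀ ⁻¹) ∼ x₀^ (ℤ.pred n)
    x₀^-pred n = ∼-trans (++-congʳ {x₀ ⁻¹} (∼-trans (Group.reflexive group (≡.cong x₀^ (≡.sym (ℤ.suc-pred n)))) (^ᶻ-sucʳ group x₀ (ℤ.pred n))))
      (F₂.//-rightDividesʳ x₀ (x₀^ (ℤ.pred n)))

    -- The leading run of x₀ letters is kept as the exponent n, so the recursion is structural in
    -- the remaining word, which need not be reduced. After a cut the remainder restarts with
    -- exponent 0.
    go : ∀ g n → F (x₀^ n ∙ g) ≈ F′ (x₀^ n ∙ g)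
    go [] n = via (++-identityʳ (x₀^ n)) (agree n)
    go ((0F , true) ∷ g) n = via
      (∼-trans (∼-sym (++-assoc (x₀^ n) x₀ g)) (++-congʳ {g} (∼-sym (^ᶻ-sucʳ group x₀ n))))
      (go g (ℤ.suc n))
    go ((0F , false) ∷ g) n = via
      (∼-trans (∼-sym (++-assoc (x₀^ n) (x₀ ⁻¹) g)) (++-congʳ {g} (x₀^-pred n)))
      (go g (ℤ.pred n))
    go ((1F , true) ∷ g) n = trans (paste c (x₀^ n) g)
      (trans (+-cong (go g n) (*-cong (agree n) (go g 0ℤ))) (sym (paste c′ (x₀^ n) g)))
    go ((1F , false) ∷ g) n = trans (c.cut (x₀^ n) g)
      (trans (+-cong (go g n) (-‿cong (*-cong (agree n) (*-congˡ (go g 0ℤ))))) (sym (c′.cut (x₀^ n) g)))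

-- Commuting elements and antimorphisms.

module Commuting {a r} (R : Ring a r) where
  open Ring R
  open RingProperties R using (-‿distribˡ-*; -‿distribʳ-*)

  infix 4 _⇄_
  _⇄_ : Carrier → Carrier → Set r
  x ⇄ y = x * y ≈ y * x

  ⇄-* : ∀ {x y z} → x ⇄ y → x ⇄ z → x ⇄ y * z
  ⇄-* {x} {y} {z} p q = trans (sym (*-assoc x y z)) (trans (*-congʳ p)
    (trans (*-assoc y x z) (trans (*-congˡ q) (sym (*-assoc y z x)))))

  ⇄-sub : ∀ {x y z} → x ⇄ y → x ⇄ z → x ⇄ y - z
  ⇄-sub {x} {y} {z} p q = trans (distribˡ x y (- z)) (trans
    (+-cong p (trans (sym (-‿distribʳ-* x z)) (trans (-‿cong q) (-‿distribˡ-* z x)))) (sym (distribʳ x y (- z))))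

  ⇄-1 : ∀ {x} → x ⇄ 1#
  ⇄-1 {x} = trans (*-identityʳ x) (sym (*-identityˡ x))

  ⇄-inverse : ∀ {x y z} → y * z ≈ 1# → z * y ≈ 1# → x ⇄ y → x ⇄ z
  ⇄-inverse {x} {y} {z} yz zy p = trans (sym (*-identityˡ _)) (trans (*-congʳ (sym zy))
    (trans (*-assoc z y _) (*-congˡ (trans (sym (*-assoc y x z)) (trans (*-congʳ (sym p))
    (trans (*-assoc x y z) (trans (*-congˡ yz) (*-identityʳ x))))))))

record IsAntimorphism {c ℓ a r} {k : CommutativeRing c ℓ} (A : KAlgebra k a r)
  (σ : KAlgebra.Carrier A → KAlgebra.Carrier A) : Set (c ⊔ a ⊔ r) where
  open KAlgebra A
  field
    σ-cong : ∀ {x y} → x ≈ y → σ x ≈ σ y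
    σ-+    : ∀ x y → σ (x + y) ≈ σ x + σ y
    σ-*    : ∀ x y → σ (x * y) ≈ σ y * σ x
    σ-η    : ∀ c → σ (η c) ≈ η c

  σ-0 : σ 0# ≈ 0#
  σ-0 = trans (σ-cong (sym η-0)) (trans (σ-η _) η-0)

  σ-1 : σ 1# ≈ 1#
  σ-1 = trans (σ-cong (sym η-1)) (trans (σ-η _) η-1)

-- The matrix coefficient and its cut rule.

module DualRepresentation {c ℓ a r} {k : CommutativeRing c ℓ} (A : KAlgebra k a r)
  (𝐗₀ 𝐗₁ 𝐘₀ 𝐘₁ : Units.Unit A)
  (X₁Y₀ : Units.Commute A 𝐗₁ 𝐘₀)
  (X₁Y₁ : Units.Commute A 𝐗₁ 𝐘₁)
  (X₀Y₁ : Units.Commute A 𝐗₀ 𝐘₁)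
  where

  open KAlgebra A
  open Units A hiding (Commute)
  open Matrices A hiding (algebra)
  open Sum semiring using (sum; ∑-distrib-+; *-distribˡ-sum; *-distribʳ-sum)
  open RingProperties ring
  open Group units using (_∙_; _⁻¹)
  open SemigroupProperties *-semigroup using (uv≈w⇒xu∙v≈xw)
  open Commuting ring
  open SetoidReasoning setoid
  open MatrixData A 𝐗₀ 𝐗₁ 𝐘₀ 𝐘₁ X₁Y₀ X₁Y₁ using (row; col; ρX₀; ρX₁; 𝐃; module M₃)

  private
    X₀ = value 𝐗₀
    X₁ = value 𝐗₁
    Y₀ = value 𝐘₀
    Y₁ = value 𝐘₁
    X₀⁻¹ = inverse 𝐗₀
    X₁⁻¹ = inverse 𝐗₁
    Y₀⁻¹ = inverse 𝐘₀
    Y₁⁻¹ = inverse 𝐘₁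

  -- In this order the inverse unfolds to X₁⁻¹ Y₁⁻¹, which is how X₁⁻¹ ⊗ X₁⁻¹ splits into its left
  -- and right factors.
  𝐰 : Unit
  𝐰 = 𝐘₁ ∙ 𝐗₁

  w w⁻¹ : Carrier
  w = value 𝐰
  w⁻¹ = inverse 𝐰

  -- row · D⁻¹ and D · col
  α : Matrix 1 3
  α _ = ⟨ 1# ∣ - Y₁ ∣ 0# ⟩

  β : Matrix 3 1
  β i _ = ⟨ X₁ - 1# ∣ X₁ * (Y₁⁻¹ - 1#) ∣ 0# ⟩ i

  private
    ⇄⁻¹ : ∀ {x} u → x ⇄ value u → x ⇄ inverse u
    ⇄⁻¹ u = ⇄-inverse (inverseʳ u) (inverseˡ u)

    X₁Y₁⁻¹ : X₁ ⇄ Y₁⁻¹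
    X₁Y₁⁻¹ = ⇄⁻¹ 𝐘₁ X₁Y₁

    cancelʳ : ∀ x {y z} → y * z ≈ 1# → x * y * z ≈ x
    cancelʳ x p = trans (uv≈w⇒xu∙v≈xw p x) (*-identityʳ x)

    cancelˡ : ∀ x {y z} → y * z ≈ 1# → y * (z * x) ≈ x
    cancelˡ x p = trans (sym (*-assoc _ _ _)) (trans (*-congʳ p) (*-identityˡ x))

    swap : ∀ x {y z} → y ⇄ z → x * y * z ≈ x * z * y
    swap x p = trans (*-assoc _ _ _) (trans (*-congˡ p) (sym (*-assoc _ _ _)))

    𝐝 : Fin 3 → Unit
    𝐝 = ⟨ 𝐘₁ ∣ 𝐗₁ ∣ (𝐗₀ ∙ 𝐗₁) ⁻¹ ∙ 𝐘₁ ⁻¹ ∙ 𝐘₀ ∙ 𝐘₁ ⟩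

    row-α : ∀ i j → (row ⊡ M₃.inverse 𝐃) i j ≈ α i j
    row-α 0F j = trans (⊡-diagonal row (inverse ∘ 𝐝) 0F j) (entry j)
      where
      entry : ∀ j → row 0F j * inverse (𝐝 j) ≈ α 0F j
      entry 0F = inverseʳ 𝐘₁
      entry 1F = trans (sym (-‿distribˡ-* _ _)) (-‿cong (trans (*-congʳ X₁Y₁) (cancelʳ Y₁ (inverseʳ 𝐗₁))))
      entry 2F = zeroˡ _

    col-β : ∀ i j → (M₃.value 𝐃 ⊡ col) i j ≈ β i j
    col-β i 0F = trans (diagonal-⊡ (value ∘ 𝐝) col i 0F) (entry i)
      where
      entry : ∀ i → value (𝐝 i) * col i 0F ≈ β i 0F
      entry 0F = cancelˡ _ (inverseʳ 𝐘₁)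
      entry 1F = *-congˡ (trans (x[y-z]≈xy-xz _ _ _) (+-cong (*-identityʳ _) (-‿cong (inverseˡ 𝐘₁))))
      entry 2F = trans (*-congˡ (zeroʳ _)) (zeroʳ _)

    ⊡-congˡ : ∀ {m n p} (M : Matrix m n) {N N′ : Matrix n p} → N ≋ N′ → M ⊡ N ≋ M ⊡ N′
    ⊡-congˡ M p i j = sum-cong λ h → *-congˡ {M i h} (p h j)

    ⊡-congʳ : ∀ {m n p} {M M′ : Matrix m n} (N : Matrix n p) → M ≋ M′ → M ⊡ N ≋ M′ ⊡ N
    ⊡-congʳ N p i j = sum-cong λ h → *-congʳ {N h j} (p i h)

  -- The conjugation by D moves onto the outer vectors, so that everything afterwards concerns the
  -- unconjugated matrices.
  conjugate : ∀ M → row ⊡ (M₃.inverse 𝐃 ⊡ M ⊡ M₃.value 𝐃) ⊡ col ≋ α ⊡ M ⊡ β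
  conjugate M i j = begin
    (row ⊡ (D⁻¹ ⊡ M ⊡ D) ⊡ col) i j    ≈⟨ ⊡-congʳ col (⊡-assoc row (D⁻¹ ⊡ M) D) i j ⟨
    (row ⊡ (D⁻¹ ⊡ M) ⊡ D ⊡ col) i j    ≈⟨ ⊡-assoc (row ⊡ (D⁻¹ ⊡ M)) D col i j ⟩
    (row ⊡ (D⁻¹ ⊡ M) ⊡ (D ⊡ col)) i j  ≈⟨ ⊡-congˡ (row ⊡ (D⁻¹ ⊡ M)) col-β i j ⟩
    (row ⊡ (D⁻¹ ⊡ M) ⊡ β) i j          ≈⟨ ⊡-congʳ β (⊡-assoc row D⁻¹ M) i j ⟨
    (row ⊡ D⁻¹ ⊡ M ⊡ β) i j            ≈⟨ ⊡-congʳ β (⊡-congʳ M row-α) i j ⟩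
    (α ⊡ M ⊡ β) i j                    ∎
    where
    D = M₃.value 𝐃
    D⁻¹ = M₃.inverse 𝐃

  open FreeGroup (Fin 2) using (generator; group)
  open Group group using () renaming (Carrier to Word; _≈_ to _∼_; _∙_ to _·_; _⁻¹ to inv; sym to ∼-sym)

  -- In the application σ is `op₂` and N g is ρ(g⁻¹), transposed and with σ applied to the entries.
  -- Inversion of g reverses products, and so does transposition combined with σ, hence N is
  -- multiplicative.
  module Coefficients {σ : Carrier → Carrier} (σ-antimorphism : IsAntimorphism A σ)
    (σ-X₀ : σ X₀ ≈ X₀⁻¹) (σ-X₁ : σ X₁ ≈ X₁⁻¹) (σ-Y₀ : σ Y₀ ≈ Y₀⁻¹) (σ-Y₁ : σ Y₁ ≈ Y₁⁻¹)
    (σ-X₁⁻¹ : σ X₁⁻¹ ≈ X₁) (σ-Y₁⁻¹ : σ Y₁⁻¹ ≈ Y₁)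
    (N : Word → Matrix 3 3) (N-cong : ∀ {g h} → g ∼ h → N g ≋ N h)
    (N-· : ∀ g h → N (g · h) ≋ N g ⊡ N h) (N-ε : N [] ≋ diagonal λ _ → 1#)
    (N-x₀⁻¹ : N (inv (generator 0F)) ≋ mapEntries σ (transpose ρX₀))
    (N-x₁⁻¹ : N (inv (generator 1F)) ≋ mapEntries σ (transpose ρX₁))
    where

    open IsAntimorphism σ-antimorphism

    private
      σ-sub : ∀ {x y x′ y′} → σ x ≈ x′ → σ y ≈ y′ → σ (x - y) ≈ x′ - y′
      σ-sub p q = trans (σ-+ _ _) (+-cong p (trans (additive⇒neg ring ring σ σ-cong σ-+ _) (-‿cong q)))

      σ-** : ∀ {x y x′ y′} → σ x ≈ x′ → σ y ≈ y′ → σ (x * y) ≈ y′ * x′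
      σ-** p q = trans (σ-* _ _) (*-cong q p)

      σ-++ : ∀ {x y x′ y′} → σ x ≈ x′ → σ y ≈ y′ → σ (x + y) ≈ x′ + y′
      σ-++ p q = trans (σ-+ _ _) (+-cong p q)

      -- The values of N at the inverse generators: σᵗρ inverts its argument,
      -- so no inverse of ρX₀ or ρX₁ has to be computed.
      N₀ N₁ : Matrix 3 3
      N₀ = mapEntries σ (transpose ρX₀)
      N₁ = mapEntries σ (transpose ρX₁)

      δ : Matrix 3 3
      δ = diagonal λ _ → 1#

      β₀w⁻¹ : β 0F 0F * w⁻¹ ≈ (1# - X₁⁻¹) * Y₁⁻¹
      β₀w⁻¹ = trans (sym (*-assoc _ _ _)) (*-congʳ (trans ([y-z]x≈yx-zx _ _ _)
        (+-cong (inverseʳ 𝐗₁) (-‿cong (*-identityˡ _)))))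

      β₁w⁻¹ : β 1F 0F * w⁻¹ ≈ (Y₁⁻¹ - 1#) * Y₁⁻¹
      β₁w⁻¹ = trans (sym (*-assoc _ _ _)) (*-congʳ (trans (*-congʳ (⇄-sub X₁Y₁⁻¹ ⇄-1))
        (cancelʳ _ (inverseʳ 𝐗₁))))

      x-0*y : ∀ x y → x ≈ x - 0# * y
      x-0*y x y = sym (trans (+-congˡ (trans (-‿cong (zeroˡ y)) -0#≈0#)) (+-identityʳ x))

      x-y*0 : ∀ x y → x ≈ x - y * 0#
      x-y*0 x y = sym (trans (+-congˡ (trans (-‿cong (zeroʳ y)) -0#≈0#)) (+-identityʳ x))

      0-x*-y : ∀ x y → 0# - x * - y ≈ x * y
      0-x*-y x y = trans (+-identityˡ _) (trans (-‿cong (sym (-‿distribʳ-* x y))) (-‿involutive _))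

      -- The matrix of X₁⁻¹ is the identity minus the rank-one matrix β w⁻¹ α. The factor w⁻¹ is
      -- absorbed into β in advance, after which each entry needs only that X₁ and Y₁ commute.
      N₁-entry : ∀ i j → N₁ i j ≈ δ i j - β i 0F * w⁻¹ * α 0F j
      N₁-entry 0F 0F = begin
        σ ((X₁ - 1#) * Y₁ + 1#)          ≈⟨ σ-++ (σ-** (σ-sub σ-X₁ σ-1) σ-Y₁) σ-1 ⟩
        Y₁⁻¹ * (X₁⁻¹ - 1#) + 1#          ≈⟨ +-comm _ _ ⟩
        1# + Y₁⁻¹ * (X₁⁻¹ - 1#)          ≈⟨ +-congˡ (⇄-sub (⇄⁻¹ 𝐗₁ (sym X₁Y₁⁻¹)) ⇄-1) ⟩
        1# + (X₁⁻¹ - 1#) * Y₁⁻¹          ≈⟨ +-congˡ (*-congʳ (⁻¹-anti-homo‿- 1# X₁⁻¹)) ⟨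
        1# + - (1# - X₁⁻¹) * Y₁⁻¹        ≈⟨ +-congˡ (-‿distribˡ-* _ _) ⟨
        1# - (1# - X₁⁻¹) * Y₁⁻¹          ≈⟨ +-congˡ (-‿cong (trans (*-identityʳ _) β₀w⁻¹)) ⟨
        1# - β 0F 0F * w⁻¹ * 1#          ∎
      N₁-entry 0F 1F = begin
        σ (1# - X₁)                      ≈⟨ σ-sub σ-1 σ-X₁ ⟩
        1# - X₁⁻¹                        ≈⟨ cancelʳ _ (inverseˡ 𝐘₁) ⟨
        (1# - X₁⁻¹) * Y₁⁻¹ * Y₁          ≈⟨ *-congʳ β₀w⁻¹ ⟨
        β 0F 0F * w⁻¹ * Y₁               ≈⟨ 0-x*-y _ _ ⟨
        0# - β 0F 0F * w⁻¹ * - Y₁        ∎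
      N₁-entry 0F 2F = trans σ-0 (x-y*0 _ _)
      N₁-entry 1F 0F = begin
        σ (Y₁ * (1# - Y₁))               ≈⟨ σ-** σ-Y₁ (σ-sub σ-1 σ-Y₁) ⟩
        (1# - Y₁⁻¹) * Y₁⁻¹               ≈⟨ *-congʳ (⁻¹-anti-homo‿- Y₁⁻¹ 1#) ⟨
        - (Y₁⁻¹ - 1#) * Y₁⁻¹             ≈⟨ -‿distribˡ-* _ _ ⟨
        - ((Y₁⁻¹ - 1#) * Y₁⁻¹)           ≈⟨ -‿cong (trans (*-identityʳ _) β₁w⁻¹) ⟨
        - (β 1F 0F * w⁻¹ * 1#)           ≈⟨ +-identityˡ _ ⟨
        0# - β 1F 0F * w⁻¹ * 1#          ∎
      N₁-entry 1F 1F = begin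
        σ Y₁                             ≈⟨ σ-Y₁ ⟩
        Y₁⁻¹                             ≈⟨ //-rightDividesˡ 1# Y₁⁻¹ ⟨
        Y₁⁻¹ - 1# + 1#                   ≈⟨ +-comm _ _ ⟩
        1# + (Y₁⁻¹ - 1#)                 ≈⟨ +-congˡ (cancelʳ _ (inverseˡ 𝐘₁)) ⟨
        1# + (Y₁⁻¹ - 1#) * Y₁⁻¹ * Y₁     ≈⟨ +-congˡ (*-congʳ β₁w⁻¹) ⟨
        1# + β 1F 0F * w⁻¹ * Y₁          ≈⟨ +-congˡ (trans (sym (+-identityˡ _)) (0-x*-y _ _)) ⟨
        1# + (- (β 1F 0F * w⁻¹ * - Y₁))  ∎
      N₁-entry 1F 2F = trans σ-0 (x-y*0 _ _)
      N₁-entry 2F 0F = trans σ-0 (trans (x-0*y _ _) (+-congˡ (-‿cong (*-congʳ (sym (zeroˡ _))))))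
      N₁-entry 2F 1F = trans σ-0 (trans (x-0*y _ _) (+-congˡ (-‿cong (*-congʳ (sym (zeroˡ _))))))
      N₁-entry 2F 2F = trans σ-1 (x-y*0 _ _)

      N₁-⊡ : ∀ (s : Matrix 3 1) i → (N₁ ⊡ s) i 0F ≈ s i 0F - β i 0F * (w⁻¹ * (α ⊡ s) 0F 0F)
      N₁-⊡ s i = begin
        sum (λ h → N₁ i h * s h 0F)
          ≈⟨ sum-cong (λ h → trans (*-congʳ (N₁-entry i h)) (trans ([y-z]x≈yx-zx (s h 0F) _ _)
               (+-congˡ (trans (-‿distribˡ-* _ _) (trans (*-congʳ (-‿distribˡ-* _ _)) (*-assoc _ _ _)))))) ⟩
        sum (λ h → δ i h * s h 0F + - (β i 0F * w⁻¹) * (α 0F h * s h 0F))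
          ≈⟨ ∑-distrib-+ {3} (λ h → δ i h * s h 0F) (λ h → - (β i 0F * w⁻¹) * (α 0F h * s h 0F)) ⟩
        sum (λ h → δ i h * s h 0F) + sum (λ h → - (β i 0F * w⁻¹) * (α 0F h * s h 0F))
          ≈⟨ +-cong (⊡-identityˡ s i 0F) (sym (*-distribˡ-sum {3} _ (λ h → α 0F h * s h 0F))) ⟩
        s i 0F + - (β i 0F * w⁻¹) * (α ⊡ s) 0F 0F
          ≈⟨ +-congˡ (trans (sym (-‿distribˡ-* _ _)) (-‿cong (*-assoc _ _ _))) ⟩
        s i 0F - β i 0F * (w⁻¹ * (α ⊡ s) 0F 0F)
          ∎

      ⊡-N₁-⊡ : ∀ (r : Matrix 1 3) (s : Matrix 3 1) →
        (r ⊡ (N₁ ⊡ s)) 0F 0F ≈ (r ⊡ s) 0F 0F - (r ⊡ β) 0F 0F * (w⁻¹ * (α ⊡ s) 0F 0F)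
      ⊡-N₁-⊡ r s = begin
        sum (λ i → r 0F i * (N₁ ⊡ s) i 0F)
          ≈⟨ sum-cong (λ i → trans (*-congˡ (N₁-⊡ s i)) (trans (x[y-z]≈xy-xz (r 0F i) _ _)
               (+-congˡ (trans (-‿cong (sym (*-assoc _ _ _))) (-‿distribʳ-* _ _))))) ⟩
        sum (λ i → r 0F i * s i 0F + r 0F i * β i 0F * - t)
          ≈⟨ ∑-distrib-+ {3} (λ i → r 0F i * s i 0F) (λ i → r 0F i * β i 0F * - t) ⟩
        sum (λ i → r 0F i * s i 0F) + sum (λ i → r 0F i * β i 0F * - t)
          ≈⟨ +-congˡ (sym (*-distribʳ-sum {3} _ (λ i → r 0F i * β i 0F))) ⟩
        (r ⊡ s) 0F 0F + (r ⊡ β) 0F 0F * - t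
          ≈⟨ +-congˡ (-‿distribʳ-* _ _) ⟨
        (r ⊡ s) 0F 0F - (r ⊡ β) 0F 0F * t
          ∎
        where t = w⁻¹ * (α ⊡ s) 0F 0F

      αβ : (α ⊡ β) 0F 0F ≈ w - 1#
      αβ = begin
        1# * (X₁ - 1#) + (- Y₁ * (X₁ * (Y₁⁻¹ - 1#)) + (0# * 0# + 0#))
          ≈⟨ +-cong (*-identityˡ _) (trans (+-congˡ (trans (+-identityʳ _) (zeroˡ _))) (+-identityʳ _)) ⟩
        (X₁ - 1#) + - Y₁ * (X₁ * (Y₁⁻¹ - 1#))
          ≈⟨ +-congˡ (trans (sym (-‿distribˡ-* _ _)) (-‿cong (sym (*-assoc _ _ _)))) ⟩
        (X₁ - 1#) - w * (Y₁⁻¹ - 1#)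
          ≈⟨ +-congˡ (-‿cong (trans (x[y-z]≈xy-xz _ _ _) (+-cong
               (trans (*-congʳ (sym X₁Y₁)) (cancelʳ X₁ (inverseʳ 𝐘₁))) (-‿cong (*-identityʳ w))))) ⟩
        (X₁ - 1#) - (X₁ - w)
          ≈⟨ +-cong (+-comm _ _) (⁻¹-anti-homo‿- _ _) ⟩
        (- 1# + X₁) + (w - X₁)
          ≈⟨ +-assoc _ _ _ ⟩
        - 1# + (X₁ + (w - X₁))
          ≈⟨ +-congˡ (trans (sym (+-assoc _ _ _)) (xyx⁻¹≈y X₁ w)) ⟩
        - 1# + w
          ≈⟨ +-comm _ _ ⟩
        w - 1#
          ∎

    private
      x₀ x₁ : Word
      x₀ = generator 0F
      x₁ = generator 1F

      x₀^ : ℤ → Word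
      x₀^ = _^ᶻ_ group x₀

    coefficient : Word → Carrier
    coefficient g = (α ⊡ N g ⊡ β) 0F 0F

    -- Between N g and N h the identity part of the matrix of x₁⁻¹ gives the coefficient of gh; its
    -- rank-one part splits the form into the coefficients of g and h, joined by w⁻¹.
    coefficient-cuttable : Cutting.Cuttable A 𝐰 coefficient
    coefficient-cuttable = record
      { cong = λ g∼h → ⊡-congʳ β (⊡-congˡ α (N-cong g∼h)) 0F 0F
      ; cut = cut
      ; F-ε = trans (⊡-congʳ β (λ i j → trans (⊡-congˡ α N-ε i j) (trans (⊡-diagonal α _ i j) (*-identityʳ _))) 0F 0F) αβ }
      where
      cut : ∀ g h → coefficient (g · (inv x₁ · h)) ≈ coefficient (g · h) - coefficient g * (w⁻¹ * coefficient h)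
      cut g h = begin
        (α ⊡ N (g · (inv x₁ · h)) ⊡ β) 0F 0F
          ≈⟨ ⊡-congʳ β (⊡-congˡ α (N-· g (inv x₁ · h))) 0F 0F ⟩
        (α ⊡ (N g ⊡ N (inv x₁ · h)) ⊡ β) 0F 0F
          ≈⟨ ⊡-congʳ β (⊡-congˡ α (⊡-congˡ (N g) (N-· (inv x₁) h))) 0F 0F ⟩
        (α ⊡ (N g ⊡ (N (inv x₁) ⊡ N h)) ⊡ β) 0F 0F
          ≈⟨ ⊡-congʳ β (⊡-congˡ α (⊡-congˡ (N g) (⊡-congʳ (N h) N-x₁⁻¹))) 0F 0F ⟩
        (α ⊡ (N g ⊡ (N₁ ⊡ N h)) ⊡ β) 0F 0F
          ≈⟨ ⊡-congʳ β (⊡-assoc α (N g) (N₁ ⊡ N h)) 0F 0F ⟨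
        (α ⊡ N g ⊡ (N₁ ⊡ N h) ⊡ β) 0F 0F
          ≈⟨ ⊡-assoc (α ⊡ N g) (N₁ ⊡ N h) β 0F 0F ⟩
        (α ⊡ N g ⊡ (N₁ ⊡ N h ⊡ β)) 0F 0F
          ≈⟨ ⊡-congˡ (α ⊡ N g) (⊡-assoc N₁ (N h) β) 0F 0F ⟩
        (α ⊡ N g ⊡ (N₁ ⊡ (N h ⊡ β))) 0F 0F
          ≈⟨ ⊡-N₁-⊡ (α ⊡ N g) (N h ⊡ β) ⟩
        (α ⊡ N g ⊡ (N h ⊡ β)) 0F 0F - coefficient g * (w⁻¹ * (α ⊡ (N h ⊡ β)) 0F 0F)
          ≈⟨ +-cong (⊡-assoc (α ⊡ N g) (N h) β 0F 0F) (-‿cong (*-congˡ (*-congˡ (⊡-assoc α (N h) β 0F 0F)))) ⟨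
        (α ⊡ N g ⊡ N h ⊡ β) 0F 0F - coefficient g * (w⁻¹ * coefficient h)
          ≈⟨ +-congʳ (⊡-congʳ β (⊡-assoc α (N g) (N h)) 0F 0F) ⟩
        (α ⊡ (N g ⊡ N h) ⊡ β) 0F 0F - coefficient g * (w⁻¹ * coefficient h)
          ≈⟨ +-congʳ (⊡-congʳ β (⊡-congˡ α (N-· g h)) 0F 0F) ⟨
        coefficient (g · h) - coefficient g * (w⁻¹ * coefficient h)
          ∎

    -- The matrix coefficient at powers of X₀.

    private
      rows : ℤ → Fin 3 → Carrier
      rows n = (α ⊡ N (x₀^ n)) 0F

      rows-step : ∀ n j → rows n j ≈ sum (λ i → rows (ℤ.suc n) i * N₀ i j)
      rows-step n j = begin
        (α ⊡ N (x₀^ n)) 0F j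
          ≈⟨ ⊡-congˡ α (N-cong (∼-trans (∼-sym (F₂.//-rightDividesʳ x₀ (x₀^ n))) (++-congʳ {inv x₀} (∼-sym (^ᶻ-sucʳ group x₀ n))))) 0F j ⟩
        (α ⊡ N (x₀^ (ℤ.suc n) · inv x₀)) 0F j
          ≈⟨ ⊡-congˡ α (N-· (x₀^ (ℤ.suc n)) (inv x₀)) 0F j ⟩
        (α ⊡ (N (x₀^ (ℤ.suc n)) ⊡ N (inv x₀))) 0F j
          ≈⟨ ⊡-congˡ α (⊡-congˡ (N (x₀^ (ℤ.suc n))) N-x₀⁻¹) 0F j ⟩
        (α ⊡ (N (x₀^ (ℤ.suc n)) ⊡ N₀)) 0F j
          ≈⟨ ⊡-assoc α (N (x₀^ (ℤ.suc n))) N₀ 0F j ⟨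
        (α ⊡ N (x₀^ (ℤ.suc n)) ⊡ N₀) 0F j
          ∎
        where
        open Group group using () renaming (trans to ∼-trans; ∙-congʳ to ++-congʳ)
        module F₂ = GroupProperties group

      rows-0 : ∀ j → rows 0ℤ j ≈ α 0F j
      rows-0 j = trans (⊡-congˡ α N-ε 0F j) (trans (⊡-diagonal α _ 0F j) (*-identityʳ _))

      -- N₀ maps the column (0, 1, X₁⁻¹) to (0, 1, X₁⁻¹) · X₀⁻¹, which makes the
      -- product of this column with rows n a geometric sequence.
      b : ℤ → Carrier
      b n = rows n 1F + rows n 2F * X₁⁻¹

      -- The image under σ of the conjugate Y₁⁻¹ Y₀ Y₁ in ρ(X₀), that is, its inverse, bracketed as
      -- the reversal of products yields it.
      W : Carrier
      W = Y₁⁻¹ * (Y₀⁻¹ * Y₁)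

      N₀₁₁ : N₀ 1F 1F ≈ X₀⁻¹ * (1# - X₁⁻¹) + W
      N₀₁₁ = σ-++ (σ-** (σ-sub σ-1 σ-X₁) σ-X₀) (σ-** (σ-** σ-Y₁⁻¹ σ-Y₀) σ-Y₁)

      N₀₂₁ : N₀ 2F 1F ≈ X₁⁻¹ * (X₀⁻¹ * (1# - X₁⁻¹))
      N₀₂₁ = σ-** (σ-** (σ-sub σ-1 σ-X₁) σ-X₀) σ-X₁

      N₀₁₂ : N₀ 1F 2F ≈ X₀⁻¹ - X₁ * W
      N₀₁₂ = σ-sub σ-X₀ (σ-** (σ-** (σ-** σ-Y₁⁻¹ σ-Y₀) σ-Y₁) σ-X₁⁻¹)

      N₀₂₂ : N₀ 2F 2F ≈ X₁⁻¹ * X₀⁻¹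
      N₀₂₂ = σ-** σ-X₀ σ-X₁

      X₁W : X₁ ⇄ W
      X₁W = ⇄-* X₁Y₁⁻¹ (⇄-* (⇄⁻¹ 𝐘₀ X₁Y₀) X₁Y₁)

      -- The terms with X₀⁻¹ in this column of `N₀` are proportional to the column defining b, so
      -- the third entry of the row enters only through b.
      rows₁ : ∀ n → rows n 1F ≈ b (ℤ.suc n) * X₀⁻¹ * (1# - X₁⁻¹) + rows (ℤ.suc n) 1F * W
      rows₁ n = begin
        rows n 1F
          ≈⟨ rows-step n 1F ⟩
        r₀′ * σ 0# + (r₁′ * N₀ 1F 1F + (r₂′ * N₀ 2F 1F + 0#))
          ≈⟨ trans (+-congʳ (trans (*-congˡ σ-0) (zeroʳ _))) (+-identityˡ _) ⟩
        r₁′ * N₀ 1F 1F + (r₂′ * N₀ 2F 1F + 0#)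
          ≈⟨ +-cong (trans (*-congˡ N₀₁₁) (distribˡ _ _ _)) (trans (+-identityʳ _) (*-congˡ N₀₂₁)) ⟩
        (r₁′ * P + r₁′ * W) + r₂′ * (X₁⁻¹ * P)
          ≈⟨ +-cong (+-comm _ _) (sym (*-assoc _ _ _)) ⟩
        (r₁′ * W + r₁′ * P) + r₂′ * X₁⁻¹ * P
          ≈⟨ trans (+-assoc _ _ _) (+-comm _ _) ⟩
        (r₁′ * P + r₂′ * X₁⁻¹ * P) + r₁′ * W
          ≈⟨ +-congʳ (trans (sym (distribʳ _ _ _)) (sym (*-assoc _ _ _))) ⟩
        b (ℤ.suc n) * X₀⁻¹ * (1# - X₁⁻¹) + r₁′ * W
          ∎
        where
        r₀′ = rows (ℤ.suc n) 0F
        r₁′ = rows (ℤ.suc n) 1F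
        r₂′ = rows (ℤ.suc n) 2F
        P = X₀⁻¹ * (1# - X₁⁻¹)

      rows₂ : ∀ n → rows n 2F ≈ b (ℤ.suc n) * X₀⁻¹ - rows (ℤ.suc n) 1F * (X₁ * W)
      rows₂ n = begin
        rows n 2F
          ≈⟨ rows-step n 2F ⟩
        r₀′ * σ 0# + (r₁′ * N₀ 1F 2F + (r₂′ * N₀ 2F 2F + 0#))
          ≈⟨ trans (+-congʳ (trans (*-congˡ σ-0) (zeroʳ _))) (+-identityˡ _) ⟩
        r₁′ * N₀ 1F 2F + (r₂′ * N₀ 2F 2F + 0#)
          ≈⟨ +-cong (trans (*-congˡ N₀₁₂) (x[y-z]≈xy-xz _ _ _)) (trans (+-identityʳ _) (trans (*-congˡ N₀₂₂) (sym (*-assoc _ _ _)))) ⟩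
        (r₁′ * X₀⁻¹ - r₁′ * (X₁ * W)) + r₂′ * X₁⁻¹ * X₀⁻¹
          ≈⟨ trans (+-assoc _ _ _) (trans (+-congˡ (+-comm _ _)) (sym (+-assoc _ _ _))) ⟩
        (r₁′ * X₀⁻¹ + r₂′ * X₁⁻¹ * X₀⁻¹) - r₁′ * (X₁ * W)
          ≈⟨ +-congʳ (distribʳ _ _ _) ⟨
        b (ℤ.suc n) * X₀⁻¹ - r₁′ * (X₁ * W)
          ∎
        where
        r₀′ = rows (ℤ.suc n) 0F
        r₁′ = rows (ℤ.suc n) 1F
        r₂′ = rows (ℤ.suc n) 2F

      telescope : ∀ x y z → (x - y + z) + (y - z) ≈ x
      telescope x y z = begin
        (x - y + z) + (y - z)    ≈⟨ +-congˡ (+-comm _ _) ⟩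
        (x - y + z) + (- z + y)  ≈⟨ +-assoc _ _ _ ⟨
        (x - y + z) - z + y      ≈⟨ +-congʳ (//-rightDividesʳ z (x - y)) ⟩
        x - y + y                ≈⟨ //-rightDividesˡ y x ⟩
        x                        ∎

      b-step : ∀ n → b n ≈ b (ℤ.suc n) * X₀⁻¹
      b-step n = begin
        rows n 1F + rows n 2F * X₁⁻¹
          ≈⟨ +-cong (rows₁ n) (*-congʳ (rows₂ n)) ⟩
        (t * (1# - X₁⁻¹) + z) + (t - rows (ℤ.suc n) 1F * (X₁ * W)) * X₁⁻¹
          -- Since X₁ commutes with W, X₁ W X₁⁻¹ = W: both W-terms become z, with opposite signs.
          ≈⟨ +-cong (+-congʳ (trans (x[y-z]≈xy-xz _ _ _) (+-congʳ (*-identityʳ t)))) (trans ([y-z]x≈yx-zx _ _ _) (+-congˡ (-‿cong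
               (trans (*-assoc _ _ _) (*-congˡ (trans (*-congʳ X₁W) (cancelʳ W (inverseʳ 𝐗₁)))))))) ⟩
        (t - t * X₁⁻¹ + z) + (t * X₁⁻¹ - z)
          ≈⟨ telescope _ _ _ ⟩
        t
          ∎
        where
        t = b (ℤ.suc n) * X₀⁻¹
        z = rows (ℤ.suc n) 1F * W

    module _ (p q : ℤ → Carrier) (p-0 : p 0ℤ ≈ 1#) (q-0 : q 0ℤ ≈ 1#)
      (p-suc : ∀ n → p (ℤ.suc n) ≈ p n * X₀) (q-suc : ∀ n → q (ℤ.suc n) ≈ q n * Y₀)
      where

      private
        module Rˣ = Recurrences A 𝐗₀
        module Rʸ = Recurrences A 𝐘₀

        e : Carrier
        e = X₁ - 1#

        Q : ℤ → Carrier
        Q = Rʸ.truncated q q-0 q-suc λ n → p n * e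

        p-step : ∀ n → p n ≈ p (ℤ.suc n) * X₀⁻¹
        p-step n = sym (trans (*-congʳ (p-suc n)) (cancelʳ (p n) (inverseʳ 𝐗₀)))

        geometric : ∀ f g → (∀ n → f n ≈ f (ℤ.suc n) * X₀⁻¹) → (∀ n → g n ≈ g (ℤ.suc n) * X₀⁻¹) → f 0ℤ ≈ g 0ℤ → ∀ n → f n ≈ g n
        geometric f g f-step g-step = Rˣ.recurrence-unique {λ _ → 0#} {f} {g}
          (λ n → trans (f-step n) (sym (+-identityˡ _))) (λ n → trans (g-step n) (sym (+-identityˡ _)))

        r₀≈p : ∀ n → rows n 0F ≈ p n
        r₀≈p = geometric (λ n → rows n 0F) p r₀-step p-step (trans (rows-0 0F) (sym p-0))
          where
          r₀-step : ∀ n → rows n 0F ≈ rows (ℤ.suc n) 0F * X₀⁻¹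
          r₀-step n = trans (rows-step n 0F) (trans (+-cong (*-congˡ σ-X₀)
            (trans (+-cong (trans (*-congˡ σ-0) (zeroʳ _)) (trans (+-identityʳ _) (trans (*-congˡ σ-0) (zeroʳ _)))) (+-identityʳ _))) (+-identityʳ _))

        -- The start is -Y₁, from the second entry of α; as X₀ commutes with Y₁, this constant can
        -- stay to the right of the powers of X₀.
        b≈-pY₁ : ∀ n → b n ≈ - (p n * Y₁)
        b≈-pY₁ = geometric b (λ n → - (p n * Y₁)) b-step -pY₁-step (begin
          rows 0ℤ 1F + rows 0ℤ 2F * X₁⁻¹   ≈⟨ +-cong (rows-0 1F) (trans (*-congʳ (rows-0 2F)) (zeroˡ _)) ⟩
          - Y₁ + 0#                        ≈⟨ +-identityʳ _ ⟩
          - Y₁                             ≈⟨ -‿cong (trans (*-congʳ p-0) (*-identityˡ Y₁)) ⟨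
          - (p 0ℤ * Y₁)                    ∎)
          where
          -pY₁-step : ∀ n → - (p n * Y₁) ≈ - (p (ℤ.suc n) * Y₁) * X₀⁻¹
          -pY₁-step n = begin
            - (p n * Y₁)                     ≈⟨ -‿cong (*-congʳ (p-step n)) ⟩
            - (p (ℤ.suc n) * X₀⁻¹ * Y₁)      ≈⟨ -‿cong (swap _ (sym (⇄⁻¹ 𝐗₀ (sym X₀Y₁)))) ⟩
            - (p (ℤ.suc n) * Y₁ * X₀⁻¹)      ≈⟨ -‿distribˡ-* _ _ ⟩
            - (p (ℤ.suc n) * Y₁) * X₀⁻¹      ∎

        -- Rescaled so that the recurrence of rows n 1F becomes that of Q.
        f : ℤ → Carrier
        f n = - (rows n 1F * (X₁ * Y₁⁻¹))

        -- The factor X₁Y₁⁻¹ serves both terms: moved to the left past it, W = Y₁⁻¹ Y₀⁻¹ Y₁ becomes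
        -- Y₀⁻¹, and Y₁(1 - X₁⁻¹) times it is X₁ - 1.
        f-recurrence : Rʸ.Recurrence (λ n → p n * e) f
        f-recurrence n = begin
          - (rows n 1F * (X₁ * Y₁⁻¹))
            -- b(n + 1) X₀⁻¹ is folded back to b n, so that the inhomogeneous term carries X₀ⁿ.
            ≈⟨ -‿cong (*-congʳ (trans (rows₁ n) (+-congʳ (*-congʳ (trans (sym (b-step n)) (b≈-pY₁ n)))))) ⟩
          - ((- (p n * Y₁) * (1# - X₁⁻¹) + r₁′ * W) * (X₁ * Y₁⁻¹))
            ≈⟨ -‿cong (distribʳ _ _ _) ⟩
          - (- (p n * Y₁) * (1# - X₁⁻¹) * (X₁ * Y₁⁻¹) + r₁′ * W * (X₁ * Y₁⁻¹))
            ≈⟨ -‿+-comm _ _ ⟨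
          - (- (p n * Y₁) * (1# - X₁⁻¹) * (X₁ * Y₁⁻¹)) + - (r₁′ * W * (X₁ * Y₁⁻¹))
            ≈⟨ +-cong first second ⟩
          p n * e + f (ℤ.suc n) * Y₀⁻¹
            ∎
          where
          r₁′ = rows (ℤ.suc n) 1F

          first : - (- (p n * Y₁) * (1# - X₁⁻¹) * (X₁ * Y₁⁻¹)) ≈ p n * e
          first = begin
            - (- (p n * Y₁) * (1# - X₁⁻¹) * (X₁ * Y₁⁻¹))
              ≈⟨ -‿cong (trans (*-assoc _ _ _) (sym (-‿distribˡ-* _ _))) ⟩
            - - (p n * Y₁ * ((1# - X₁⁻¹) * (X₁ * Y₁⁻¹)))
              ≈⟨ -‿involutive _ ⟩
            p n * Y₁ * ((1# - X₁⁻¹) * (X₁ * Y₁⁻¹))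
              ≈⟨ *-congˡ (trans (sym (*-assoc _ _ _)) (*-congʳ (trans ([y-z]x≈yx-zx _ _ _) (+-cong (*-identityˡ _) (-‿cong (inverseˡ 𝐗₁)))))) ⟩
            p n * Y₁ * (e * Y₁⁻¹)
              ≈⟨ trans (*-assoc _ _ _) (*-congˡ (sym (*-assoc _ _ _))) ⟩
            p n * (Y₁ * e * Y₁⁻¹)
              ≈⟨ *-congˡ (trans (*-congʳ (⇄-sub (sym X₁Y₁) ⇄-1)) (cancelʳ e (inverseʳ 𝐘₁))) ⟩
            p n * e
              ∎

          second : - (r₁′ * W * (X₁ * Y₁⁻¹)) ≈ f (ℤ.suc n) * Y₀⁻¹
          second = begin
            - (r₁′ * W * (X₁ * Y₁⁻¹))          ≈⟨ -‿cong (trans (*-assoc _ _ _) (*-congˡ (sym (*-assoc _ _ _)))) ⟩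
            - (r₁′ * (W * X₁ * Y₁⁻¹))          ≈⟨ -‿cong (*-congˡ (trans (*-congʳ (sym X₁W)) (*-assoc _ _ _))) ⟩
            - (r₁′ * (X₁ * (W * Y₁⁻¹)))        ≈⟨ -‿cong (*-congˡ (*-congˡ (trans (*-congʳ (sym (*-assoc _ _ _))) (cancelʳ _ (inverseʳ 𝐘₁))))) ⟩
            - (r₁′ * (X₁ * (Y₁⁻¹ * Y₀⁻¹)))     ≈⟨ -‿cong (trans (*-congˡ (sym (*-assoc _ _ _))) (sym (*-assoc _ _ _))) ⟩
            - (r₁′ * (X₁ * Y₁⁻¹) * Y₀⁻¹)       ≈⟨ -‿distribˡ-* _ _ ⟩
            f (ℤ.suc n) * Y₀⁻¹                 ∎

        f≈Q : ∀ n → f n ≈ Q n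
        f≈Q = Rʸ.recurrence-unique f-recurrence (Rʸ.truncated-recurrence q q-0 q-suc λ n → p n * e) (begin
          - (rows 0ℤ 1F * (X₁ * Y₁⁻¹))   ≈⟨ -‿cong (trans (*-congʳ (rows-0 1F)) (sym (-‿distribˡ-* _ _))) ⟩
          - - (Y₁ * (X₁ * Y₁⁻¹))         ≈⟨ -‿involutive _ ⟩
          Y₁ * (X₁ * Y₁⁻¹)               ≈⟨ trans (sym (*-assoc _ _ _)) (trans (*-congʳ (sym X₁Y₁)) (cancelʳ X₁ (inverseʳ 𝐘₁))) ⟩
          X₁                             ≈⟨ trans (+-comm _ _) (//-rightDividesˡ 1# X₁) ⟨
          1# + e                         ≈⟨ +-congˡ (trans (*-congʳ p-0) (*-identityˡ e)) ⟨
          1# + p 0ℤ * e                  ≈⟨ Rʸ.truncated-0 q q-0 q-suc (λ n → p n * e) ⟨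
          Q 0ℤ                           ∎)

      -- Pairing with β brings in X₁(Y₁⁻¹ - 1) = - X₁Y₁⁻¹(Y₁ - 1), which is why `f` carries the
      -- factor - X₁Y₁⁻¹. The result has the shape of Δ(X₀ⁿ(X₁ - 1)) with Y₁ - 1 factored out on the
      -- right.
      coefficient-x₀^ : ∀ n → coefficient (x₀^ n) ≈
        p n * (X₁ - 1#) + Rʸ.truncated q q-0 q-suc (λ j → p j * (X₁ - 1#)) n * (Y₁ - 1#)
      coefficient-x₀^ n = begin
        rows n 0F * e + (r₁′ * (X₁ * (Y₁⁻¹ - 1#)) + (rows n 2F * 0# + 0#))
          ≈⟨ +-cong (*-congʳ (r₀≈p n)) (trans (+-congˡ (trans (+-identityʳ _) (zeroʳ _))) (+-identityʳ _)) ⟩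
        p n * e + r₁′ * (X₁ * (Y₁⁻¹ - 1#))
          ≈⟨ +-congˡ (sym (begin
            f n * (Y₁ - 1#)                           ≈⟨ trans (sym (-‿distribˡ-* _ _)) (-‿distribʳ-* _ _) ⟩
            r₁′ * (X₁ * Y₁⁻¹) * - (Y₁ - 1#)           ≈⟨ *-congˡ (⁻¹-anti-homo‿- _ _) ⟩
            r₁′ * (X₁ * Y₁⁻¹) * (1# - Y₁)             ≈⟨ trans (*-assoc _ _ _) (*-congˡ (*-assoc _ _ _)) ⟩
            r₁′ * (X₁ * (Y₁⁻¹ * (1# - Y₁)))           ≈⟨ *-congˡ (*-congˡ (trans (x[y-z]≈xy-xz _ _ _) (+-cong (*-identityʳ _) (-‿cong (inverseˡ 𝐘₁))))) ⟩
            r₁′ * (X₁ * (Y₁⁻¹ - 1#))                  ∎)) ⟩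
        p n * e + f n * (Y₁ - 1#)
          ≈⟨ +-congˡ (*-congʳ (f≈Q n)) ⟩
        p n * e + Q n * (Y₁ - 1#)
          ∎
        where r₁′ = rows n 1F

-- Linear maps on spans, group algebras and tensor products.

module SpanMap {c ℓ x y r s} (k : CommutativeRing c ℓ) {X : Set x} {Y : Set y}
  (R : X → LinComb k X → Set r) (S : Y → LinComb k Y → Set s) (h : X → Y) where
  private
    module k = CommutativeRing k
    module R = Span k R
    module S = Span k S
    open R using () renaming (_≈_ to _≈ᴿ_)
    open S using () renaming (_≈_ to _≈ˢ_)

  h* : LinComb k X → LinComb k Y
  h* = map (map₂ h)

  -- Equality in a span is the least congruence containing the relations, so these alone have to be
  -- checked.
  h*-cong : (∀ {x u} → R x u → [ k.1# , h x ] ≈ˢ h* u) → ∀ {u v} → u ≈ᴿ v → h* u ≈ˢ h* v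
  h*-cong h-relate = go
    where
    open SetoidReasoning S.setoid

    h*-scale : ∀ c u → S.scale c (h* u) ≡ h* (R.scale c u)
    h*-scale c u = ≡.trans (≡.sym (List.map-∘ u)) (List.map-∘ u)

    h*-++ : ∀ u v → h* (u ++ v) ≡ h* u ++ h* v
    h*-++ = List.map-++ (map₂ h)

    go : ∀ {u v} → u ≈ᴿ v → h* u ≈ˢ h* v
    go R.≈-refl = S.≈-refl
    go (R.≈-sym p) = S.≈-sym (go p)
    go (R.≈-trans p q) = S.≈-trans (go p) (go q)
    go (R.++-cong {u} {u₁} {v} {v₁} p q) = begin
      h* (u ++ v)      ≡⟨ h*-++ u v ⟩
      h* u ++ h* v     ≈⟨ S.++-cong (go p) (go q) ⟩
      h* u₁ ++ h* v₁   ≡⟨ h*-++ u₁ v₁ ⟨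
      h* (u₁ ++ v₁)    ∎
    go (R.++-comm u v) = begin
      h* (u ++ v)      ≡⟨ h*-++ u v ⟩
      h* u ++ h* v     ≈⟨ S.++-comm (h* u) (h* v) ⟩
      h* v ++ h* u     ≡⟨ h*-++ v u ⟨
      h* (v ++ u)      ∎
    go (R.coeff x p) = S.coeff (h x) p
    go (R.merge c d x) = S.merge c d (h x)
    go (R.vanish x) = S.vanish (h x)
    go (R.relate c {x} {u} p) = begin
      [ c , h x ]                    ≈⟨ S.coeff (h x) (k.*-identityʳ c) ⟨
      S.scale c [ k.1# , h x ]       ≈⟨ S.scale-cong c (h-relate p) ⟩
      S.scale c (h* u)               ≡⟨ h*-scale c u ⟩
      h* (R.scale c u)               ∎

  module _ (_∙_ : X → X → X) (_◦_ : Y → Y → Y) where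
    open Product k _∙_ using () renaming (_*_ to _*ˣ_; _⋆_ to _⋆ˣ_)
    open Product k _◦_ using (_*_; _⋆_)
    open SetoidReasoning S.setoid

    private
      h₂ : k.Carrier × X → k.Carrier × Y
      h₂ = map₂ h

    h*-* : (∀ c x y → [ c , h (x ∙ y) ] ≈ˢ [ c , h x ◦ h y ]) → ∀ u v → h* (u *ˣ v) ≈ˢ h* u * h* v
    h*-* h-∙ = go
      where
      go-⋆ : ∀ t v → h* (t ⋆ˣ v) ≈ˢ h₂ t ⋆ h* v
      go-⋆ t [] = S.≈-refl
      go-⋆ (c , x) ((d , y) ∷ v) = S.++-cong (h-∙ (c k.* d) x y) (go-⋆ (c , x) v)

      go : ∀ u v → h* (u *ˣ v) ≈ˢ h* u * h* v
      go [] v = S.≈-refl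
      go (t ∷ u) v = S.≈-trans (S.≡⇒≈ (List.map-++ h₂ (t ⋆ˣ v) (u *ˣ v))) (S.++-cong (go-⋆ t v) (go u v))

    -- The product recurses on its left factor, but after the reversal the recursion sits in the
    -- right one; hence distributivity on that side is assumed. Commutativity of k reorders the
    -- coefficients.
    h*-anti-* : (∀ u v w → u * (v ++ w) ≈ˢ u * v ++ u * w) →
      (∀ c x y → [ c , h (x ∙ y) ] ≈ˢ [ c , h y ◦ h x ]) → ∀ u v → h* (u *ˣ v) ≈ˢ h* v * h* u
    h*-anti-* distribˡ h-∙ = go
      where
      go-⋆ : ∀ t v → h* (t ⋆ˣ v) ≈ˢ h* v * [ h₂ t ]
      go-⋆ t [] = S.≈-refl
      go-⋆ (c , x) ((d , y) ∷ v) = S.++-cong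
        (S.≈-trans (h-∙ (c k.* d) x y) (S.coeff _ (k.*-comm c d))) (go-⋆ (c , x) v)

      *-[] : ∀ v → [] ≡ v * []
      *-[] [] = ≡.refl
      *-[] (_ ∷ v) = *-[] v

      go : ∀ u v → h* (u *ˣ v) ≈ˢ h* v * h* u
      go [] v = S.≡⇒≈ (*-[] (h* v))
      go (t ∷ u) v = begin
        h* (t ⋆ˣ v ++ u *ˣ v)               ≡⟨ List.map-++ h₂ (t ⋆ˣ v) (u *ˣ v) ⟩
        h* (t ⋆ˣ v) ++ h* (u *ˣ v)          ≈⟨ S.++-cong (go-⋆ t v) (go u v) ⟩
        h* v * [ h₂ t ] ++ h* v * h* u      ≈⟨ distribˡ (h* v) [ h₂ t ] (h* u) ⟨
        h* v * (h₂ t ∷ h* u)                ∎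

record IsLinear {c ℓ a r b s} {k : CommutativeRing c ℓ} (A : KAlgebra k a r) (B : KAlgebra k b s)
  (f : KAlgebra.Carrier A → KAlgebra.Carrier B) : Set (c ⊔ a ⊔ r ⊔ s) where
  private
    module A = KAlgebra A
    module B = KAlgebra B
  field
    cong  : ∀ {x y} → x A.≈ y → f x B.≈ f y
    +-homo : ∀ x y → f (x A.+ y) B.≈ f x B.+ f y
    •-homo : ∀ c x → f (c A.• x) B.≈ c B.• f x

module _ {c ℓ g e} (k : CommutativeRing c ℓ) (G : Group g e) where
  private
    module k = CommutativeRing k
    module G = Group G
    module 𝐤G = GroupAlgebra k G
    module A = KAlgebra 𝐤G.algebra
    open GroupProperties G using (⁻¹-anti-homo-∙; ε⁻¹≈ε)
    open Span k 𝐤G.Equal using (relate; coeff; ≈-trans)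
    module op = SpanMap k 𝐤G.Equal 𝐤G.Equal G._⁻¹

  ⌜⌝-cong : ∀ {c x y} → x G.≈ y → [ c , x ] A.≈ [ c , y ]
  ⌜⌝-cong p = ≈-trans (relate _ (𝐤G.equal p)) (coeff _ (k.*-identityʳ _))

  ⌜⌝-∙ : ∀ x y → [ k.1# , x G.∙ y ] A.≈ [ k.1# , x ] A.* [ k.1# , y ]
  ⌜⌝-∙ x y = coeff _ (k.sym (k.*-identityʳ _))

  ⌜⌝-scale : ∀ c x → [ c , x ] A.≈ c A.• [ k.1# , x ]
  ⌜⌝-scale c x = ≈-trans (⌜⌝-cong (G.sym (G.identityˡ x))) (coeff _ (k.sym (k.*-identityʳ _)))

  op-cong : ∀ {u v} → u A.≈ v → 𝐤G.op u A.≈ 𝐤G.op v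
  op-cong = op.h*-cong λ { (𝐤G.equal p) → ⌜⌝-cong (G.⁻¹-cong p) }

  op-+ : ∀ u v → 𝐤G.op (u A.+ v) A.≈ 𝐤G.op u A.+ 𝐤G.op v
  op-+ u v = A.reflexive (List.map-++ _ u v)

  op-* : ∀ u v → 𝐤G.op (u A.* v) A.≈ 𝐤G.op v A.* 𝐤G.op u
  op-* = op.h*-anti-* G._∙_ G._∙_ A.distribˡ (λ c x y → ⌜⌝-cong (⁻¹-anti-homo-∙ x y))

  op-η : ∀ c → 𝐤G.op (A.η c) A.≈ A.η c
  op-η c = ⌜⌝-cong ε⁻¹≈ε

  op-isLinear : IsLinear 𝐤G.algebra 𝐤G.algebra 𝐤G.op
  op-isLinear = record
    { cong = op-cong
    ; +-homo = op-+
    ; •-homo = λ c u → A.trans (op-* (A.η c) u) (A.trans (A.*-congˡ {𝐤G.op u} (op-η c)) (A.sym (A.η-central c (𝐤G.op u)))) }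

module TensorProperties {c ℓ a r b s} {k : CommutativeRing c ℓ} (A : KAlgebra k a r) (B : KAlgebra k b s) where
  private
    module k = CommutativeRing k
    module A = KAlgebra A
    module B = KAlgebra B
    module A⊗B = Tensor A B
    module T = KAlgebra A⊗B.algebra
    open A⊗B using (_⊗_)
    open Span k A⊗B.Bilinear using (relate; coeff; ≈-trans; ++-cong)

  ⊗-cong : ∀ {c x x₁ y y₁} → x A.≈ x₁ → y B.≈ y₁ → [ c , x , y ] T.≈ [ c , x₁ , y₁ ]
  ⊗-cong p q = ≈-trans (relate _ (A⊗B.equal (p , q))) (coeff _ (k.*-identityʳ _))

  ⊗-distribʳ : ∀ x x₁ y → (x A.+ x₁) ⊗ y T.≈ x ⊗ y T.+ x₁ ⊗ y
  ⊗-distribʳ x x₁ y = ≈-trans (relate _ (A⊗B.addˡ x x₁ y)) (++-cong (coeff _ (k.*-identityʳ _)) (coeff _ (k.*-identityʳ _)))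

  ⊗-distribˡ : ∀ x y y₁ → x ⊗ (y B.+ y₁) T.≈ x ⊗ y T.+ x ⊗ y₁
  ⊗-distribˡ x y y₁ = ≈-trans (relate _ (A⊗B.addʳ x y y₁)) (++-cong (coeff _ (k.*-identityʳ _)) (coeff _ (k.*-identityʳ _)))

  •-⊗ : ∀ c x y → (c A.• x) ⊗ y T.≈ [ c , x , y ]
  •-⊗ c x y = ≈-trans (relate _ (A⊗B.scalarˡ c x y)) (coeff _ (k.*-identityˡ _))

  ⊗-• : ∀ c x y → x ⊗ (c B.• y) T.≈ [ c , x , y ]
  ⊗-• c x y = ≈-trans (relate _ (A⊗B.scalarʳ c x y)) (coeff _ (k.*-identityˡ _))

  ⊗-* : ∀ x x₁ y y₁ → (x A.* x₁) ⊗ (y B.* y₁) T.≈ (x ⊗ y) T.* (x₁ ⊗ y₁)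
  ⊗-* x x₁ y y₁ = coeff _ (k.sym (k.*-identityʳ _))

  left : A.Carrier → T.Carrier
  left x = x ⊗ B.1#

  right : B.Carrier → T.Carrier
  right y = A.1# ⊗ y

  left-cong : ∀ {x y} → x A.≈ y → left x T.≈ left y
  left-cong p = ⊗-cong p B.refl

  right-cong : ∀ {x y} → x B.≈ y → right x T.≈ right y
  right-cong p = ⊗-cong A.refl p

  left-sub : ∀ x y → left (x A.- y) T.≈ left x T.- left y
  left-sub x y = T.trans (⊗-distribʳ x (A.- y) B.1#) (T.+-congˡ {left x}
    (additive⇒neg A.ring T.ring left left-cong (λ x y → ⊗-distribʳ x y B.1#) y))

  right-sub : ∀ x y → right (x B.- y) T.≈ right x T.- right y
  right-sub x y = T.trans (⊗-distribˡ A.1# x (B.- y)) (T.+-congˡ {right x}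
    (additive⇒neg B.ring T.ring right right-cong (⊗-distribˡ A.1#) y))

  left-* : ∀ x y → left (x A.* y) T.≈ left x T.* left y
  left-* x y = T.trans (⊗-cong A.refl (B.sym (B.*-identityˡ B.1#))) (⊗-* x y B.1# B.1#)

  right-* : ∀ x y → right (x B.* y) T.≈ right x T.* right y
  right-* x y = T.trans (⊗-cong (A.sym (A.*-identityˡ A.1#)) B.refl) (⊗-* A.1# A.1# x y)

  left-right : ∀ x y → x ⊗ y T.≈ left x T.* right y
  left-right x y = T.trans (⊗-cong (A.sym (A.*-identityʳ x)) (B.sym (B.*-identityˡ y))) (⊗-* x A.1# B.1# y)

module TensorMap {c ℓ a r b s a₁ r₁ b₁ s₁} {k : CommutativeRing c ℓ}
  (A : KAlgebra k a r) (B : KAlgebra k b s) (A₁ : KAlgebra k a₁ r₁) (B₁ : KAlgebra k b₁ s₁)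
  {f : KAlgebra.Carrier A → KAlgebra.Carrier A₁} (f-linear : IsLinear A A₁ f)
  {g : KAlgebra.Carrier B → KAlgebra.Carrier B₁} (g-linear : IsLinear B B₁ g) where

  private
    module k = CommutativeRing k
    module A = KAlgebra A
    module B = KAlgebra B
    module A₁ = KAlgebra A₁
    module B₁ = KAlgebra B₁
    module T = KAlgebra (Tensor.algebra A B)
    module T₁ = KAlgebra (Tensor.algebra A₁ B₁)
    module f = IsLinear f-linear
    module g = IsLinear g-linear
    open TensorProperties A₁ B₁

    module Map = SpanMap k (Tensor.Bilinear A B) (Tensor.Bilinear A₁ B₁) (×.map f g)

    f⊗g : T.Carrier → T₁.Carrier
    f⊗g = tensorMap {A = A} {B = B} {A₁ = A₁} {B₁ = B₁} f g

    relation : ∀ {x u} → Tensor.Bilinear A B x u → [ k.1# , ×.map f g x ] T₁.≈ f⊗g u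
    relation (Tensor.equal (p , q)) = ⊗-cong (f.cong p) (g.cong q)
    relation (Tensor.addˡ x x₁ y) = T₁.trans (⊗-cong (f.+-homo x x₁) B₁.refl) (⊗-distribʳ (f x) (f x₁) (g y))
    relation (Tensor.addʳ x y y₁) = T₁.trans (⊗-cong A₁.refl (g.+-homo y y₁)) (⊗-distribˡ (f x) (g y) (g y₁))
    relation (Tensor.scalarˡ c x y) = T₁.trans (⊗-cong (f.•-homo c x) B₁.refl) (•-⊗ c (f x) (g y))
    relation (Tensor.scalarʳ c x y) = T₁.trans (⊗-cong A₁.refl (g.•-homo c y)) (⊗-• c (f x) (g y))

  tensorMap-cong : ∀ {u v} → u T.≈ v → f⊗g u T₁.≈ f⊗g v
  tensorMap-cong = Map.h*-cong relation

  tensorMap-+ : ∀ u v → f⊗g (u T.+ v) T₁.≈ f⊗g u T₁.+ f⊗g v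
  tensorMap-+ u v = T₁.reflexive (List.map-++ _ u v)

  private
    _∙_ = Monoid._∙_ (DirectProduct.monoid A.*-monoid B.*-monoid)
    _∙₁_ = Monoid._∙_ (DirectProduct.monoid A₁.*-monoid B₁.*-monoid)

  tensorMap-* : (∀ x y → f (x A.* y) A₁.≈ f x A₁.* f y) → (∀ x y → g (x B.* y) B₁.≈ g x B₁.* g y) →
    ∀ u v → f⊗g (u T.* v) T₁.≈ f⊗g u T₁.* f⊗g v
  tensorMap-* f-* g-* = Map.h*-* _∙_ _∙₁_ λ c (x , y) (x₁ , y₁) → ⊗-cong (f-* x x₁) (g-* y y₁)

  tensorMap-anti-* : (∀ x y → f (x A.* y) A₁.≈ f y A₁.* f x) → (∀ x y → g (x B.* y) B₁.≈ g y B₁.* g x) →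
    ∀ u v → f⊗g (u T.* v) T₁.≈ f⊗g v T₁.* f⊗g u
  tensorMap-anti-* f-* g-* = Map.h*-anti-* _∙_ _∙₁_ T₁.distribˡ λ c (x , y) (x₁ , y₁) → ⊗-cong (f-* x x₁) (g-* y y₁)

-- The transposed representation and its linear forms.

module Transposed {c ℓ a r b s} {k : CommutativeRing c ℓ} (V : KAlgebra k b s) (A : KAlgebra k a r)
  {τ : KAlgebra.Carrier V → KAlgebra.Carrier V} (τ-anti : IsAntimorphism V τ)
  {σ : KAlgebra.Carrier A → KAlgebra.Carrier A} (σ-anti : IsAntimorphism A σ)
  {n : ℕ} (ρ : AlgebraHom V (Matrices.algebra A n)) where

  private
    module V = KAlgebra V
    module τ = IsAntimorphism τ-anti
    module ρ = AlgebraHom ρ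
    module ρʰ = IsRingHomomorphism ρ.isRingHomomorphism
  open KAlgebra A hiding (zero)
  open IsAntimorphism σ-anti
  open Matrices A hiding (algebra)
  open Sum semiring using (sum)
  open SetoidReasoning setoid

  transposed : V.Carrier → Matrix n n
  transposed v = mapEntries σ (transpose (ρ.⟦ τ v ⟧))

  private
    σ-sum : ∀ {m} (f : Fin m → Carrier) → σ (sum f) ≈ sum (σ ∘ f)
    σ-sum {0} f = σ-0
    σ-sum {ℕ.suc m} f = trans (σ-+ _ _) (+-congˡ (σ-sum (f ∘ Fin.suc)))

  transposed-cong : ∀ {u v} → u V.≈ v → transposed u ≋ transposed v
  transposed-cong p i j = σ-cong (ρʰ.⟦⟧-cong (τ.σ-cong p) j i)

  transposed-+ : ∀ u v i j → transposed (u V.+ v) i j ≈ transposed u i j + transposed v i j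
  transposed-+ u v i j = trans (σ-cong (trans (ρʰ.⟦⟧-cong (τ.σ-+ u v) j i) (ρʰ.+-homo (τ u) (τ v) j i))) (σ-+ _ _)

  -- The order is reversed by τ and restored by transposition; σ reverses the two factors in every
  -- summand, which transposition needs over a noncommutative ring.
  transposed-* : ∀ u v → transposed (u V.* v) ≋ transposed u ⊡ transposed v
  transposed-* u v i j = begin
    σ (ρ.⟦ τ (u V.* v) ⟧ j i)
      ≈⟨ σ-cong (trans (ρʰ.⟦⟧-cong (τ.σ-* u v) j i) (ρʰ.*-homo (τ v) (τ u) j i)) ⟩
    σ (sum λ h → ρ.⟦ τ v ⟧ j h * ρ.⟦ τ u ⟧ h i)
      ≈⟨ σ-sum (λ h → ρ.⟦ τ v ⟧ j h * ρ.⟦ τ u ⟧ h i) ⟩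
    sum (λ h → σ (ρ.⟦ τ v ⟧ j h * ρ.⟦ τ u ⟧ h i))
      ≈⟨ sum-cong (λ h → σ-* (ρ.⟦ τ v ⟧ j h) (ρ.⟦ τ u ⟧ h i)) ⟩
    (transposed u ⊡ transposed v) i j
      ∎

  transposed-η : ∀ c → transposed (V.η c) ≋ diagonal λ _ → η c
  transposed-η c i j = trans (σ-cong (trans (ρʰ.⟦⟧-cong (τ.σ-η c) j i) (ρ.η-homo c j i))) (lemma i j)
    where
    lemma : ∀ i j → σ (diagonal (λ _ → η c) j i) ≈ diagonal (λ _ → η c) i j
    lemma i j rewrite ≟-sym j i with i ≟ j
    ... | yes _ = σ-η c
    ... | no _ = σ-0

  transposed-1 : transposed V.1# ≋ diagonal λ _ → 1#
  transposed-1 i j = trans (transposed-cong (V.sym V.η-1) i j) (trans (transposed-η _ i j) (diagonal-cong (λ _ → η-1) i j))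

  module _ (α : Matrix 1 n) (β : Matrix n 1) where
    private
      form : Matrix n n → Carrier
      form M = (α ⊡ M ⊡ β) 0F 0F

    open Sum semiring using (∑-distrib-+; *-distribˡ-sum)

    form-+ : ∀ {L M N} → (∀ i j → L i j ≈ M i j + N i j) → form L ≈ form M + form N
    form-+ {L} {M} {N} p = begin
      sum (λ j → sum (λ i → α 0F i * L i j) * β j 0F)
        ≈⟨ sum-cong (λ j → *-congʳ (trans (sum-cong (λ i → trans (*-congˡ (p i j)) (distribˡ (α 0F i) (M i j) (N i j))))
             (∑-distrib-+ (λ i → α 0F i * M i j) (λ i → α 0F i * N i j)))) ⟩
      sum (λ j → ((α ⊡ M) 0F j + (α ⊡ N) 0F j) * β j 0F)
        ≈⟨ sum-cong (λ j → distribʳ (β j 0F) ((α ⊡ M) 0F j) ((α ⊡ N) 0F j)) ⟩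
      sum (λ j → (α ⊡ M) 0F j * β j 0F + (α ⊡ N) 0F j * β j 0F)
        ≈⟨ ∑-distrib-+ (λ j → (α ⊡ M) 0F j * β j 0F) (λ j → (α ⊡ N) 0F j * β j 0F) ⟩
      form M + form N
        ∎

    form-• : ∀ {c L M} → (∀ i j → L i j ≈ c • M i j) → form L ≈ c • form M
    form-• {c} {L} {M} p = begin
      sum (λ j → sum (λ i → α 0F i * L i j) * β j 0F)
        ≈⟨ sum-cong (λ j → *-congʳ (trans (sum-cong (λ i → pull (α 0F i) (p i j)))
             (sym (*-distribˡ-sum (η c) (λ i → α 0F i * M i j))))) ⟩
      sum (λ j → η c * (α ⊡ M) 0F j * β j 0F)
        ≈⟨ sum-cong (λ j → *-assoc (η c) ((α ⊡ M) 0F j) (β j 0F)) ⟩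
      sum (λ j → η c * ((α ⊡ M) 0F j * β j 0F))
        ≈⟨ *-distribˡ-sum (η c) (λ j → (α ⊡ M) 0F j * β j 0F) ⟨
      η c * form M
        ∎
      where
      pull : ∀ x {y z} → y ≈ c • z → x * y ≈ c • (x * z)
      pull x {y} {z} q = trans (*-congˡ q) (trans (sym (*-assoc x (η c) z)) (trans (*-congʳ (sym (η-central c x))) (*-assoc (η c) x z)))

    transposed-form-linear : IsLinear V A (form ∘ transposed)
    transposed-form-linear = record
      { cong = λ p → sum-cong λ j → *-congʳ {β j 0F} (sum-cong λ i → *-congˡ {α 0F i} (transposed-cong p i j))
      ; +-homo = λ u v → form-+ (transposed-+ u v)
      -- A scalar acts as multiplication by η c, so homogeneity follows from multiplicativity and
      -- the diagonal image of η c.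
      ; •-homo = λ c v → form-• λ i j → trans (transposed-* (V.η c) v i j)
          (trans (sum-cong λ h → *-congʳ {transposed v h j} (transposed-η c i h)) (diagonal-⊡ _ (transposed v) i j)) }

module _ {c ℓ g e b s} {k : CommutativeRing c ℓ} {G : Group g e} {B : KAlgebra k b s} where
  private
    module k = CommutativeRing k
    module B = KAlgebra B
    𝐤G = GroupAlgebra.algebra k G
    module A = KAlgebra 𝐤G

  linear-ext : ∀ {f h} → IsLinear 𝐤G B f → IsLinear 𝐤G B h →
    (∀ x → f [ k.1# , x ] B.≈ h [ k.1# , x ]) → ∀ v → f v B.≈ h v
  linear-ext {f} {h} F H p = go
    where
    module F = IsLinear F
    module H = IsLinear H

    zero : ∀ {f} → IsLinear 𝐤G B f → f [] B.≈ B.0#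
    zero L = RingProperties.x+x≈x⇒x≈0 B.ring _ (B.sym (IsLinear.+-homo L [] []))

    go : ∀ v → f v B.≈ h v
    go [] = B.trans (zero F) (B.sym (zero H))
    go ((c , x) ∷ v) = B.trans (F.+-homo [ c , x ] v) (B.trans (B.+-cong term (go v)) (B.sym (H.+-homo [ c , x ] v)))
      where
      term : f [ c , x ] B.≈ h [ c , x ]
      term = B.trans (F.cong (⌜⌝-scale k G c x)) (B.trans (F.•-homo c [ k.1# , x ]) (B.trans (B.*-congˡ (p x))
        (B.trans (B.sym (H.•-homo c [ k.1# , x ])) (H.cong (A.sym (⌜⌝-scale k G c x))))))

-- This is y = 1 - (x - 1) y, placed between g and h(x - 1).
cut-identity : ∀ {a r} (R : Ring a r) → let open Ring R in ∀ {x y} → x * y ≈ 1# → ∀ g h →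
  g * (y * h) * (x - 1#) ≈ g * h * (x - 1#) - g * (x - 1#) * (y * (h * (x - 1#)))
cut-identity R {x} {y} xy≈1 g h = begin
  g * (y * h) * e                      ≈⟨ trans (*-assoc _ _ _) (*-congˡ (*-assoc _ _ _)) ⟩
  g * (y * z)                          ≈⟨ //-rightDividesʳ (g * e * (y * z)) (g * (y * z)) ⟨
  g * (y * z) + g * e * (y * z) - g * e * (y * z)
    ≈⟨ +-congʳ (+-congˡ (trans (*-assoc _ _ _) (*-congˡ (sym (*-assoc _ _ _))))) ⟩
  g * (y * z) + g * (e * y * z) - g * e * (y * z)
    ≈⟨ +-congʳ (trans (sym (distribˡ _ _ _)) (*-congˡ (sym (distribʳ _ _ _)))) ⟩
  g * ((y + e * y) * z) - g * e * (y * z)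
    ≈⟨ +-congʳ (*-congˡ (*-congʳ (begin
      y + (x - 1#) * y   ≈⟨ +-congˡ (trans ([y-z]x≈yx-zx _ _ _) (+-cong xy≈1 (-‿cong (*-identityˡ y)))) ⟩
      y + (1# - y)       ≈⟨ trans (+-comm _ _) (//-rightDividesˡ y 1#) ⟩
      1#                 ∎))) ⟩
  g * (1# * z) - g * e * (y * z)
    ≈⟨ +-congʳ (trans (*-congˡ (*-identityˡ z)) (sym (*-assoc _ _ _))) ⟩
  g * h * e - g * e * (y * z)          ∎
  where
  open Ring R
  open RingProperties R
  open SetoidReasoning setoid
  e = x - 1#
  z = h * e

-- Comparison of the coproduct with the matrix coefficient.

module Comparison {c ℓ} (k : CommutativeRing c ℓ) where
  open Betti k
  private
    module k = CommutativeRing k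
    module V = KAlgebra 𝒱
    module T = KAlgebra 𝒱⊗𝒱.algebra
    module W = KAlgebra 𝒲
    module WW = KAlgebra 𝒲⊗𝒲.algebra
    module U = Units 𝒱
    module ⊗ = TensorProperties 𝒱 𝒱
    open ⊗ using (left; right)
    open 𝒱⊗𝒱 using (_⊗ᵘ_)
    open Group U.units using () renaming (ε to 1ᵘ)
    open Group F₂.group using (_∙_; _⁻¹) renaming (Carrier to Word)

    x₀ x₁ : Word
    x₀ = F₂.generator 0F
    x₁ = F₂.generator 1F

    x₀^ : ℤ → Word
    x₀^ = _^ᶻ_ F₂.group x₀

    ⌜_⌝ : Word → V.Carrier
    ⌜ g ⌝ = U.value 𝐤F₂.⌜ g ⌝

    e : V.Carrier
    e = ⌜ x₁ ⌝ V.- V.1#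

    X₁⁻¹ : V.Carrier
    X₁⁻¹ = ⌜ x₁ ⁻¹ ⌝

    𝐗 𝐘 : Word → Units.Unit 𝒱⊗𝒱.algebra
    𝐗 g = 𝐤F₂.⌜ g ⌝ ⊗ᵘ 1ᵘ
    𝐘 g = 1ᵘ ⊗ᵘ 𝐤F₂.⌜ g ⌝

  open DualRepresentation 𝒱⊗𝒱.algebra (𝐗 x₀) (𝐗 x₁) (𝐘 x₀) (𝐘 x₁)
    (𝒱⊗𝒱.⊗-comm _ _) (𝒱⊗𝒱.⊗-comm _ _) (𝒱⊗𝒱.⊗-comm _ _)

  op-antimorphism : IsAntimorphism 𝒱 𝐤F₂.op
  op-antimorphism = record { σ-cong = op-cong k F₂.group ; σ-+ = op-+ k F₂.group ; σ-* = op-* k F₂.group ; σ-η = op-η k F₂.group }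

  private
    op-linear : IsLinear 𝒱 𝒱 𝐤F₂.op
    op-linear = op-isLinear k F₂.group

    module Op₂ = TensorMap 𝒱 𝒱 𝒱 𝒱 op-linear op-linear

  op₂-antimorphism : IsAntimorphism 𝒱⊗𝒱.algebra op₂
  op₂-antimorphism = record
    { σ-cong = Op₂.tensorMap-cong
    ; σ-+ = Op₂.tensorMap-+
    ; σ-* = Op₂.tensorMap-anti-* (op-* k F₂.group) (op-* k F₂.group)
    ; σ-η = λ c → T.refl }

  private
    module Op₂′ = IsAntimorphism op₂-antimorphism
    module N = Transposed 𝒱 𝒱⊗𝒱.algebra op-antimorphism op₂-antimorphism ρ

    N : Word → Matrix 3 3
    N g = N.transposed ⌜ g ⌝

    -- The six values of `op₂` hold by computation, because each argument is a single pure tensor of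
    -- words.
    module Coefficient = Coefficients op₂-antimorphism T.refl T.refl T.refl T.refl T.refl T.refl
      N (λ p → N.transposed-cong (⌜⌝-cong k F₂.group p))
      (λ g h i j → T.trans (N.transposed-cong (⌜⌝-∙ k F₂.group g h) i j) (N.transposed-* ⌜ g ⌝ ⌜ h ⌝ i j))
      N.transposed-1
      (λ i j → Op₂′.σ-cong (ρ[X₀]≋ρX₀ j i))
      (λ i j → Op₂′.σ-cong (ρ[X₁]≋ρX₁ j i))

  open AlgebraHom

  module _ (Δ : AlgebraHom 𝒲 𝒲⊗𝒲.algebra) (isΔ : IsΔ^𝒲 Δ) where
    private
      module Δ = IsRingHomomorphism (isRingHomomorphism Δ)
      module isΔ = IsΔ^𝒲 isΔ
      open SetoidReasoning T.setoid

      proj₁-linear : IsLinear 𝒲 𝒱 proj₁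
      proj₁-linear = record { cong = id ; +-homo = λ _ _ → V.refl ; •-homo = λ _ _ → V.refl }

      module Incl = TensorMap 𝒲 𝒲 𝒱 𝒱 proj₁-linear proj₁-linear

      incl-* : ∀ x y → inclusion (x WW.* y) T.≈ inclusion x T.* inclusion y
      incl-* = Incl.tensorMap-* (λ _ _ → V.refl) (λ _ _ → V.refl)

      incl-sub : ∀ x y → inclusion (x WW.- y) T.≈ inclusion x T.- inclusion y
      incl-sub x y = T.trans (Incl.tensorMap-+ x (WW.- y)) (T.+-congˡ {inclusion x}
        (additive⇒neg WW.ring T.ring inclusion Incl.tensorMap-cong Incl.tensorMap-+ y))

      Ψ : W.Carrier → T.Carrier
      Ψ x = inclusion (⟦ Δ ⟧ x)

      Ψ-cong : ∀ {x y} → proj₁ x V.≈ proj₁ y → Ψ x T.≈ Ψ y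
      Ψ-cong {x} {y} p = Incl.tensorMap-cong (Δ.⟦⟧-cong {x} {y} p)

      Ψ-+ : ∀ x y → Ψ (x W.+ y) T.≈ Ψ x T.+ Ψ y
      Ψ-+ x y = T.trans (Incl.tensorMap-cong (Δ.+-homo x y)) (Incl.tensorMap-+ (⟦ Δ ⟧ x) (⟦ Δ ⟧ y))

      Ψ-* : ∀ x y → Ψ (x W.* y) T.≈ Ψ x T.* Ψ y
      Ψ-* x y = T.trans (Incl.tensorMap-cong (Δ.*-homo x y)) (incl-* (⟦ Δ ⟧ x) (⟦ Δ ⟧ y))

      Ψ-sub : ∀ x y → Ψ (x W.- y) T.≈ Ψ x T.- Ψ y
      Ψ-sub x y = T.trans (Ψ-+ x (W.- y)) (T.+-congˡ {Ψ x} (additive⇒neg W.ring T.ring Ψ (λ {x} {y} → Ψ-cong {x} {y}) Ψ-+ y))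

      Ψ-η : ∀ c → Ψ (W.η c) T.≈ T.η c
      Ψ-η c = Incl.tensorMap-cong (η-homo Δ c)

      0⊕_·e : V.Carrier → W.Carrier
      0⊕ v ·e = k.0# ⊕ v ·e

      0⊕≈ : ∀ v → proj₁ (0⊕ v ·e) V.≈ v V.* e
      0⊕≈ v = V.trans (V.+-congʳ {v V.* e} V.η-0) (V.+-identityˡ (v V.* e))

      L : V.Carrier → T.Carrier
      L v = Ψ 0⊕ v ·e

      -- Elements of `𝒲` carry a decomposition but are compared in `𝒱`. Hence L v may be evaluated
      -- at any sum, product or generator with value v(X₁ - 1), whatever decomposition it carries.
      L-≈ : ∀ {v x} → v V.* e V.≈ proj₁ x → L v T.≈ Ψ x
      L-≈ {v} {x} p = Ψ-cong {0⊕ v ·e} {x} (V.trans (0⊕≈ v) p)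

      Ψ-⊕ : ∀ l v → Ψ (l ⊕ v ·e) T.≈ T.η l T.+ L v
      Ψ-⊕ l v = T.trans (Ψ-cong {l ⊕ v ·e} {W.η l W.+ 0⊕ v ·e} (V.+-congˡ {V.η l} (V.sym (0⊕≈ v))))
        (T.trans (Ψ-+ (W.η l) 0⊕ v ·e) (T.+-congʳ {L v} (Ψ-η l)))

      L-linear : IsLinear 𝒱 𝒱⊗𝒱.algebra L
      L-linear = record
        { cong = λ {u} {v} p → L-≈ {u} {0⊕ v ·e} (V.trans (V.*-congʳ {e} p) (V.sym (0⊕≈ v)))
        ; +-homo = λ u v → T.trans
            (L-≈ {u V.+ v} {0⊕ u ·e W.+ 0⊕ v ·e} (V.trans (V.distribʳ e u v) (V.sym (V.+-cong (0⊕≈ u) (0⊕≈ v)))))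
            (Ψ-+ 0⊕ u ·e 0⊕ v ·e)
        ; •-homo = λ c v → T.trans
            (L-≈ {c V.• v} {W.η c W.* 0⊕ v ·e} (V.trans (V.*-assoc (V.η c) v e) (V.*-congˡ {V.η c} (V.sym (0⊕≈ v)))))
            (T.trans (Ψ-* (W.η c) 0⊕ v ·e) (T.*-congʳ {L v} (Ψ-η c))) }

      Λ : Word → T.Carrier
      Λ g = L ⌜ g ⌝

      Ψ-X₁⁻¹ : Ψ X₁⁻¹∈𝒲 T.≈ w⁻¹
      Ψ-X₁⁻¹ = T.trans (Incl.tensorMap-cong isΔ.Δ-X₁⁻¹) (⊗.left-right X₁⁻¹ X₁⁻¹)

      -- `cut-identity` rewrites the argument with elements of `𝒲` only, and then Δ can be applied
      -- factor by factor.
      Λ-cut : ∀ g h → Λ (g ∙ (x₁ ⁻¹ ∙ h)) T.≈ Λ (g ∙ h) T.- Λ g T.* (w⁻¹ T.* Λ h)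
      Λ-cut g h = begin
        Λ (g ∙ (x₁ ⁻¹ ∙ h))
          ≈⟨ L-≈ {⌜ g ∙ (x₁ ⁻¹ ∙ h) ⌝} {0⊕ ⌜ g ∙ h ⌝ ·e W.- 0⊕ ⌜ g ⌝ ·e W.* (X₁⁻¹∈𝒲 W.* 0⊕ ⌜ h ⌝ ·e)} in-V ⟩
        Ψ (0⊕ ⌜ g ∙ h ⌝ ·e W.- 0⊕ ⌜ g ⌝ ·e W.* (X₁⁻¹∈𝒲 W.* 0⊕ ⌜ h ⌝ ·e))
          ≈⟨ Ψ-sub 0⊕ ⌜ g ∙ h ⌝ ·e (0⊕ ⌜ g ⌝ ·e W.* (X₁⁻¹∈𝒲 W.* 0⊕ ⌜ h ⌝ ·e)) ⟩
        Λ (g ∙ h) T.- Ψ (0⊕ ⌜ g ⌝ ·e W.* (X₁⁻¹∈𝒲 W.* 0⊕ ⌜ h ⌝ ·e))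
          ≈⟨ T.+-congˡ {Λ (g ∙ h)} (T.-‿cong (T.trans (Ψ-* 0⊕ ⌜ g ⌝ ·e (X₁⁻¹∈𝒲 W.* 0⊕ ⌜ h ⌝ ·e))
               (T.*-congˡ {Λ g} (T.trans (Ψ-* X₁⁻¹∈𝒲 0⊕ ⌜ h ⌝ ·e) (T.*-congʳ {Λ h} Ψ-X₁⁻¹))))) ⟩
        Λ (g ∙ h) T.- Λ g T.* (w⁻¹ T.* Λ h)
          ∎
        where
        in-V : ⌜ g ∙ (x₁ ⁻¹ ∙ h) ⌝ V.* e V.≈ proj₁ (0⊕ ⌜ g ∙ h ⌝ ·e) V.- proj₁ (0⊕ ⌜ g ⌝ ·e) V.* (X₁⁻¹ V.* proj₁ (0⊕ ⌜ h ⌝ ·e))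
        in-V = V.trans
          (V.*-congʳ {e} (V.trans (⌜⌝-∙ k F₂.group g (x₁ ⁻¹ ∙ h)) (V.*-congˡ {⌜ g ⌝} (⌜⌝-∙ k F₂.group (x₁ ⁻¹) h))))
          (V.trans (cut-identity V.ring {⌜ x₁ ⌝} {X₁⁻¹} (U.inverseʳ 𝐤F₂.⌜ x₁ ⌝) ⌜ g ⌝ ⌜ h ⌝)
          (V.+-cong
            (V.sym (V.trans (0⊕≈ ⌜ g ∙ h ⌝) (V.*-congʳ {e} (⌜⌝-∙ k F₂.group g h))))
            (V.-‿cong (V.sym (V.*-cong (0⊕≈ ⌜ g ⌝) (V.*-congˡ {X₁⁻¹} (0⊕≈ ⌜ h ⌝)))))))

      p q : ℤ → T.Carrier
      p n = left ⌜ x₀^ n ⌝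
      q n = right ⌜ x₀^ n ⌝

      ⌜x₀^⌝-suc : ∀ n → ⌜ x₀^ (ℤ.suc n) ⌝ V.≈ ⌜ x₀^ n ⌝ V.* ⌜ x₀ ⌝
      ⌜x₀^⌝-suc n = V.trans (⌜⌝-cong k F₂.group (^ᶻ-sucʳ F₂.group x₀ n)) (⌜⌝-∙ k F₂.group (x₀^ n) x₀)

      p-suc : ∀ n → p (ℤ.suc n) T.≈ p n T.* left ⌜ x₀ ⌝
      p-suc n = T.trans (⊗.left-cong (⌜x₀^⌝-suc n)) (⊗.left-* ⌜ x₀^ n ⌝ ⌜ x₀ ⌝)

      q-suc : ∀ n → q (ℤ.suc n) T.≈ q n T.* right ⌜ x₀ ⌝
      q-suc n = T.trans (⊗.right-cong (⌜x₀^⌝-suc n)) (⊗.right-* ⌜ x₀^ n ⌝ ⌜ x₀ ⌝)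

      e₁ e₂ : T.Carrier
      e₁ = left ⌜ x₁ ⌝ T.- T.1#
      e₂ = right ⌜ x₁ ⌝ T.- T.1#

      left-·e : ∀ n → left (⌜ x₀^ n ⌝ V.* e) T.≈ p n T.* e₁
      left-·e n = T.trans (⊗.left-* ⌜ x₀^ n ⌝ e) (T.*-congˡ {p n} (⊗.left-sub ⌜ x₁ ⌝ V.1#))

      right-·e : ∀ n → right (⌜ x₀^ n ⌝ V.* e) T.≈ q n T.* e₂
      right-·e n = T.trans (⊗.right-* ⌜ x₀^ n ⌝ e) (T.*-congˡ {q n} (⊗.right-sub ⌜ x₁ ⌝ V.1#))

      a : ℤ → W.Carrier
      a n = X₀^ n [X₁-1]∈𝒲

      term : ℤ → ℤ → T.Carrier
      term n j = p j T.* e₁ T.* q (n ℤ.- j)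

      module Rʸ = Recurrences 𝒱⊗𝒱.algebra (𝐘 x₀)

      Q : ℤ → T.Carrier
      Q = Rʸ.truncated q T.refl q-suc λ j → p j T.* e₁

      a⊗a : ∀ n j → inclusion (a j 𝒲⊗𝒲.⊗ a (n ℤ.- j)) T.≈ term n j T.* e₂
      a⊗a n j = T.trans (⊗.left-right (⌜ x₀^ j ⌝ V.* e) (⌜ x₀^ (n ℤ.- j) ⌝ V.* e))
        (T.trans (T.*-cong (left-·e j) (right-·e (n ℤ.- j))) (T.sym (T.*-assoc (p j T.* e₁) (q (n ℤ.- j)) e₂)))

      -- Every summand except the first ends in a right factor Y₁ - 1; pulling it out through the
      -- sum leaves the truncated power series `Q`.
      Λ-x₀^ : ∀ n → Λ (x₀^ n) T.≈ p n T.* e₁ T.+ Q n T.* e₂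
      Λ-x₀^ n = begin
        Λ (x₀^ n)
          ≈⟨ L-≈ {⌜ x₀^ n ⌝} {a n} V.refl ⟩
        Ψ (a n)
          ≈⟨ Incl.tensorMap-cong (isΔ.Δ-X₀ⁿ[X₁-1] n) ⟩
        inclusion ((a n 𝒲⊗𝒲.⊗ W.1# WW.+ W.1# 𝒲⊗𝒲.⊗ a n) WW.- S)
          ≈⟨ incl-sub (a n 𝒲⊗𝒲.⊗ W.1# WW.+ W.1# 𝒲⊗𝒲.⊗ a n) S ⟩
        (left (⌜ x₀^ n ⌝ V.* e) T.+ right (⌜ x₀^ n ⌝ V.* e)) T.- inclusion S
          ≈⟨ T.+-cong (T.+-cong (left-·e n) (right-·e n)) (T.-‿cong incl-S) ⟩
        (p n T.* e₁ T.+ q n T.* e₂) T.- S′ T.* e₂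
          ≈⟨ T.+-assoc (p n T.* e₁) (q n T.* e₂) (T.- (S′ T.* e₂)) ⟩
        p n T.* e₁ T.+ (q n T.* e₂ T.- S′ T.* e₂)
          ≈⟨ T.+-congˡ {p n T.* e₁} (RingProperties.[y-z]x≈yx-zx T.ring e₂ (q n) S′) ⟨
        p n T.* e₁ T.+ Q n T.* e₂
          ∎
        where
        S : WW.Carrier
        S = intervalSum WW.ring (+ 1) (n ℤ.- + 1) (λ j → a j 𝒲⊗𝒲.⊗ a (n ℤ.- j))

        S′ : T.Carrier
        S′ = intervalSum T.ring (+ 1) (n ℤ.- + 1) (term n)

        incl-S : inclusion S T.≈ S′ T.* e₂
        incl-S = begin
          inclusion S
            ≈⟨ intervalSum-homo WW.ring T.ring inclusion Incl.tensorMap-cong Incl.tensorMap-+ (+ 1) (n ℤ.- + 1) (λ j → a j 𝒲⊗𝒲.⊗ a (n ℤ.- j)) ⟩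
          intervalSum T.ring (+ 1) (n ℤ.- + 1) (λ j → inclusion (a j 𝒲⊗𝒲.⊗ a (n ℤ.- j)))
            ≈⟨ intervalSum-cong T.ring (+ 1) (n ℤ.- + 1) (a⊗a n) ⟩
          intervalSum T.ring (+ 1) (n ℤ.- + 1) (λ j → term n j T.* e₂)
            ≈⟨ intervalSum-homo T.ring T.ring (T._* e₂) (T.*-congʳ {e₂}) (T.distribʳ e₂) (+ 1) (n ℤ.- + 1) (term n) ⟨
          S′ T.* e₂
            ∎

      agree : ∀ n → Λ (x₀^ n) T.≈ Coefficient.coefficient (x₀^ n)
      agree n = T.trans (Λ-x₀^ n) (T.sym (Coefficient.coefficient-x₀^ p q T.refl T.refl p-suc q-suc n))

      Λ-cuttable : Cutting.Cuttable 𝒱⊗𝒱.algebra 𝐰 Λ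
      Λ-cuttable = record
        { cong = λ g∼h → IsLinear.cong L-linear (⌜⌝-cong k F₂.group g∼h)
        ; cut = Λ-cut
        -- The empty word is x₀ to the power 0, so the normalisation is inherited from the matrix
        -- side.
        ; F-ε = T.trans (agree 0ℤ) (Cutting.Cuttable.F-ε Coefficient.coefficient-cuttable) }

    Δ≈matrix : ∀ l v → inclusion (⟦ Δ ⟧ (l ⊕ v ·e)) T.≈ l T.• (V.1# 𝒱⊗𝒱.⊗ V.1#) T.+ (row ⊡ rρ v ⊡ col) 0F 0F
    Δ≈matrix l v = T.trans (Ψ-⊕ l v) (T.+-cong (T.sym (T.*-identityʳ (T.η l)))
      -- Both sides are linear in v, which reduces the claim to words, where uniqueness of cuttable
      -- functions applies.
      (T.trans (linear-ext {k = k} {G = F₂.group} {B = 𝒱⊗𝒱.algebra} L-linear (N.transposed-form-linear α β)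
         (Cutting.cuttable-unique 𝒱⊗𝒱.algebra 𝐰 Λ-cuttable Coefficient.coefficient-cuttable agree) v)
       (T.sym (conjugate (N.transposed v) 0F 0F))))

theorem3p5 : ∀ {c ℓ} (k : CommutativeRing c ℓ) →
    let module k = CommutativeRing k
        open Betti k
        module V = KAlgebra 𝒱
        module V⊗V = KAlgebra 𝒱⊗𝒱.algebra
    in
    (ι : ℚ → k.Carrier) → IsRingHomomorphism +-*-rawRing k.rawRing ι →
    (Δ : AlgebraHom 𝒲 𝒲⊗𝒲.algebra) → IsΔ^𝒲 Δ →
    ∀ (l : k.Carrier) (v : V.Carrier) →
    inclusion (AlgebraHom.⟦_⟧ Δ (l ⊕ v ·e))
      V⊗V.≈ l V⊗V.• (V.1# 𝒱⊗𝒱.⊗ V.1#) V⊗V.+ (row ⊡ rρ v ⊡ col) 0F 0F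
theorem3p5 k ι ι-hom Δ isΔ = Comparison.Δ≈matrix k Δ isΔ
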